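{- Let $G$ be a connected 4-regular graph and let $p$ be any prime. Let $v$ and $w$ be adjacent vertices of $G$ which have exactly two common neighbours. Then \[ c_2^{(p)}(G - v) = c_2^{(p)}(G - w), \] and thus $c_2(G - v) = c_2(G - w)$.
   Context: For a graph $H$, $H-v$ denotes the graph obtained by deleting the vertex $v$ and all edges incident to it. For a connected graph $H$ with at least $3$ vertices, assign a variable $\alpha_e$ to each edge $e$ and define the Kirchhoff polynomial $\Psi_H=\sum_{T}\prod_{e\notin T}\alpha_e$, the sum over all spanning trees $T$ of $H$. For a prime $p$, let $[\Psi_H]_p$ be the number of zeros of $\Psi_H$ in $\mathbb{F}_p^{|E(H)|}$; it is divisible by $p^2$, and $c_2^{(p)}(H)\equiv [\Psi_H]_p/p^2 \pmod p$, an element of $\mathbb{Z}/p\mathbb{Z}$. The $c_2$-invariant $c_2(H)$ denotes the sequence $(c_2^{(p)}(H))_p$ indexed by all primes $p$. -}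

module Defs where

open import Data.Bool using (Bool; true; false; _∧_; _∨_; not; if_then_else_)
open import Data.Nat using (ℕ; zero; suc; _+_; _*_; _∸_; _<ᵇ_; _≡ᵇ_)
open import Data.Nat.DivMod using (_/_; _%_)
open import Data.Fin using (Fin; toℕ; punchIn)
open import Data.Fin.Properties using (_≟_)
open import Data.List using (List; []; _∷_; length; map; concatMap; allFin; foldr; upTo)
open import Data.Product using (_×_; _,_; proj₁; proj₂)
open import Relation.Nullary.Decidable using (⌊_⌋)
open import Relation.Binary.PropositionalEquality using (_≡_)

bfilter : ∀ {A : Set} → (A → Bool) → List A → List A
bfilter f []       = []
bfilter f (x ∷ xs) = if f x then x ∷ bfilter f xs else bfilter f xs

anyB : ∀ {A : Set} → (A → Bool) → List A → Bool
anyB f = foldr (λ x b → f x ∨ b) false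

allB : ∀ {A : Set} → (A → Bool) → List A → Bool
allB f = foldr (λ x b → f x ∧ b) true

sumL : List ℕ → ℕ
sumL = foldr _+_ 0

productL : List ℕ → ℕ
productL = foldr _*_ 1

record Graph (n : ℕ) : Set where
  field
    adj    : Fin n → Fin n → Bool
    sym    : ∀ i j → adj i j ≡ adj j i
    irrefl : ∀ i → adj i i ≡ false
open Graph public

deleteVertex : ∀ {n} → Graph (suc n) → Fin (suc n) → Graph n
deleteVertex G v = record
  { adj    = λ i j → adj G (punchIn v i) (punchIn v j)
  ; sym    = λ i j → sym G (punchIn v i) (punchIn v j)
  ; irrefl = λ i → irrefl G (punchIn v i) }

_==_ : ∀ {n} → Fin n → Fin n → Bool
i == j = ⌊ i ≟ j ⌋

edges : ∀ {n} → Graph n → List (Fin n × Fin n)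
edges {n} G = bfilter (λ e → adj G (proj₁ e) (proj₂ e) ∧ (toℕ (proj₁ e) <ᵇ toℕ (proj₂ e)))
                     (concatMap (λ i → map (λ j → i , j) (allFin n)) (allFin n))

step : ∀ {n} → List (Fin n × Fin n) → (Fin n → Bool) → (Fin n → Bool)
step T S v = S v ∨ anyB (λ e → (S (proj₁ e) ∧ (proj₂ e == v)) ∨ (S (proj₂ e) ∧ (proj₁ e == v))) T

iter : ∀ {n} → ℕ → List (Fin n × Fin n) → (Fin n → Bool) → (Fin n → Bool)
iter zero    T S = S
iter (suc k) T S = step T (iter k T S)

connectedE : ∀ {n} → List (Fin n × Fin n) → Bool
connectedE {zero}  T = true
connectedE {suc n} T = allB (iter (suc n) T (λ v → v == Fin.zero)) (allFin (suc n))
  where import Data.Fin as Fin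

Connected : ∀ {n} → Graph n → Set
Connected G = connectedE (edges G) ≡ true

masks : ℕ → List (List Bool)
masks zero    = [] ∷ []
masks (suc m) = concatMap (λ b → map (b ∷_) (masks m)) (true ∷ false ∷ [])

select : ∀ {A : Set} → List Bool → List A → List A
select (true  ∷ bs) (x ∷ xs) = x ∷ select bs xs
select (false ∷ bs) (x ∷ xs) = select bs xs
select _ _ = []

isSpanningTree : ∀ {n} → List (Fin n × Fin n) → Bool
isSpanningTree {n} T = connectedE T ∧ (length T ≡ᵇ (n ∸ 1))

-- Value of the Kirchhoff polynomial Ψ_H = Σ_T Π_{e ∉ T} α_e at an integer
-- point α (a list of values, one per edge, in the order of 'edges H').
complement : List Bool → List Bool
complement = map not

kirchhoff : ∀ {n} → Graph n → List ℕ → ℕ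
kirchhoff G α =
  sumL (map (λ m → if isSpanningTree (select m (edges G))
                    then productL (select (complement m) α) else 0)
           (masks (length (edges G))))

-- All points of F_p^m, with F_p represented by {0, …, p-1}.
points : ℕ → ℕ → List (List ℕ)
points p zero    = [] ∷ []
points p (suc m) = concatMap (λ a → map (a ∷_) (points p m)) (upTo p)

zeroCount : ∀ {n} → ℕ → Graph n → ℕ
zeroCount zero    G = 0
zeroCount (suc q) G =
  length (bfilter (λ α → (kirchhoff G α % suc q) ≡ᵇ 0)
                 (points (suc q) (length (edges G))))

-- c_2^{(p)}(H) = ([Ψ_H]_p / p^2) mod p, an element of {0,…,p-1} ≅ Z/pZ.
c2 : ∀ {n} → ℕ → Graph n → ℕ
c2 zero    G = 0
c2 (suc q) G = ((zeroCount (suc q) G / suc q) / suc q) % suc q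

degree : ∀ {n} → Graph n → Fin n → ℕ
degree {n} G v = length (bfilter (λ u → adj G v u) (allFin n))

FourRegular : ∀ {n} → Graph n → Set
FourRegular G = ∀ v → degree G v ≡ 4

commonNeighbours : ∀ {n} → Graph n → Fin n → Fin n → ℕ
commonNeighbours {n} G v w = length (bfilter (λ u → adj G v u ∧ adj G w u) (allFin n))

{-# OPTIONS --safe #-}
-- Let v, w have common neighbours a, b and let c, d be the remaining neighbours of w and v, so that
-- G − v and G − w are K = G − {v, w} with a 3-valent vertex attached to a, b, c, respectively a, b, d.
-- All graph polynomials are written as D(X; Y) = Σ_S ∏_{e ∉ S} α_e det(S, X) det(S, Y), a bilinear
-- extension of the matrix-tree theorem. With f = D(∅; ∅), r = D(b−a; b−a), t = D(b−c; b−c) and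
-- s = D(b−a; b−c) over K, the Jacobi identity f h = r t − s² shows that the number of zeros of Ψ in the
-- three star variables is p², except where f = r = t = 0 when it is 0 or p³. So modulo p, c₂ is the number of
-- points of K at which f, r, t do not all vanish, which by inclusion–exclusion is a combination of
-- numbers of points where f, r, t, s, fr, ft, fs are non-zero.
-- Now a has exactly two edges in K, to a₁ and a₂. Modulo p, counting points where
-- (Ax + B)(Cx + E) ≠ 0 over x replaces the product by its resultant AE − BC up to terms free of x, and
-- eliminating both edges at a kills everything depending on c except fs, which becomes
-- D(∅; ∅) D(a₁−a₂; b−c) over K − a. Eliminating the edges at b in the same way replaces b − c by
-- b₁ − b₂ (or, if a and b are adjacent, leaves only D(∅; ∅)), and no trace of c remains.
module Submission where

open import Defs
open import Data.Bool using (Bool; true; false; not; if_then_else_; _∧_; _∨_)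
import Data.Bool as Bool
import Data.Bool.Properties as Bool
open import Data.Empty using (⊥; ⊥-elim)
open import Data.Fin as Fin using (Fin; toℕ; punchIn; punchOut)
open import Data.Fin.Properties using (_≟_; toℕ-injective; punchIn-injective; punchInᵢ≢i; punchIn-punchOut; punchIn-mono-≤; punchIn-cancel-≤)
open import Data.Integer using (ℤ; +_; -[1+_]; _+_; _*_; -_; _-_; 0ℤ; 1ℤ; ∣_∣)
open import Data.Integer.Divisibility.Signed using (_∣_; divides; _∣?_; ∣⇒∣ᵤ; ∣ᵤ⇒∣; ∣m∣n⇒∣m+n; ∣m⇒∣-m; ∣n⇒∣m*n; ∣m⇒∣m*n)
open import Data.Integer.DivMod using (_%ℕ_; _/ℕ_; n%ℕd<d; a≡a%ℕn+[a/ℕn]*n)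
import Data.Integer.Properties as ℤₚ
open import Data.Integer.Properties using (*-zeroˡ; *-zeroʳ; *-comm; *-identityˡ; *-identityʳ; neg-involutive; +-identityʳ; +-identityˡ; abs-*; pos-*)
open import Data.Integer.Tactic.RingSolver using (solve-∀)
open import Data.List using (List; []; _∷_; _++_; length; map; concatMap; allFin; upTo; tabulate; cartesianProduct)
import Data.List.Membership.DecPropositional as DecMembership
open import Data.List.Membership.Propositional using (_∈_; _∉_; find; lose)
open import Data.List.Membership.Propositional.Properties using (∈-allFin; ∈-upTo⁺; ∈-upTo⁻; ∈-++⁻; ∈-++⁺ˡ; ∈-++⁺ʳ; ∈-map⁺; ∈-map⁻; ∈-∃++; ∈-cartesianProduct⁺)
open import Data.List.Membership.Propositional.Properties.WithK using (unique∧set⇒bag)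
import Data.List.Properties as List
open import Data.List.Relation.Binary.BagAndSetEquality using (∼bag⇒↭)
open import Data.List.Relation.Binary.Permutation.Propositional as ↭ using (_↭_; ↭-sym; ↭-trans; ↭-refl; ↭-reflexive)
import Data.List.Relation.Binary.Permutation.Propositional.Properties as ↭
open import Data.List.Relation.Unary.All as All using (All; []; _∷_)
import Data.List.Relation.Unary.All.Properties as All
open import Data.List.Relation.Unary.AllPairs using ([]; _∷_)
open import Data.List.Relation.Unary.Any using (here; there; any?)
open import Data.List.Relation.Unary.Unique.Propositional using (Unique)
import Data.List.Relation.Unary.Unique.Propositional.Properties as Unique
open import Data.Nat as ℕ using (ℕ; zero; suc; NonZero; _<ᵇ_; _≡ᵇ_)
open import Data.Nat.Coprimality using (Coprime; coprime-Bézout)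
import Data.Nat.Divisibility as ℕ
open import Data.Nat.DivMod using (_/_; _%_; m*n/n≡m; [m+kn]%n≡m%n)
open import Data.Nat.GCD using (module Bézout)
open import Data.Nat.Primality using (Prime; euclidsLemma; prime⇒nonZero; prime⇒irreducible)
import Data.Nat.Properties as ℕₚ
open import Data.Product using (∃; _×_; _,_; proj₁; proj₂) renaming (swap to flipPair; map₁ to mapFst)
open import Data.Sum using (_⊎_; inj₁; inj₂; [_,_]′)
open import Data.Unit using (⊤; tt)
open import Function using (id)
open import Function.Bundles using (mk⇔)
open import Relation.Binary.Bundles using (Setoid)
open import Relation.Binary.Definitions using (tri<; tri≈; tri>)
open import Relation.Binary.PropositionalEquality as ≡ using (_≡_; _≢_; ≢-sym; cong; cong₂; subst; module ≡-Reasoning)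
open import Relation.Nullary using (Dec; yes; no; ¬_; does)
open import Relation.Nullary.Decidable using (_×-dec_; _⊎-dec_; ¬?)

-- Forms on lists of vectors take the place of matrices: grounding a vertex, using an edge and
-- appending a test vector such as b - a are all the insertion of one more vector. Every polynomial
-- is then a value of the same `D`, and the Plücker relations of the determinant are all that the
-- Jacobi identity needs. Elimination at a is governed by the a-coordinate of the test vectors. The
-- product of D(∅; ∅) with D(ξ; η), where η vanishes at a, reduces to an expression with the factor
-- ξ(a). This is 0 for b - c and -1 for b - a, so ft disappears and fs survives. It also explains
-- why s is brought in: where f = 0 the product rt equals s², and s, unlike rt, is linear in each
-- edge variable. Congruences modulo p suffice for these reductions, but the count over the star
-- variables has to be exact, because it is divided by p². Both vertex deletions are rooted at the
-- same vertex c. The two resulting forms over K then differ only in the order in which v and w are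
-- grounded, hence by a sign that `D` does not see, and only the vectors b - c and b - d tell the
-- two counts apart.

private variable
  A : Set

-- Alternating forms

self-neg⇒0 : ∀ x → x ≡ - x → x ≡ 0ℤ
self-neg⇒0 (+ zero) _ = ≡.refl
self-neg⇒0 (+ suc n) ()

-- The exterior product φ ∧ f, expanded along φ.
ext : (A → ℤ) → (List A → ℤ) → List A → ℤ
ext φ f []      = 0ℤ
ext φ f (x ∷ X) = φ x * f X - ext φ (λ Y → f (x ∷ Y)) X

ext-linʳ : ∀ {φ : A → ℤ} {f g h : List A → ℤ} c d → (∀ Y → h Y ≡ c * f Y + d * g Y) →
           ∀ X → ext φ h X ≡ c * ext φ f X + d * ext φ g X
ext-linʳ c d eq [] = identity c d
  where identity : ∀ c d → 0ℤ ≡ c * 0ℤ + d * 0ℤ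
        identity = solve-∀
ext-linʳ {φ = φ} {f} {g} {h} c d eq (x ∷ X) =
  ≡.trans (cong₂ (λ u v → φ x * u - v) (eq X) (ext-linʳ c d (λ Y → eq (x ∷ Y)) X))
        (identity c d (φ x) (f X) (g X) _ _)
  where identity : ∀ c d m u v s t → m * (c * u + d * v) - (c * s + d * t) ≡ c * (m * u - s) + d * (m * v - t)
        identity = solve-∀

ext-linˡ : ∀ {φ ψ χ : A → ℤ} {f : List A → ℤ} c d → (∀ a → χ a ≡ c * φ a + d * ψ a) →
           ∀ X → ext χ f X ≡ c * ext φ f X + d * ext ψ f X
ext-linˡ c d eq [] = identity c d
  where identity : ∀ c d → 0ℤ ≡ c * 0ℤ + d * 0ℤ
        identity = solve-∀
ext-linˡ {φ = φ} {ψ} {χ} {f} c d eq (x ∷ X) =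
  ≡.trans (cong₂ (λ u v → u * f X - v) (eq x) (ext-linˡ c d eq X)) (identity c d (φ x) (ψ x) (f X) _ _)
  where identity : ∀ c d u v m s t → (c * u + d * v) * m - (c * s + d * t) ≡ c * (u * m - s) + d * (v * m - t)
        identity = solve-∀

neg-as-comb : ∀ u → - u ≡ (- 1ℤ) * u + 0ℤ * u
neg-as-comb = solve-∀

ext-negʳ : ∀ {φ : A → ℤ} {f h : List A → ℤ} → (∀ Y → h Y ≡ - f Y) → ∀ X → ext φ h X ≡ - ext φ f X
ext-negʳ {φ = φ} {f} eq X = ≡.trans (ext-linʳ {g = f} (- 1ℤ) 0ℤ (λ Y → ≡.trans (eq Y) (neg-as-comb (f Y))) X)
                         (≡.sym (neg-as-comb (ext φ f X)))

ext-negˡ : ∀ {φ χ : A → ℤ} {f : List A → ℤ} → (∀ a → χ a ≡ - φ a) → ∀ X → ext χ f X ≡ - ext φ f X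
ext-negˡ {φ = φ} {χ} {f} eq X = ≡.trans (ext-linˡ {ψ = φ} (- 1ℤ) 0ℤ (λ a → ≡.trans (eq a) (neg-as-comb (φ a))) X)
                         (≡.sym (neg-as-comb (ext φ f X)))

ext-zeroˡ : ∀ {φ : A → ℤ} {f : List A → ℤ} → (∀ a → φ a ≡ 0ℤ) → ∀ X → ext φ f X ≡ 0ℤ
ext-zeroˡ p [] = ≡.refl
ext-zeroˡ {f = f} p (x ∷ X) = cong₂ _-_ (cong (_* f X) (p x)) (ext-zeroˡ p X)

ext-zeroʳ : ∀ {φ : A → ℤ} {f : List A → ℤ} → (∀ Y → f Y ≡ 0ℤ) → ∀ X → ext φ f X ≡ 0ℤ
ext-zeroʳ p [] = ≡.refl
ext-zeroʳ {φ = φ} p (x ∷ X) =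
  cong₂ _-_ (≡.trans (cong (φ x *_) (p X)) (*-zeroʳ (φ x))) (ext-zeroʳ (λ Y → p (x ∷ Y)) X)

-- Expanding both sides at x produces the same two terms φ(x) ψ∧f and ψ(x) φ∧f with opposite signs;
-- what remains is the claim for the form with x inserted.
ext-anticomm : ∀ (φ ψ : A → ℤ) (f : List A → ℤ) X → ext φ (ext ψ f) X ≡ - ext ψ (ext φ f) X
ext-anticomm φ ψ f [] = ≡.refl
ext-anticomm φ ψ f (x ∷ X) = begin
  φ x * ext ψ f X - ext φ (λ Y → ψ x * f Y - ext ψ (λ Z → f (x ∷ Z)) Y) X
    ≡⟨ cong (λ s → φ x * ext ψ f X - s) (expand φ ψ) ⟩
  φ x * ext ψ f X - (ψ x * ext φ f X + (- 1ℤ) * ext φ (ext ψ f′) X)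
    ≡⟨ cong (λ s → φ x * ext ψ f X - (ψ x * ext φ f X + (- 1ℤ) * s)) (ext-anticomm φ ψ f′ X) ⟩
  φ x * ext ψ f X - (ψ x * ext φ f X + (- 1ℤ) * - ext ψ (ext φ f′) X)
    ≡⟨ identity (φ x * ext ψ f X) (ψ x * ext φ f X) (ext ψ (ext φ f′) X) ⟩
  - (ψ x * ext φ f X - (φ x * ext ψ f X + (- 1ℤ) * ext ψ (ext φ f′) X))
    ≡⟨ cong (λ s → - (ψ x * ext φ f X - s)) (expand ψ φ) ⟨
  - (ψ x * ext φ f X - ext ψ (λ Y → φ x * f Y - ext φ (λ Z → f (x ∷ Z)) Y) X) ∎
  where
  open ≡-Reasoning
  f′ : List _ → ℤ
  f′ Z = f (x ∷ Z)
  minus : ∀ u v → u - v ≡ u + (- 1ℤ) * v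
  minus = solve-∀
  expand : ∀ φ ψ → ext φ (λ Y → ψ x * f Y - ext ψ f′ Y) X ≡ ψ x * ext φ f X + (- 1ℤ) * ext φ (ext ψ f′) X
  expand φ ψ = ext-linʳ (ψ x) (- 1ℤ) (λ Y → minus (ψ x * f Y) (ext ψ f′ Y)) X
  identity : ∀ u v s → u - (v + (- 1ℤ) * - s) ≡ - (v - (u + (- 1ℤ) * s))
  identity = solve-∀

ext-self : ∀ (φ : A → ℤ) f X → ext φ (ext φ f) X ≡ 0ℤ
ext-self φ f X = self-neg⇒0 _ (ext-anticomm φ φ f X)

Vector : ℕ → Set
Vector N = Fin N → ℤ

-- Vectors are functions, so z is only required to agree pointwise with the combination of x and y;
-- linearity in this form also makes f respect pointwise equality of vectors.
record IsAlternating {N} (f : List (Vector N) → ℤ) : Set where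
  field
    linear : ∀ P {x y z} Q c d → (∀ i → z i ≡ c * x i + d * y i) →
             f (P ++ z ∷ Q) ≡ c * f (P ++ x ∷ Q) + d * f (P ++ y ∷ Q)
    swap-at   : ∀ P x y Q → f (P ++ x ∷ y ∷ Q) ≡ - f (P ++ y ∷ x ∷ Q)
open IsAlternating

ext-alternating : ∀ {N} {φ : Vector N → ℤ} {f} →
  (∀ {x y z} c d → (∀ i → z i ≡ c * x i + d * y i) → φ z ≡ c * φ x + d * φ y) →
  IsAlternating f → IsAlternating (ext φ f)
ext-alternating {N} {φ} φ-lin alt = record { linear = lin alt ; swap-at = sw alt }
  where
  lin : ∀ {f} → IsAlternating f → ∀ P {x y z} Q c d → (∀ i → z i ≡ c * x i + d * y i) →
        ext φ f (P ++ z ∷ Q) ≡ c * ext φ f (P ++ x ∷ Q) + d * ext φ f (P ++ y ∷ Q)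
  lin {f} alt [] {x} {y} {z} Q c d eq =
    ≡.trans (cong₂ (λ u v → u * f Q - v) (φ-lin c d eq) (ext-linʳ c d (λ Y → linear alt [] Y c d eq) Q))
          (identity c d (φ x) (φ y) (f Q) _ _)
    where identity : ∀ c d u v m s t → (c * u + d * v) * m - (c * s + d * t) ≡ c * (u * m - s) + d * (v * m - t)
          identity = solve-∀
  lin {f} alt (p ∷ P) Q c d eq =
    ≡.trans (cong₂ (λ u v → φ p * u - v) (linear alt P Q c d eq)
            (lin (record { linear = λ P → linear alt (p ∷ P) ; swap-at = λ P → swap-at alt (p ∷ P) }) P Q c d eq))
          (identity c d (φ p) _ _ _ _)
    where identity : ∀ c d m u v s t → m * (c * u + d * v) - (c * s + d * t) ≡ c * (m * u - s) + d * (m * v - t)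
          identity = solve-∀
  sw : ∀ {f} → IsAlternating f → ∀ P x y Q → ext φ f (P ++ x ∷ y ∷ Q) ≡ - ext φ f (P ++ y ∷ x ∷ Q)
  sw {f} alt [] x y Q =
    ≡.trans (cong (λ s → φ x * f (y ∷ Q) - (φ y * f (x ∷ Q) - s))
                (ext-negʳ (swap-at alt [] x y) Q))
          (identity (φ x * f (y ∷ Q)) (φ y * f (x ∷ Q)) (ext φ (λ Y → f (y ∷ x ∷ Y)) Q))
    where identity : ∀ u v s → u - (v - - s) ≡ - (v - (u - s))
          identity = solve-∀
  sw {f} alt (p ∷ P) x y Q =
    ≡.trans (cong₂ (λ u v → φ p * u - v) (swap-at alt P x y Q)
             (sw (record { linear = λ P → linear alt (p ∷ P) ; swap-at = λ P → swap-at alt (p ∷ P) }) P x y Q))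
          (identity (φ p) _ _)
    where identity : ∀ m u v → m * - u - - v ≡ - (m * u - v)
          identity = solve-∀

-- Laplace expansion along the rows in the list, applied to a list of columns. A non-square array
-- gets the value 0, so a sum over all sets of edges needs no condition on their size.
detOn : ∀ {N} → List (Fin N) → List (Vector N) → ℤ
detOn []       []      = 1ℤ
detOn []       (_ ∷ _) = 0ℤ
detOn (i ∷ is)         = ext (λ x → x i) (detOn is)

detOn-alternating : ∀ {N} (is : List (Fin N)) → IsAlternating (detOn is)
detOn-alternating []       = record
  { linear = λ { [] Q c d _ → zeros c d ; (_ ∷ _) Q c d _ → zeros c d }
  ; swap-at = λ { [] _ _ _ → ≡.refl ; (_ ∷ _) _ _ _ → ≡.refl } }
  where zeros : ∀ c d → 0ℤ ≡ c * 0ℤ + d * 0ℤ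
        zeros = solve-∀
detOn-alternating (i ∷ is) = ext-alternating {φ = λ x → x i} (λ c d eq → eq i) (detOn-alternating is)

-- Functionals are generated from the coordinates so that the vanishing of φ ∧ det can be proved by
-- induction, with a repeated row as the only real case.
data Linear {N} : (Vector N → ℤ) → Set where
  null  : ∀ {φ} → (∀ x → φ x ≡ 0ℤ) → Linear φ
  coord : ∀ i → Linear (λ x → x i)
  comb  : ∀ {φ ψ χ} c d → Linear φ → Linear ψ → (∀ x → χ x ≡ c * φ x + d * ψ x) → Linear χ

Linear-ext : ∀ {N} {ψ : Vector N → ℤ} {f : Vector N → List (Vector N) → ℤ} →
             (∀ Y → Linear (λ a → f a Y)) → ∀ C → Linear (λ a → ext ψ (f a) C)
Linear-ext lin []      = null (λ _ → ≡.refl)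
Linear-ext {ψ = ψ} {f} lin (c ∷ C) =
  comb (ψ c) (- 1ℤ) (lin C) (Linear-ext {ψ = ψ} (λ Y → lin (c ∷ Y)) C)
       (λ a → minus (ψ c * f a C) (ext ψ (λ Y → f a (c ∷ Y)) C))
  where minus : ∀ u v → u - v ≡ u + (- 1ℤ) * v
        minus = solve-∀

detOn-Linear : ∀ {N} (is : List (Fin N)) C → Linear (λ a → detOn is (a ∷ C))
detOn-Linear []       C = null (λ _ → ≡.refl)
detOn-Linear (i ∷ is) C =
  comb (detOn is C) (- 1ℤ) (coord i) (Linear-ext {ψ = λ x → x i} (detOn-Linear is) C)
       (λ a → minus (a i) (detOn is C) (ext (λ x → x i) (λ Y → detOn is (a ∷ Y)) C))
  where minus : ∀ u v w → u * v - w ≡ v * u + (- 1ℤ) * w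
        minus = solve-∀

-- `detOn is` is the wedge of the coordinates in the list; anticommuting the new factor to its
-- second occurrence gives a square, which vanishes.
coord-detOn : ∀ {N} {i : Fin N} {is} → i ∈ is → ∀ X → ext (λ x → x i) (detOn is) X ≡ 0ℤ
coord-detOn {is = j ∷ is} (here ≡.refl) X = ext-self _ (detOn is) X
coord-detOn {i = i} {is = j ∷ is} (there i∈is) X =
  ≡.trans (ext-anticomm _ _ (detOn is) X) (cong -_ (ext-zeroʳ (coord-detOn i∈is) X))

-- The quadratic Plücker relations characterise decomposable forms. They are stored with the form
-- because they, and not the determinant itself, are what `D-exchange` starts from, and because
-- contraction preserves them.
record Form (N : ℕ) : Set where
  field
    ⟦_⟧         : List (Vector N) → ℤ
    alternating : IsAlternating ⟦_⟧
    plücker     : ∀ A C → ext (λ a → ⟦_⟧ (a ∷ C)) ⟦_⟧ A ≡ 0ℤ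
open Form

module _ {N} {f : List (Vector N) → ℤ} (alt : IsAlternating f) where

  repeat-zero : ∀ P x Q → f (P ++ x ∷ x ∷ Q) ≡ 0ℤ
  repeat-zero P x Q = self-neg⇒0 _ (swap-at alt P x x Q)

-- Contraction of F by z; contracting by the basis vector of a vertex deletes (grounds) that vertex.
ground : ∀ {N} → Vector N → Form N → Form N
ground z F = record
  { ⟦_⟧ = λ X → ⟦ F ⟧ (z ∷ X)
  ; alternating = record { linear = λ P → linear (alternating F) (z ∷ P) ; swap-at = λ P → swap-at (alternating F) (z ∷ P) }
  ; plücker = λ A C → begin
      ext (λ a → ⟦ F ⟧ (z ∷ a ∷ C)) (λ X → ⟦ F ⟧ (z ∷ X)) A
        ≡⟨ ext-negˡ (λ a → swap-at (alternating F) [] z a C) A ⟩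
      - e A C
        ≡⟨ identity (⟦ F ⟧ A) (e A C) ⟩
      0ℤ * ⟦ F ⟧ A - e A C
        -- The relation of F for `z ∷ A` and `z ∷ C` has one summand too many, and its factor F(z,
        -- z, C) is zero.
        ≡⟨ cong (λ u → u * ⟦ F ⟧ A - e A C) (repeat-zero (alternating F) [] z C) ⟨
      ⟦ F ⟧ (z ∷ z ∷ C) * ⟦ F ⟧ A - e A C
        ≡⟨ plücker F (z ∷ A) (z ∷ C) ⟩
      0ℤ ∎ }
  where
  open ≡-Reasoning
  e : List _ → List _ → ℤ
  e A C = ext (λ a → ⟦ F ⟧ (a ∷ z ∷ C)) (λ X → ⟦ F ⟧ (z ∷ X)) A
  identity : ∀ u v → - v ≡ 0ℤ * u - v
  identity = solve-∀

ext-zero-on : ∀ {A : Set} {φ : A → ℤ} {f : List A → ℤ} {X} → All (λ x → φ x ≡ 0ℤ) X → ext φ f X ≡ 0ℤ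
ext-zero-on []                  = ≡.refl
ext-zero-on {f = f} {x ∷ X} (p ∷ ps) = cong₂ _-_ (cong (_* f X) p) (ext-zero-on ps)

-- Determinants

δ : ∀ {N} → Fin N → Vector N
δ i j = if i == j then 1ℤ else 0ℤ

δ-same : ∀ {N} (i : Fin N) → δ i i ≡ 1ℤ
δ-same i with i ≟ i
... | yes _ = ≡.refl
... | no i≢i = ⊥-elim (i≢i ≡.refl)

δ-distinct : ∀ {N} {i j : Fin N} → i ≢ j → δ i j ≡ 0ℤ
δ-distinct {i = i} {j} i≢j with i ≟ j
... | yes i≡j = ⊥-elim (i≢j i≡j)
... | no _ = ≡.refl

ext-length : ∀ {A : Set} {φ : A → ℤ} {f : List A → ℤ} k → (∀ Y → length Y ≢ k → f Y ≡ 0ℤ) →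
             ∀ X → length X ≢ suc k → ext φ f X ≡ 0ℤ
ext-length k fz []      _   = ≡.refl
ext-length {φ = φ} {f} k fz (x ∷ X) len =
  cong₂ _-_ (≡.trans (cong (φ x *_) (fz X (λ e → len (cong suc e)))) (*-zeroʳ (φ x))) (inner k fz len)
  where
  inner : ∀ k → (∀ Y → length Y ≢ k → f Y ≡ 0ℤ) → suc (length X) ≢ suc k → ext φ (λ Y → f (x ∷ Y)) X ≡ 0ℤ
  inner zero    fz len = ext-zeroʳ (λ Y → fz (x ∷ Y) (λ ())) X
  inner (suc k) fz len = ext-length k (λ Y ne → fz (x ∷ Y) (λ e → ne (ℕₚ.suc-injective e))) X (λ e → len (cong suc e))

detOn-length : ∀ {N} (is : List (Fin N)) X → length X ≢ length is → detOn is X ≡ 0ℤ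
detOn-length []       []      ne = ⊥-elim (ne ≡.refl)
detOn-length []       (_ ∷ _) ne = ≡.refl
detOn-length (i ∷ is) X       ne = ext-length (length is) (detOn-length is) X ne

detOn-basis : ∀ {N} {is : List (Fin N)} → Unique is → detOn is (map δ is) ≡ 1ℤ
detOn-basis [] = ≡.refl
detOn-basis {is = i ∷ is} (i∉is ∷ u) =
  ≡.trans (cong₂ _-_ (cong₂ _*_ (δ-same i) (detOn-basis u))
             (ext-zero-on {φ = λ x → x i} (All.map⁺ (All.map (λ i≢j → δ-distinct (λ j≡i → i≢j (≡.sym j≡i))) i∉is))))
          ≡.refl

abstract

  det : ∀ {N} → List (Vector N) → ℤ
  det {N} = detOn (allFin N)

  det-alternating : ∀ {N} → IsAlternating (det {N})
  det-alternating = detOn-alternating (allFin _)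

  det-Linear : ∀ {N} C → Linear {N} (λ a → det (a ∷ C))
  det-Linear = detOn-Linear (allFin _)

  det-length : ∀ {N} (X : List (Vector N)) → length X ≢ N → det X ≡ 0ℤ
  det-length {N} X ne = detOn-length (allFin N) X (λ e → ne (≡.trans e (List.length-tabulate {n = N} _)))

  det-basis : ∀ {N} → det (map δ (allFin N)) ≡ 1ℤ
  det-basis {N} = detOn-basis (Unique.allFin⁺ N)

  -- Cramer's rule: a functional wedged with the top form vanishes.
  ext-det : ∀ {N} {φ : Vector N → ℤ} → Linear φ → ∀ X → ext φ det X ≡ 0ℤ
  ext-det (null z)          X = ext-zeroˡ z X
  ext-det (coord i)         X = coord-detOn (∈-allFin i) X
  ext-det (comb c d p q eq) X =
    ≡.trans (ext-linˡ c d eq X)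
            (≡.trans (cong₂ (λ u v → c * u + d * v) (ext-det p X) (ext-det q X)) (zeros c d))
    where zeros : ∀ c d → c * 0ℤ + d * 0ℤ ≡ 0ℤ
          zeros = solve-∀

detForm : ∀ {N} → Form N
detForm = record
  { ⟦_⟧ = det ; alternating = det-alternating
  ; plücker = λ A C → ext-det (det-Linear C) A }

-- Graph polynomials

Edge : ℕ → Set
Edge N = Fin N × Fin N

infixl 6 _⊖_
_⊖_ : ∀ {N} → Fin N → Fin N → Vector N
(s ⊖ t) i = δ s i - δ t i

vec : ∀ {N} → Edge N → Vector N
vec (s , t) = s ⊖ t

-- Cramer's rule for `u ∷ X` has the single surviving summand φ(u) det X: vectors in the kernel of a
-- functional that takes the value 1 are dependent.
det-functional-zero : ∀ {N} {φ : Vector N → ℤ} → Linear φ → (u : Vector N) → φ u ≡ 1ℤ →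
                      ∀ {X} → All (λ x → φ x ≡ 0ℤ) X → det X ≡ 0ℤ
det-functional-zero {φ = φ} lin u φu {X} zs = begin
  det X                                       ≡⟨ identity (det X) ⟩
  1ℤ * det X - 0ℤ                             ≡⟨ cong₂ (λ c s → c * det X - s) φu (ext-zero-on zs) ⟨
  ext φ det (u ∷ X)                           ≡⟨ ext-det lin (u ∷ X) ⟩
  0ℤ ∎
  where
  open ≡-Reasoning
  identity : ∀ x → x ≡ 1ℤ * x - 0ℤ
  identity = solve-∀

-- Says that the coordinate u is still live in F: some argument must involve u for F to be non-zero.
-- Grounding any other vertex keeps this true, and it is what makes the term in which no edge at u
-- is used vanish.
ZeroColumn : ∀ {N} → Form N → Fin N → Set
ZeroColumn F u = ∀ {X} → All (λ x → x u ≡ 0ℤ) X → ⟦ F ⟧ X ≡ 0ℤ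

det-zeroColumn : ∀ {N} (u : Fin N) → ZeroColumn detForm u
det-zeroColumn u = det-functional-zero (coord u) (δ u) (δ-same u)

ground-zeroColumn : ∀ {N} {F : Form N} {z u} → ZeroColumn F u → z u ≡ 0ℤ → ZeroColumn (ground z F) u
ground-zeroColumn zc zu zs = zc (zu ∷ zs)

-- D F ws X Y = Σ_S ∏_{e ∉ S} α_e F(S, X) F(S, Y) over sets S of edges. For the determinant with a root
-- grounded, D F ws [] [] is the Kirchhoff polynomial and the other values are Dodgson polynomials.
D : ∀ {N} → Form N → List (Edge N × ℕ) → List (Vector N) → List (Vector N) → ℤ
D F []             X Y = ⟦ F ⟧ X * ⟦ F ⟧ Y
D F ((e , α) ∷ ws) X Y = + α * D F ws X Y + D F ws (vec e ∷ X) (vec e ∷ Y)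

module _ {N} (F : Form N) where

  D-sym : ∀ ws X Y → D F ws X Y ≡ D F ws Y X
  D-sym []             X Y = *-comm (⟦ F ⟧ X) (⟦ F ⟧ Y)
  D-sym ((e , α) ∷ ws) X Y = cong₂ (λ u v → + α * u + v) (D-sym ws X Y) (D-sym ws _ _)

  D-alternating : ∀ ws Y → IsAlternating (λ X → D F ws X Y)
  D-alternating [] Y = record
    { linear = λ P {x} {y} Q c d eq → ≡.trans (cong (_* ⟦ F ⟧ Y) (linear (alternating F) P Q c d eq))
                                        (distrib c d (⟦ F ⟧ (P ++ x ∷ Q)) (⟦ F ⟧ (P ++ y ∷ Q)) (⟦ F ⟧ Y))
    ; swap-at = λ P x y Q → ≡.trans (cong (_* ⟦ F ⟧ Y) (swap-at (alternating F) P x y Q))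
                                 (pull (⟦ F ⟧ (P ++ y ∷ x ∷ Q)) (⟦ F ⟧ Y)) }
    where
    distrib : ∀ c d u v m → (c * u + d * v) * m ≡ c * (u * m) + d * (v * m)
    distrib = solve-∀
    pull : ∀ u m → - u * m ≡ - (u * m)
    pull = solve-∀
  D-alternating ((e , α) ∷ ws) Y = record
    { linear = λ P {x} {y} Q c d eq →
        ≡.trans (cong₂ (λ s t → + α * s + t) (linear (D-alternating ws Y) P Q c d eq)
                                             (linear (D-alternating ws (vec e ∷ Y)) (vec e ∷ P) Q c d eq))
                (distrib c d (+ α) (D F ws (P ++ x ∷ Q) Y) (D F ws (P ++ y ∷ Q) Y)
                   (D F ws (vec e ∷ P ++ x ∷ Q) (vec e ∷ Y)) (D F ws (vec e ∷ P ++ y ∷ Q) (vec e ∷ Y)))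
    ; swap-at = λ P x y Q →
        ≡.trans (cong₂ (λ s t → + α * s + t) (swap-at (D-alternating ws Y) P x y Q)
                                             (swap-at (D-alternating ws (vec e ∷ Y)) (vec e ∷ P) x y Q))
                (pull (+ α) (D F ws (P ++ y ∷ x ∷ Q) Y) (D F ws (vec e ∷ P ++ y ∷ x ∷ Q) (vec e ∷ Y))) }
    where
    distrib : ∀ c d m u v s t → m * (c * u + d * v) + (c * s + d * t) ≡ c * (m * u + s) + d * (m * v + t)
    distrib = solve-∀
    pull : ∀ m u v → m * - u + - v ≡ - (m * u + v)
    pull = solve-∀

  D-swap₂ : ∀ ws x y X Y → D F ws (x ∷ y ∷ X) (x ∷ y ∷ Y) ≡ D F ws (y ∷ x ∷ X) (y ∷ x ∷ Y)
  D-swap₂ ws x y X Y = begin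
    D F ws (x ∷ y ∷ X) (x ∷ y ∷ Y)     ≡⟨ swap-at (D-alternating ws _) [] x y X ⟩
    - D F ws (y ∷ x ∷ X) (x ∷ y ∷ Y)   ≡⟨ cong -_ (D-sym ws _ _) ⟩
    - D F ws (x ∷ y ∷ Y) (y ∷ x ∷ X)   ≡⟨ cong -_ (swap-at (D-alternating ws _) [] x y Y) ⟩
    - - D F ws (y ∷ x ∷ Y) (y ∷ x ∷ X) ≡⟨ neg-involutive (D F ws (y ∷ x ∷ Y) (y ∷ x ∷ X)) ⟩
    D F ws (y ∷ x ∷ Y) (y ∷ x ∷ X)     ≡⟨ D-sym ws _ _ ⟩
    D F ws (y ∷ x ∷ X) (y ∷ x ∷ Y)     ∎
    where open ≡-Reasoning

  D-perm : ∀ {ws ws′} → ws ↭ ws′ → ∀ X Y → D F ws X Y ≡ D F ws′ X Y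
  D-perm ↭.refl X Y = ≡.refl
  D-perm (↭.prep (e , α) p) X Y = cong₂ (λ u v → + α * u + v) (D-perm p X Y) (D-perm p _ _)
  D-perm {ws′ = _ ∷ _ ∷ ws′} (↭.swap (e , α) (e′ , α′) p) X Y =
    ≡.trans (cong₂ (λ u v → + α * u + v)
             (cong₂ (λ u v → + α′ * u + v) (D-perm p X Y) (D-perm p _ _))
             (cong₂ (λ u v → + α′ * u + v) (D-perm p _ _)
                    (≡.trans (D-perm p _ _) (D-swap₂ ws′ (vec e′) (vec e) X Y))))
          (identity (+ α) (+ α′) (D F ws′ X Y) (D F ws′ (vec e′ ∷ X) (vec e′ ∷ Y)) (D F ws′ (vec e ∷ X) (vec e ∷ Y))
                    (D F ws′ (vec e ∷ vec e′ ∷ X) (vec e ∷ vec e′ ∷ Y)))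
    where
    identity : ∀ a b u v w z → a * (b * u + v) + (b * w + z) ≡ b * (a * u + w) + (a * v + z)
    identity = solve-∀
  D-perm (↭.trans p q) X Y = ≡.trans (D-perm p X Y) (D-perm q X Y)

  D-flip : ∀ s t α ws X Y → D F (((s , t) , α) ∷ ws) X Y ≡ D F (((t , s) , α) ∷ ws) X Y
  D-flip s t α ws X Y = cong (λ u → + α * D F ws X Y + u) (begin
    D F ws (s ⊖ t ∷ X) (s ⊖ t ∷ Y)     ≡⟨ flipˡ X (s ⊖ t ∷ Y) ⟩
    - D F ws (t ⊖ s ∷ X) (s ⊖ t ∷ Y)   ≡⟨ cong -_ (D-sym ws _ _) ⟩
    - D F ws (s ⊖ t ∷ Y) (t ⊖ s ∷ X)   ≡⟨ cong -_ (flipˡ Y (t ⊖ s ∷ X)) ⟩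
    - - D F ws (t ⊖ s ∷ Y) (t ⊖ s ∷ X) ≡⟨ neg-involutive (D F ws (t ⊖ s ∷ Y) (t ⊖ s ∷ X)) ⟩
    D F ws (t ⊖ s ∷ Y) (t ⊖ s ∷ X)     ≡⟨ D-sym ws _ _ ⟩
    D F ws (t ⊖ s ∷ X) (t ⊖ s ∷ Y)     ∎)
    where
    open ≡-Reasoning
    identity : ∀ a b → a - b ≡ (- 1ℤ) * (b - a) + 0ℤ * (b - a)
    identity = solve-∀
    flipˡ : ∀ X Y → D F ws (s ⊖ t ∷ X) Y ≡ - D F ws (t ⊖ s ∷ X) Y
    flipˡ X Y = ≡.trans (linear (D-alternating ws Y) [] {t ⊖ s} {t ⊖ s} X (- 1ℤ) 0ℤ (λ i → identity (δ s i) (δ t i)))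
                        (≡.sym (neg-as-comb (D F ws (t ⊖ s ∷ X) Y)))

  D-zeroColumn : ∀ {u} → ZeroColumn F u → ∀ {ws} → All (λ w → vec (proj₁ w) u ≡ 0ℤ) ws →
                 ∀ {X} Y → All (λ x → x u ≡ 0ℤ) X → D F ws X Y ≡ 0ℤ
  D-zeroColumn zc [] Y zs = cong (_* ⟦ F ⟧ Y) (zc zs)
  D-zeroColumn zc {(e , α) ∷ ws} (z ∷ avoid) Y zs =
    ≡.trans (cong₂ (λ u v → + α * u + v) (D-zeroColumn zc avoid Y zs) (D-zeroColumn zc avoid _ (z ∷ zs)))
            (≡.trans (+-identityʳ _) (*-zeroʳ (+ α)))

  D-zeroColumnʳ : ∀ {u} → ZeroColumn F u → ∀ {ws} → All (λ w → vec (proj₁ w) u ≡ 0ℤ) ws →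
                 ∀ X {Y} → All (λ y → y u ≡ 0ℤ) Y → D F ws X Y ≡ 0ℤ
  D-zeroColumnʳ zc {ws} avoid X zs = ≡.trans (D-sym ws X _) (D-zeroColumn zc avoid X zs)

  D-ground : ∀ z ws X Y → D (ground z F) ws X Y ≡ D F ws (z ∷ X) (z ∷ Y)
  D-ground z []             X Y = ≡.refl
  D-ground z ((e , α) ∷ ws) X Y =
    cong₂ (λ u v → + α * u + v) (D-ground z ws X Y)
          (≡.trans (D-ground z ws _ _) (D-swap₂ ws z (vec e) X Y))

  -- The bilinear (Hirota-type) relation satisfied by all minors of a matrix. Each edge factor
  -- α + ι_e ⊗ ι_e preserves it: the terms linear in α are the relations for (eP, eQ, R, S)
  -- and (P, Q, eR, eS), whose extra summands D(P; eQ) D(eR; S) cancel.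
  D-exchange : ∀ ws P Q R S →
    ext (λ a → D F ws (a ∷ R) S) (λ P′ → D F ws P′ Q) P ≡ ext (λ b → D F ws P (b ∷ Q)) (λ S′ → D F ws R S′) S
  D-exchange [] P Q R S = ≡.trans (lhs P) (≡.sym (rhs S))
    where
    f = ⟦ F ⟧
    factor : ∀ {φ ψ g h} (m m′ : ℤ) → (∀ a → φ a ≡ m * ψ a) → (∀ Y → g Y ≡ m′ * h Y) →
             ∀ X → ext φ g X ≡ m * (m′ * ext ψ h X)
    factor {φ} {ψ} {g} {h} m m′ p q X =
      ≡.trans (ext-linˡ {ψ = ψ} {f = g} m 0ℤ (λ a → ≡.trans (p a) (pad m (ψ a))) X)
      (≡.trans (≡.sym (pad m (ext ψ g X)))
      (cong (m *_) (≡.trans (ext-linʳ {g = h} m′ 0ℤ (λ Y → ≡.trans (q Y) (pad m′ (h Y))) X) (≡.sym (pad m′ (ext ψ h X))))))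
      where pad : ∀ m u → m * u ≡ m * u + 0ℤ * u
            pad = solve-∀
    vanish : ∀ m m′ {z} → z ≡ 0ℤ → m * (m′ * z) ≡ 0ℤ
    vanish m m′ ≡.refl = ≡.trans (cong (m *_) (*-zeroʳ m′)) (*-zeroʳ m)
    lhs : ∀ P → ext (λ a → f (a ∷ R) * f S) (λ P′ → f P′ * f Q) P ≡ 0ℤ
    lhs P = ≡.trans (factor (f S) (f Q) (λ a → *-comm (f (a ∷ R)) (f S)) (λ Y → *-comm (f Y) (f Q)) P)
                    (vanish (f S) (f Q) (plücker F P R))
    rhs : ∀ S → ext (λ b → f P * f (b ∷ Q)) (λ S′ → f R * f S′) S ≡ 0ℤ
    rhs S = ≡.trans (factor (f P) (f R) (λ a → ≡.refl) (λ Y → ≡.refl) S)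
                    (vanish (f P) (f R) (plücker F S Q))
  D-exchange ((e′ , w) ∷ ws) P Q R S = begin
    ext (λ a → α * d (a ∷ R) S + d (e ∷ a ∷ R) (e ∷ S)) (λ P′ → α * d P′ Q + d (e ∷ P′) (e ∷ Q)) P
      ≡⟨ bilinear (λ a → d (a ∷ R) S) (λ a → d (e ∷ a ∷ R) (e ∷ S)) (λ P′ → d P′ Q) (λ P′ → d (e ∷ P′) (e ∷ Q)) P ⟩
    combine (L P Q R S) (ext (λ a → d (a ∷ R) S) (λ P′ → d (e ∷ P′) (e ∷ Q)) P)
       (ext (λ a → d (e ∷ a ∷ R) (e ∷ S)) (λ P′ → d P′ Q) P)
       (ext (λ a → d (e ∷ a ∷ R) (e ∷ S)) (λ P′ → d (e ∷ P′) (e ∷ Q)) P)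
      ≡⟨ cong₂ (combine (L P Q R S) (ext (λ a → d (a ∷ R) S) (λ P′ → d (e ∷ P′) (e ∷ Q)) P))
          (ext-negˡ (λ a → swapˡ e a R (e ∷ S)) P) (ext-negˡ (λ a → swapˡ e a R (e ∷ S)) P) ⟩
    combine (L P Q R S) x₁ (- L P Q (e ∷ R) (e ∷ S)) (- x₂)
      ≡⟨ left α (L P Q R S) x₁ x₂ (L P Q (e ∷ R) (e ∷ S)) (d (e ∷ R) S) (d P (e ∷ Q)) ⟩
    combine (L P Q R S) (d (e ∷ R) S * d P (e ∷ Q) - L (e ∷ P) (e ∷ Q) R S) (- L P Q (e ∷ R) (e ∷ S))
      (0ℤ * d P (e ∷ Q) - x₂)
      -- The α-free part lacks only the summand D(e, e, R; eS) D(P; eQ) = 0; restoring it gives the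
      -- full left side for (eP, eQ, eR, eS).
      ≡⟨ cong (λ z → combine (L P Q R S) (d (e ∷ R) S * d P (e ∷ Q) - L (e ∷ P) (e ∷ Q) R S) (- L P Q (e ∷ R) (e ∷ S)) (z * d P (e ∷ Q) - x₂))
              (repeat-zero (D-alternating ws _) [] e R) ⟨
    combine (L P Q R S) (d (e ∷ R) S * d P (e ∷ Q) - L (e ∷ P) (e ∷ Q) R S) (- L P Q (e ∷ R) (e ∷ S))
      (L (e ∷ P) (e ∷ Q) (e ∷ R) (e ∷ S))
      ≡⟨ rewriteAll (D-exchange ws P Q R S) (D-exchange ws (e ∷ P) (e ∷ Q) R S) (D-exchange ws P Q (e ∷ R) (e ∷ S))
                    (D-exchange ws (e ∷ P) (e ∷ Q) (e ∷ R) (e ∷ S)) ⟩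
    combine (T P Q R S) (d (e ∷ R) S * d P (e ∷ Q) - T (e ∷ P) (e ∷ Q) R S) (- T P Q (e ∷ R) (e ∷ S))
      (T (e ∷ P) (e ∷ Q) (e ∷ R) (e ∷ S))
      ≡⟨ cong (λ z → combine (T P Q R S) (d (e ∷ R) S * d P (e ∷ Q) - T (e ∷ P) (e ∷ Q) R S) (- T P Q (e ∷ R) (e ∷ S)) (z * d (e ∷ R) S - y₂))
              (≡.trans (D-sym ws _ _) (repeat-zero (D-alternating ws _) [] e Q)) ⟩
    combine (T P Q R S) (d (e ∷ R) S * d P (e ∷ Q) - T (e ∷ P) (e ∷ Q) R S) (- T P Q (e ∷ R) (e ∷ S))
      (0ℤ * d (e ∷ R) S - y₂)
      ≡⟨ right α (T P Q R S) y₁ y₂ (T (e ∷ P) (e ∷ Q) R S) (d (e ∷ R) S) (d P (e ∷ Q)) ⟩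
    combine (T P Q R S) y₁ (- T (e ∷ P) (e ∷ Q) R S) (- y₂)
      ≡⟨ cong₂ (combine (T P Q R S) y₁)
          (ext-negˡ (λ b → swapʳ e b (e ∷ P) Q) S) (ext-negˡ (λ b → swapʳ e b (e ∷ P) Q) S) ⟨
    combine (T P Q R S) (ext (λ b → d P (b ∷ Q)) (λ S′ → d (e ∷ R) (e ∷ S′)) S)
       (ext (λ b → d (e ∷ P) (e ∷ b ∷ Q)) (λ S′ → d R S′) S)
       (ext (λ b → d (e ∷ P) (e ∷ b ∷ Q)) (λ S′ → d (e ∷ R) (e ∷ S′)) S)
      ≡⟨ bilinear (λ b → d P (b ∷ Q)) (λ b → d (e ∷ P) (e ∷ b ∷ Q)) (λ S′ → d R S′) (λ S′ → d (e ∷ R) (e ∷ S′)) S ⟨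
    ext (λ b → α * d P (b ∷ Q) + d (e ∷ P) (e ∷ b ∷ Q)) (λ S′ → α * d R S′ + d (e ∷ R) (e ∷ S′)) S ∎
    where
    open ≡-Reasoning
    d = D F ws
    e = vec e′
    α = + w
    L T : List (Vector N) → List (Vector N) → List (Vector N) → List (Vector N) → ℤ
    L P Q R S = ext (λ a → d (a ∷ R) S) (λ P′ → d P′ Q) P
    T P Q R S = ext (λ b → d P (b ∷ Q)) (λ S′ → d R S′) S
    combine : ℤ → ℤ → ℤ → ℤ → ℤ
    combine u v w z = α * (α * u + v) + (α * w + z)
    x₁ = ext (λ a → d (a ∷ R) S) (λ P′ → d (e ∷ P′) (e ∷ Q)) P
    x₂ = ext (λ a → d (a ∷ e ∷ R) (e ∷ S)) (λ P′ → d (e ∷ P′) (e ∷ Q)) P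
    y₁ = ext (λ b → d P (b ∷ Q)) (λ S′ → d (e ∷ R) (e ∷ S′)) S
    y₂ = ext (λ b → d (e ∷ P) (b ∷ e ∷ Q)) (λ S′ → d (e ∷ R) (e ∷ S′)) S
    swapˡ : ∀ x y X Y → d (x ∷ y ∷ X) Y ≡ - d (y ∷ x ∷ X) Y
    swapˡ x y X Y = swap-at (D-alternating ws Y) [] x y X
    swapʳ : ∀ x y X Y → d X (x ∷ y ∷ Y) ≡ - d X (y ∷ x ∷ Y)
    swapʳ x y X Y = ≡.trans (D-sym ws _ _) (≡.trans (swapˡ x y Y X) (cong -_ (D-sym ws _ _)))
    one : ∀ m u v → m * u + v ≡ m * u + 1ℤ * v
    one = solve-∀
    bilinear : ∀ φ ψ g h X → ext (λ a → α * φ a + ψ a) (λ Y → α * g Y + h Y) X ≡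
               combine (ext φ g X) (ext φ h X) (ext ψ g X) (ext ψ h X)
    bilinear φ ψ g h X =
      ≡.trans (ext-linˡ {φ = φ} {ψ} {f = λ Y → α * g Y + h Y} α 1ℤ (λ a → one α (φ a) (ψ a)) X)
      (≡.trans (≡.sym (one α (ext φ (λ Y → α * g Y + h Y) X) (ext ψ (λ Y → α * g Y + h Y) X)))
      (cong₂ (λ s t → α * s + t) (inner φ) (inner ψ)))
      where
      inner : ∀ χ → ext χ (λ Y → α * g Y + h Y) X ≡ α * ext χ g X + ext χ h X
      inner χ = ≡.trans (ext-linʳ {f = g} {h} α 1ℤ (λ Y → one α (g Y) (h Y)) X) (≡.sym (one α (ext χ g X) (ext χ h X)))
    left : ∀ α u x₁ x₂ v p q → α * (α * u + x₁) + (α * - v + - x₂) ≡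
           α * (α * u + (p * q - (p * q - x₁))) + (α * - v + (0ℤ * q - x₂))
    left = solve-∀
    right : ∀ α u y₁ y₂ v p q → α * (α * u + (p * q - v)) + (α * - (q * p - y₁) + (0ℤ * p - y₂)) ≡
            α * (α * u + y₁) + (α * - v + - y₂)
    right = solve-∀
    rewriteAll : ∀ {u v w z u′ v′ w′ z′} → u ≡ u′ → v ≡ v′ → w ≡ w′ → z ≡ z′ →
      combine u (d (e ∷ R) S * d P (e ∷ Q) - v) (- w) z ≡ combine u′ (d (e ∷ R) S * d P (e ∷ Q) - v′) (- w′) z′
    rewriteAll ≡.refl ≡.refl ≡.refl ≡.refl = ≡.refl

  -- The Desnanot-Jacobi identity: for these short lists the exchange relation keeps one term on the
  -- left and two on the right, the second of which is a square by symmetry.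
  D-jacobi : ∀ ws x y → D F ws [] [] * D F ws (x ∷ y ∷ []) (x ∷ y ∷ []) ≡
             D F ws (x ∷ []) (x ∷ []) * D F ws (y ∷ []) (y ∷ []) - D F ws (x ∷ []) (y ∷ []) * D F ws (x ∷ []) (y ∷ [])
  D-jacobi ws x y = begin
    d [] [] * d (x ∷ y ∷ []) (x ∷ y ∷ [])
      ≡⟨ lhs (d [] []) (d (x ∷ y ∷ []) (x ∷ y ∷ [])) ⟩
    d (x ∷ y ∷ []) (x ∷ y ∷ []) * d [] [] - 0ℤ
      ≡⟨ D-exchange ws (x ∷ []) [] (y ∷ []) (x ∷ y ∷ []) ⟩
    d (x ∷ []) (x ∷ []) * d (y ∷ []) (y ∷ []) - (d (x ∷ []) (y ∷ []) * d (y ∷ []) (x ∷ []) - 0ℤ)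
      ≡⟨ cong (λ u → d (x ∷ []) (x ∷ []) * d (y ∷ []) (y ∷ []) - (d (x ∷ []) (y ∷ []) * u - 0ℤ)) (D-sym ws _ _) ⟩
    d (x ∷ []) (x ∷ []) * d (y ∷ []) (y ∷ []) - (d (x ∷ []) (y ∷ []) * d (x ∷ []) (y ∷ []) - 0ℤ)
      ≡⟨ rhs (d (x ∷ []) (x ∷ []) * d (y ∷ []) (y ∷ [])) (d (x ∷ []) (y ∷ []) * d (x ∷ []) (y ∷ [])) ⟩
    d (x ∷ []) (x ∷ []) * d (y ∷ []) (y ∷ []) - d (x ∷ []) (y ∷ []) * d (x ∷ []) (y ∷ []) ∎
    where
    open ≡-Reasoning
    d = D F ws
    lhs : ∀ u v → u * v ≡ v * u - 0ℤ
    lhs = solve-∀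
    rhs : ∀ u v → u - (v - 0ℤ) ≡ u - v
    rhs = solve-∀

module _ {N} (F : Form N) (ws : List (Edge N × ℕ)) where

  private
    d = D F ws

  D-linearˡ : ∀ {x y z} X Y c c′ → (∀ i → z i ≡ c * x i + c′ * y i) → d (z ∷ X) Y ≡ c * d (x ∷ X) Y + c′ * d (y ∷ X) Y
  D-linearˡ X Y c c′ eq = linear (D-alternating F ws Y) [] X c c′ eq

  D-shiftˡ : ∀ {x z e} X Y → (∀ i → z i ≡ e i + x i) → d (z ∷ e ∷ X) Y ≡ d (x ∷ e ∷ X) Y
  D-shiftˡ {x} {z} {e} X Y eq = begin
    d (z ∷ e ∷ X) Y                                ≡⟨ D-linearˡ (e ∷ X) Y 1ℤ 1ℤ (λ i → ≡.trans (eq i) (ones (e i) (x i))) ⟩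
    1ℤ * d (e ∷ e ∷ X) Y + 1ℤ * d (x ∷ e ∷ X) Y    ≡⟨ cong (λ u → 1ℤ * u + 1ℤ * d (x ∷ e ∷ X) Y) (repeat-zero (D-alternating F ws Y) [] e X) ⟩
    1ℤ * 0ℤ + 1ℤ * d (x ∷ e ∷ X) Y                 ≡⟨ drop (d (x ∷ e ∷ X) Y) ⟩
    d (x ∷ e ∷ X) Y ∎
    where
    open ≡-Reasoning
    ones : ∀ a b → a + b ≡ 1ℤ * a + 1ℤ * b
    ones = solve-∀
    drop : ∀ a → 1ℤ * 0ℤ + 1ℤ * a ≡ a
    drop = solve-∀

  D-shift : ∀ {x z e} X Y → (∀ i → z i ≡ e i + x i) → d (z ∷ e ∷ X) (z ∷ e ∷ Y) ≡ d (x ∷ e ∷ X) (x ∷ e ∷ Y)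
  D-shift {x} {z} {e} X Y eq = begin
    d (z ∷ e ∷ X) (z ∷ e ∷ Y) ≡⟨ D-shiftˡ X _ eq ⟩
    d (x ∷ e ∷ X) (z ∷ e ∷ Y) ≡⟨ D-sym F ws _ _ ⟩
    d (z ∷ e ∷ Y) (x ∷ e ∷ X) ≡⟨ D-shiftˡ Y _ eq ⟩
    d (x ∷ e ∷ Y) (x ∷ e ∷ X) ≡⟨ D-sym F ws _ _ ⟩
    d (x ∷ e ∷ X) (x ∷ e ∷ Y) ∎
    where open ≡-Reasoning

-- Eliminating the edges at a vertex

module Eliminate {N} (F : Form N) {u : Fin N} (zc : ZeroColumn F u) {ws : List (Edge N × ℕ)}
                 (avoid : All (λ w → vec (proj₁ w) u ≡ 0ℤ) ws) where

  private
    d  = D F ws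
    d′ = D (ground (δ u) F) ws
    Off : List (Vector N) → Set
    Off = All (λ x → x u ≡ 0ℤ)

  dropʳ : ∀ {t} → t ≢ u → ∀ X {Y} → Off Y → d X (u ⊖ t ∷ Y) ≡ d X (δ u ∷ Y)
  dropʳ {t} t≢u X {Y} off = begin
    d X (u ⊖ t ∷ Y)                                 ≡⟨ D-sym F ws _ _ ⟩
    d (u ⊖ t ∷ Y) X                                 ≡⟨ D-linearˡ F ws Y X 1ℤ (- 1ℤ) (λ i → minus (δ u i) (δ t i)) ⟩
    1ℤ * d (δ u ∷ Y) X + (- 1ℤ) * d (δ t ∷ Y) X     ≡⟨ cong (λ s → 1ℤ * d (δ u ∷ Y) X + (- 1ℤ) * s) (D-zeroColumn F zc avoid X (δ-distinct t≢u ∷ off)) ⟩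
    1ℤ * d (δ u ∷ Y) X + (- 1ℤ) * 0ℤ                ≡⟨ drop (d (δ u ∷ Y) X) ⟩
    d (δ u ∷ Y) X                                   ≡⟨ D-sym F ws _ _ ⟩
    d X (δ u ∷ Y) ∎
    where
    open ≡-Reasoning
    minus : ∀ a b → a - b ≡ 1ℤ * a + (- 1ℤ) * b
    minus = solve-∀
    drop : ∀ a → 1ℤ * a + (- 1ℤ) * 0ℤ ≡ a
    drop = solve-∀

  -- The edge vectors alone involve the coordinate u. Their parts at s and t leave a list without
  -- that coordinate and drop out, so on both sides only the contraction by `δ u` remains.
  eliminate : ∀ {s t} → s ≢ u → t ≢ u → ∀ {X Y} → Off X → Off Y → d (u ⊖ s ∷ X) (u ⊖ t ∷ Y) ≡ d′ X Y
  eliminate {s} {t} s≢u t≢u {X} {Y} offX offY = begin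
    d (u ⊖ s ∷ X) (u ⊖ t ∷ Y) ≡⟨ dropʳ t≢u _ offY ⟩
    d (u ⊖ s ∷ X) (δ u ∷ Y)   ≡⟨ D-sym F ws _ _ ⟩
    d (δ u ∷ Y) (u ⊖ s ∷ X)   ≡⟨ dropʳ s≢u _ offX ⟩
    d (δ u ∷ Y) (δ u ∷ X)     ≡⟨ D-sym F ws _ _ ⟩
    d (δ u ∷ X) (δ u ∷ Y)     ≡⟨ D-ground F (δ u) ws X Y ⟨
    d′ X Y ∎
    where open ≡-Reasoning

  -- Only the component of ξ along `δ u` contributes. The scalar ξ(u) that appears here is the one
  -- that later decides which terms survive.
  eliminate-vector : ∀ ξ {X Y} → Off X → Off Y → d (ξ ∷ X) (δ u ∷ Y) ≡ ξ u * d′ X Y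
  eliminate-vector ξ {X} {Y} offX offY = begin
    d (ξ ∷ X) (δ u ∷ Y)
      ≡⟨ D-linearˡ F ws {δ u} {rest} X (δ u ∷ Y) (ξ u) 1ℤ (λ i → split (ξ i) (ξ u) (δ u i)) ⟩
    ξ u * d (δ u ∷ X) (δ u ∷ Y) + 1ℤ * d (rest ∷ X) (δ u ∷ Y)
      ≡⟨ cong₂ (λ s t → ξ u * s + 1ℤ * t) (≡.sym (D-ground F (δ u) ws X Y))
               (D-zeroColumn F zc avoid (δ u ∷ Y) (≡.trans (cong (λ s → ξ u - ξ u * s) (δ-same u)) (cancel (ξ u)) ∷ offX)) ⟩
    ξ u * d′ X Y + 1ℤ * 0ℤ
      ≡⟨ drop (ξ u * d′ X Y) ⟩
    ξ u * d′ X Y ∎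
    where
    open ≡-Reasoning
    rest : Vector N
    rest i = ξ i - ξ u * δ u i
    split : ∀ a k b → a ≡ k * b + 1ℤ * (a - k * b)
    split = solve-∀
    cancel : ∀ a → a - a * 1ℤ ≡ 0ℤ
    cancel = solve-∀
    drop : ∀ a → a + 1ℤ * 0ℤ ≡ a
    drop = solve-∀

  -- The eight summands are the sets of star edges in use. The empty set leaves u isolated and gives
  -- 0, and each single edge gives f. With two edges, their difference is a vector off u, which
  -- gives r, t, and for a and c the value at a - c = (b - c) - (b - a), namely r - 2s + t. All
  -- three edges give h. The result is sorted as an affine polynomial in z.
  star : ∀ {a b c} → a ≢ u → b ≢ u → c ≢ u → ∀ x y z → let
      q = λ ξ η → d′ (ξ ∷ []) (η ∷ [])
      r = q (b ⊖ a) (b ⊖ a)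
      s = q (b ⊖ a) (b ⊖ c)
      t = q (b ⊖ c) (b ⊖ c)
    in D F (((u , a) , x) ∷ ((u , b) , y) ∷ ((u , c) , z) ∷ ws) [] [] ≡
       (d′ [] [] * (+ x + + y) + r) * + z +
       (d′ [] [] * + x * + y + + x * t + + y * (r - + 2 * s + t) + d′ (b ⊖ a ∷ b ⊖ c ∷ []) (b ⊖ a ∷ b ⊖ c ∷ []))
  star {a} {b} {c} a≢u b≢u c≢u x y z =
    ≡.trans (substitute (D-zeroColumn F zc avoid [] []) (eliminate a≢u a≢u [] []) (eliminate b≢u b≢u [] [])
                        (eliminate c≢u c≢u [] []) e₃e₂ e₃e₁ e₂e₁ e₃e₂e₁)
            (identity (+ x) (+ y) (+ z) f r s t h)
    where
    open ≡-Reasoning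
    e₁ = u ⊖ a
    e₂ = u ⊖ b
    e₃ = u ⊖ c
    ξ = b ⊖ a
    η = b ⊖ c
    f = d′ [] []
    r = d′ (ξ ∷ []) (ξ ∷ [])
    s = d′ (ξ ∷ []) (η ∷ [])
    t = d′ (η ∷ []) (η ∷ [])
    h = d′ (ξ ∷ η ∷ []) (ξ ∷ η ∷ [])
    off : ∀ {i j} → i ≢ u → j ≢ u → (i ⊖ j) u ≡ 0ℤ
    off i≢u j≢u = cong₂ _-_ (δ-distinct i≢u) (δ-distinct j≢u)
    through : ∀ p q r → p - q ≡ p - r + (r - q)
    through = solve-∀
    e₃e₂ : d (e₃ ∷ e₂ ∷ []) (e₃ ∷ e₂ ∷ []) ≡ t
    e₃e₂ = begin
      d (e₃ ∷ e₂ ∷ []) (e₃ ∷ e₂ ∷ [])  ≡⟨ D-shift F ws [] [] (λ i → through (δ u i) (δ c i) (δ b i)) ⟩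
      d (η ∷ e₂ ∷ []) (η ∷ e₂ ∷ [])    ≡⟨ D-swap₂ F ws η e₂ [] [] ⟩
      d (e₂ ∷ η ∷ []) (e₂ ∷ η ∷ [])    ≡⟨ eliminate b≢u b≢u (off b≢u c≢u ∷ []) (off b≢u c≢u ∷ []) ⟩
      t ∎
    e₂e₁ : d (e₂ ∷ e₁ ∷ []) (e₂ ∷ e₁ ∷ []) ≡ r
    e₂e₁ = begin
      d (e₂ ∷ e₁ ∷ []) (e₂ ∷ e₁ ∷ [])  ≡⟨ D-swap₂ F ws e₂ e₁ [] [] ⟩
      d (e₁ ∷ e₂ ∷ []) (e₁ ∷ e₂ ∷ [])  ≡⟨ D-shift F ws [] [] (λ i → through (δ u i) (δ a i) (δ b i)) ⟩
      d (ξ ∷ e₂ ∷ []) (ξ ∷ e₂ ∷ [])    ≡⟨ D-swap₂ F ws ξ e₂ [] [] ⟩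
      d (e₂ ∷ ξ ∷ []) (e₂ ∷ ξ ∷ [])    ≡⟨ eliminate b≢u b≢u (off b≢u a≢u ∷ []) (off b≢u a≢u ∷ []) ⟩
      r ∎
    ac : ∀ Y → d′ (a ⊖ c ∷ []) Y ≡ 1ℤ * d′ (η ∷ []) Y + (- 1ℤ) * d′ (ξ ∷ []) Y
    ac Y = D-linearˡ (ground (δ u) F) ws [] Y 1ℤ (- 1ℤ) (λ i → between (δ a i) (δ b i) (δ c i))
      where between : ∀ a b c → a - c ≡ 1ℤ * (b - c) + (- 1ℤ) * (b - a)
            between = solve-∀
    e₃e₁ : d (e₃ ∷ e₁ ∷ []) (e₃ ∷ e₁ ∷ []) ≡ r - + 2 * s + t
    e₃e₁ = begin
      d (e₃ ∷ e₁ ∷ []) (e₃ ∷ e₁ ∷ [])            ≡⟨ D-shift F ws [] [] (λ i → through (δ u i) (δ c i) (δ a i)) ⟩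
      d (a ⊖ c ∷ e₁ ∷ []) (a ⊖ c ∷ e₁ ∷ [])      ≡⟨ D-swap₂ F ws (a ⊖ c) e₁ [] [] ⟩
      d (e₁ ∷ a ⊖ c ∷ []) (e₁ ∷ a ⊖ c ∷ [])      ≡⟨ eliminate a≢u a≢u (off a≢u c≢u ∷ []) (off a≢u c≢u ∷ []) ⟩
      d′ (a ⊖ c ∷ []) (a ⊖ c ∷ [])               ≡⟨ ac _ ⟩
      1ℤ * d′ (η ∷ []) (a ⊖ c ∷ []) + (- 1ℤ) * d′ (ξ ∷ []) (a ⊖ c ∷ [])
        ≡⟨ cong₂ (λ p q → 1ℤ * p + (- 1ℤ) * q) (≡.trans (D-sym (ground (δ u) F) ws _ _) (ac _))
                                               (≡.trans (D-sym (ground (δ u) F) ws _ _) (ac _)) ⟩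
      1ℤ * (1ℤ * t + (- 1ℤ) * s) + (- 1ℤ) * (1ℤ * d′ (η ∷ []) (ξ ∷ []) + (- 1ℤ) * r)
        ≡⟨ cong (λ p → 1ℤ * (1ℤ * t + (- 1ℤ) * s) + (- 1ℤ) * (1ℤ * p + (- 1ℤ) * r)) (D-sym (ground (δ u) F) ws _ _) ⟩
      1ℤ * (1ℤ * t + (- 1ℤ) * s) + (- 1ℤ) * (1ℤ * s + (- 1ℤ) * r)
        ≡⟨ collect r s t ⟩
      r - + 2 * s + t ∎
      where collect : ∀ r s t → 1ℤ * (1ℤ * t + (- 1ℤ) * s) + (- 1ℤ) * (1ℤ * s + (- 1ℤ) * r) ≡ r - + 2 * s + t
            collect = solve-∀
    e₃e₂e₁ : d (e₃ ∷ e₂ ∷ e₁ ∷ []) (e₃ ∷ e₂ ∷ e₁ ∷ []) ≡ h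
    e₃e₂e₁ = begin
      d (e₃ ∷ e₂ ∷ e₁ ∷ []) (e₃ ∷ e₂ ∷ e₁ ∷ [])    ≡⟨ D-shift F ws _ _ (λ i → through (δ u i) (δ c i) (δ b i)) ⟩
      d (η ∷ e₂ ∷ e₁ ∷ []) (η ∷ e₂ ∷ e₁ ∷ [])      ≡⟨ D-ground F η ws _ _ ⟨
      dη (e₂ ∷ e₁ ∷ []) (e₂ ∷ e₁ ∷ [])             ≡⟨ D-swap₂ (ground η F) ws e₂ e₁ [] [] ⟩
      dη (e₁ ∷ e₂ ∷ []) (e₁ ∷ e₂ ∷ [])             ≡⟨ D-shift (ground η F) ws [] [] (λ i → through (δ u i) (δ a i) (δ b i)) ⟩
      dη (ξ ∷ e₂ ∷ []) (ξ ∷ e₂ ∷ [])               ≡⟨ D-swap₂ (ground η F) ws ξ e₂ [] [] ⟩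
      dη (e₂ ∷ ξ ∷ []) (e₂ ∷ ξ ∷ [])               ≡⟨ D-ground F η ws _ _ ⟩
      d (η ∷ e₂ ∷ ξ ∷ []) (η ∷ e₂ ∷ ξ ∷ [])        ≡⟨ D-swap₂ F ws η e₂ _ _ ⟩
      d (e₂ ∷ η ∷ ξ ∷ []) (e₂ ∷ η ∷ ξ ∷ [])        ≡⟨ eliminate b≢u b≢u (off b≢u c≢u ∷ off b≢u a≢u ∷ []) (off b≢u c≢u ∷ off b≢u a≢u ∷ []) ⟩
      d′ (η ∷ ξ ∷ []) (η ∷ ξ ∷ [])                 ≡⟨ D-swap₂ (ground (δ u) F) ws η ξ [] [] ⟩
      h ∎
      where dη = D (ground η F) ws
    substitute : ∀ {d₀ d₁ d₂ d₃ d₃₂ d₃₁ d₂₁ d₃₂₁ d₀′ d₁′ d₂′ d₃′ d₃₂′ d₃₁′ d₂₁′ d₃₂₁′} →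
      d₀ ≡ d₀′ → d₁ ≡ d₁′ → d₂ ≡ d₂′ → d₃ ≡ d₃′ → d₃₂ ≡ d₃₂′ → d₃₁ ≡ d₃₁′ → d₂₁ ≡ d₂₁′ → d₃₂₁ ≡ d₃₂₁′ →
      + x * (+ y * (+ z * d₀ + d₃) + (+ z * d₂ + d₃₂)) + (+ y * (+ z * d₁ + d₃₁) + (+ z * d₂₁ + d₃₂₁)) ≡
      + x * (+ y * (+ z * d₀′ + d₃′) + (+ z * d₂′ + d₃₂′)) + (+ y * (+ z * d₁′ + d₃₁′) + (+ z * d₂₁′ + d₃₂₁′))
    substitute ≡.refl ≡.refl ≡.refl ≡.refl ≡.refl ≡.refl ≡.refl ≡.refl = ≡.refl
    identity : ∀ x y z f r s t h →
      x * (y * (z * 0ℤ + f) + (z * f + t)) + (y * (z * f + (r - + 2 * s + t)) + (z * r + h)) ≡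
      (f * (x + y) + r) * z + (f * x * y + x * t + y * (r - + 2 * s + t) + h)
    identity = solve-∀

  module TwoEdges {s t : Fin N} (s≢u : s ≢ u) (t≢u : t ≢ u) where

    D₂ : ℕ → ℕ → List (Vector N) → List (Vector N) → ℤ
    D₂ x y = D F (((u , s) , x) ∷ ((u , t) , y) ∷ ws)

    -- With either edge alone u hangs on the rest as a leaf, whichever its other end is, so x and y
    -- have the same coefficient. This symmetry makes the resultant in `∑₂-product` factor.
    empty : ∀ x y → D₂ x y [] [] ≡
            d′ [] [] * + x + (d′ [] [] * + y + d (u ⊖ t ∷ u ⊖ s ∷ []) (u ⊖ t ∷ u ⊖ s ∷ []))
    empty x y =
      ≡.trans (substitute (D-zeroColumn F zc avoid [] []) (eliminate t≢u t≢u [] []) (eliminate s≢u s≢u [] []))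
              (identity (+ x) (+ y) (d′ [] []) _)
      where
      substitute : ∀ {p q r p′ q′ r′ w} → p ≡ p′ → q ≡ q′ → r ≡ r′ →
        + x * (+ y * p + q) + (+ y * r + w) ≡ + x * (+ y * p′ + q′) + (+ y * r′ + w)
      substitute ≡.refl ≡.refl ≡.refl = ≡.refl
      identity : ∀ x y a w → x * (y * 0ℤ + a) + (y * a + w) ≡ a * x + (a * y + w)
      identity = solve-∀

    coeff : Fin N → Vector N → Vector N → ℤ
    coeff i ξ η = d (u ⊖ i ∷ ξ ∷ []) (u ⊖ i ∷ η ∷ [])

    -- The coefficient of xy uses neither edge at u, and η does not involve u either, so it
    -- vanishes.
    single : ∀ ξ η → η u ≡ 0ℤ → ∀ x y → D₂ x y (ξ ∷ []) (η ∷ []) ≡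
             coeff t ξ η * + x + (coeff s ξ η * + y + d (u ⊖ t ∷ u ⊖ s ∷ ξ ∷ []) (u ⊖ t ∷ u ⊖ s ∷ η ∷ []))
    single ξ η ηu x y =
      ≡.trans (cong (λ p → + x * (+ y * p + coeff t ξ η) + (+ y * coeff s ξ η + rest)) (D-zeroColumnʳ F zc avoid (ξ ∷ []) (ηu ∷ [])))
              (identity (+ x) (+ y) (coeff t ξ η) (coeff s ξ η) rest)
      where
      rest = d (u ⊖ t ∷ u ⊖ s ∷ ξ ∷ []) (u ⊖ t ∷ u ⊖ s ∷ η ∷ [])
      identity : ∀ x y a b w → x * (y * 0ℤ + a) + (y * b + w) ≡ a * x + (b * y + w)
      identity = solve-∀

    -- The edge vectors u - t and u - s differ by s - t, which is off u. Hence in the difference of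
    -- the two coefficients the coordinate u has to be supplied by ξ, and s - t takes the place of ξ
    -- as a test vector.
    coeff-difference : ∀ ξ η → η u ≡ 0ℤ → coeff t ξ η ≡ coeff s ξ η - ξ u * d′ (s ⊖ t ∷ []) (η ∷ [])
    coeff-difference ξ η ηu = begin
      d (u ⊖ t ∷ ξ ∷ []) (u ⊖ t ∷ η ∷ [])                  ≡⟨ dropʳ t≢u _ (ηu ∷ []) ⟩
      d (u ⊖ t ∷ ξ ∷ []) (δ u ∷ η ∷ [])
        ≡⟨ D-linearˡ F ws (ξ ∷ []) (δ u ∷ η ∷ []) 1ℤ 1ℤ (λ i → through (δ u i) (δ t i) (δ s i)) ⟩
      1ℤ * d (u ⊖ s ∷ ξ ∷ []) (δ u ∷ η ∷ []) + 1ℤ * d (s ⊖ t ∷ ξ ∷ []) (δ u ∷ η ∷ [])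
        ≡⟨ cong₂ (λ p q → 1ℤ * p + 1ℤ * q) (≡.sym (dropʳ s≢u _ (ηu ∷ []))) (swap-at (D-alternating F ws (δ u ∷ η ∷ [])) [] (s ⊖ t) ξ []) ⟩
      1ℤ * coeff s ξ η + 1ℤ * - d (ξ ∷ s ⊖ t ∷ []) (δ u ∷ η ∷ [])
        ≡⟨ cong (λ q → 1ℤ * coeff s ξ η + 1ℤ * - q) (eliminate-vector ξ (cong₂ _-_ (δ-distinct s≢u) (δ-distinct t≢u) ∷ []) (ηu ∷ [])) ⟩
      1ℤ * coeff s ξ η + 1ℤ * - (ξ u * d′ (s ⊖ t ∷ []) (η ∷ []))
        ≡⟨ tidy (coeff s ξ η) (ξ u * d′ (s ⊖ t ∷ []) (η ∷ [])) ⟩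
      coeff s ξ η - ξ u * d′ (s ⊖ t ∷ []) (η ∷ []) ∎
      where
      open ≡-Reasoning
      through : ∀ p q r → p - q ≡ 1ℤ * (p - r) + 1ℤ * (r - q)
      through = solve-∀
      tidy : ∀ p q → 1ℤ * p + 1ℤ * - q ≡ p - q
      tidy = solve-∀

  module OneEdge {s : Fin N} (s≢u : s ≢ u) where

    empty₁ : ∀ x → D F (((u , s) , x) ∷ ws) [] [] ≡ d′ [] []
    empty₁ x = ≡.trans (cong₂ (λ p q → + x * p + q) (D-zeroColumn F zc avoid [] []) (eliminate s≢u s≢u [] []))
                       (identity (+ x) (d′ [] []))
      where identity : ∀ x a → x * 0ℤ + a ≡ a
            identity = solve-∀

    -- Here both test vectors involve u, so leaving the edge out is possible, and its coefficient is
    -- the same polynomial that `empty₁` yields; i and j enter only the constant term.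
    single₁ : ∀ {i j} → i ≢ u → j ≢ u → ∀ x → D F (((u , s) , x) ∷ ws) (u ⊖ i ∷ []) (u ⊖ j ∷ []) ≡
              d′ [] [] * + x + d (u ⊖ s ∷ u ⊖ i ∷ []) (u ⊖ s ∷ u ⊖ j ∷ [])
    single₁ i≢u j≢u x = cong (_+ _) (≡.trans (cong (+ x *_) (eliminate i≢u j≢u [] [])) (*-comm (+ x) (d′ [] [])))

-- Counting modulo a prime

∑ : List A → (A → ℤ) → ℤ
∑ []      g = 0ℤ
∑ (a ∷ l) g = g a + ∑ l g

∑-cong : ∀ (l : List A) {g h} → (∀ a → g a ≡ h a) → ∑ l g ≡ ∑ l h
∑-cong []      eq = ≡.refl
∑-cong (a ∷ l) eq = cong₂ _+_ (eq a) (∑-cong l eq)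

∑-linear : ∀ (l : List A) c d g h → ∑ l (λ a → c * g a + d * h a) ≡ c * ∑ l g + d * ∑ l h
∑-linear []      c d g h = identity c d
  where identity : ∀ c d → 0ℤ ≡ c * 0ℤ + d * 0ℤ
        identity = solve-∀
∑-linear (a ∷ l) c d g h = ≡.trans (cong (_+_ (c * g a + d * h a)) (∑-linear l c d g h)) (identity c d (g a) (h a) (∑ l g) (∑ l h))
  where identity : ∀ c d u v s t → (c * u + d * v) + (c * s + d * t) ≡ c * (u + s) + d * (v + t)
        identity = solve-∀

∑-constant : ∀ (l : List A) c → ∑ l (λ _ → c) ≡ + length l * c
∑-constant []      c = ≡.sym (*-zeroˡ c)
∑-constant (a ∷ l) c = ≡.trans (cong (_+_ (c)) (∑-constant l c)) (identity c (+ length l))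
  where identity : ∀ c n → c + n * c ≡ (1ℤ + n) * c
        identity = solve-∀

∑-zero : ∀ (l : List A) {g} → All (λ a → g a ≡ 0ℤ) l → ∑ l g ≡ 0ℤ
∑-zero []      []       = ≡.refl
∑-zero (a ∷ l) (p ∷ ps) = cong₂ _+_ p (∑-zero l ps)

∑-single : ∀ {l : List A} → Unique l → ∀ {x} → x ∈ l → ∀ g → (∀ {a} → a ∈ l → a ≢ x → g a ≡ 0ℤ) → ∑ l g ≡ g x
∑-single {l = a ∷ l} (a∉l ∷ _) (here ≡.refl) g zero-off =
  ≡.trans (cong (_+_ (g a)) (∑-zero l (All.tabulate (λ {b} b∈l → zero-off (there b∈l) (λ b≡a → All.lookup a∉l b∈l (≡.sym b≡a))))))
          (+-identityʳ (g a))
∑-single {l = a ∷ l} (a∉l ∷ u) {x} (there x∈l) g zero-off =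
  ≡.trans (cong₂ _+_ (zero-off (here ≡.refl) (All.lookup a∉l x∈l)) (∑-single u x∈l g (λ a∈l → zero-off (there a∈l))))
          (+-identityˡ (g x))

module Modular (p : ℕ) (prime : Prime p) where

  instance
    p-nonZero : NonZero p
    p-nonZero = prime⇒nonZero prime

  infix 4 _≈_
  record _≈_ (x y : ℤ) : Set where
    constructor mod
    field divisible : + p ∣ x - y
  open _≈_ public

  ≈-reflexive : ∀ {x y} → x ≡ y → x ≈ y
  ≈-reflexive {x} ≡.refl = mod (divides 0ℤ (cancel x))
    where cancel : ∀ x → x - x ≡ 0ℤ
          cancel = solve-∀

  ≈-refl : ∀ {x} → x ≈ x
  ≈-refl = ≈-reflexive ≡.refl

  ≈-sym : ∀ {x y} → x ≈ y → y ≈ x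
  ≈-sym {x} {y} (mod d) = mod (subst (+ p ∣_) (flip x y) (∣m⇒∣-m d))
    where flip : ∀ x y → - (x - y) ≡ y - x
          flip = solve-∀

  ≈-trans : ∀ {x y z} → x ≈ y → y ≈ z → x ≈ z
  ≈-trans {x} {y} {z} (mod d) (mod e) = mod (subst (+ p ∣_) (join x y z) (∣m∣n⇒∣m+n d e))
    where join : ∀ x y z → x - y + (y - z) ≡ x - z
          join = solve-∀

  +-cong : ∀ {x y u v} → x ≈ y → u ≈ v → x + u ≈ y + v
  +-cong {x} {y} {u} {v} (mod d) (mod e) = mod (subst (+ p ∣_) (join x y u v) (∣m∣n⇒∣m+n d e))
    where join : ∀ x y u v → x - y + (u - v) ≡ x + u - (y + v)
          join = solve-∀

  *-cong : ∀ {x y u v} → x ≈ y → u ≈ v → x * u ≈ y * v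
  *-cong {x} {y} {u} {v} (mod d) (mod e) = mod (subst (+ p ∣_) (join x y u v) (∣m∣n⇒∣m+n (∣m⇒∣m*n u d) (∣n⇒∣m*n y e)))
    where join : ∀ x y u v → (x - y) * u + y * (u - v) ≡ x * u - y * v
          join = solve-∀

  -‿cong : ∀ {x y} → x ≈ y → - x ≈ - y
  -‿cong {x} {y} (mod d) = mod (subst (+ p ∣_) (join x y) (∣m⇒∣-m d))
    where join : ∀ x y → - (x - y) ≡ - x - - y
          join = solve-∀

  ≈-setoid : Setoid _ _
  ≈-setoid = record { Carrier = ℤ ; _≈_ = _≈_ ; isEquivalence = record { refl = ≈-refl ; sym = ≈-sym ; trans = ≈-trans } }

  module ≈-Reasoning where
    open import Relation.Binary.Reasoning.Setoid ≈-setoid public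

  multiple≈0 : ∀ m → + p * m ≈ 0ℤ
  multiple≈0 m = mod (divides m (swap (+ p) m))
    where swap : ∀ p m → p * m - 0ℤ ≡ m * p
          swap = solve-∀

  ≈0⇒∣ : ∀ {x} → x ≈ 0ℤ → + p ∣ x
  ≈0⇒∣ {x} (mod d) = subst (+ p ∣_) (+-identityʳ x) d

  ∣⇒≈0 : ∀ {x} → + p ∣ x → x ≈ 0ℤ
  ∣⇒≈0 {x} d = mod (subst (+ p ∣_) (≡.sym (+-identityʳ x)) d)

  *-zeroʳ-≈ : ∀ x {y} → y ≈ 0ℤ → x * y ≈ 0ℤ
  *-zeroʳ-≈ x e = ≈-trans (*-cong (≈-refl {x}) e) (≈-reflexive (*-zeroʳ x))

  *-zeroˡ-≈ : ∀ {x} y → x ≈ 0ℤ → x * y ≈ 0ℤ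
  *-zeroˡ-≈ y e = ≈-trans (*-cong e (≈-refl {y})) (≈-reflexive (*-zeroˡ y))

  integral : ∀ x y → x * y ≈ 0ℤ → x ≈ 0ℤ ⊎ y ≈ 0ℤ
  integral x y e with euclidsLemma ∣ x ∣ ∣ y ∣ prime (subst (p ℕ.∣_) (abs-* x y) (∣⇒∣ᵤ (≈0⇒∣ e)))
  ... | inj₁ d = inj₁ (∣⇒≈0 (∣ᵤ⇒∣ d))
  ... | inj₂ d = inj₂ (∣⇒≈0 (∣ᵤ⇒∣ d))

  cancelˡ : ∀ {x y} → ¬ x ≈ 0ℤ → x * y ≈ 0ℤ → y ≈ 0ℤ
  cancelˡ {x} {y} x≉0 e with integral x y e
  ... | inj₁ x≈0 = ⊥-elim (x≉0 x≈0)
  ... | inj₂ y≈0 = y≈0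

  ≈0-dec : ∀ x → Dec (x ≈ 0ℤ)
  ≈0-dec x with + p ∣? x
  ... | yes d = yes (∣⇒≈0 d)
  ... | no ¬d = no (λ e → ¬d (≈0⇒∣ e))

  abstract
    zero? nonzero? : ℤ → ℤ
    zero? x    = if does (≈0-dec x) then 1ℤ else 0ℤ
    nonzero? x = if does (≈0-dec x) then 0ℤ else 1ℤ

    zero?-yes : ∀ {x} → x ≈ 0ℤ → zero? x ≡ 1ℤ
    zero?-yes {x} e with ≈0-dec x
    ... | yes _ = ≡.refl
    ... | no ¬e = ⊥-elim (¬e e)

    zero?-no : ∀ {x} → ¬ x ≈ 0ℤ → zero? x ≡ 0ℤ
    zero?-no {x} ¬e with ≈0-dec x
    ... | yes e = ⊥-elim (¬e e)
    ... | no _ = ≡.refl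

    nonzero?-def : ∀ x → nonzero? x ≡ 1ℤ - zero? x
    nonzero?-def x with ≈0-dec x
    ... | yes _ = ≡.refl
    ... | no _  = ≡.refl

  nonzero?-yes : ∀ {x} → x ≈ 0ℤ → nonzero? x ≡ 0ℤ
  nonzero?-yes {x} e = ≡.trans (nonzero?-def x) (cong (_-_ 1ℤ) (zero?-yes e))

  nonzero?-no : ∀ {x} → ¬ x ≈ 0ℤ → nonzero? x ≡ 1ℤ
  nonzero?-no {x} e = ≡.trans (nonzero?-def x) (cong (_-_ 1ℤ) (zero?-no e))

  zero?-iff : ∀ {x y} → (x ≈ 0ℤ → y ≈ 0ℤ) → (y ≈ 0ℤ → x ≈ 0ℤ) → zero? x ≡ zero? y
  zero?-iff {x} {y} to from with ≈0-dec x
  ... | yes e = ≡.trans (zero?-yes e) (≡.sym (zero?-yes (to e)))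
  ... | no ¬e = ≡.trans (zero?-no ¬e) (≡.sym (zero?-no (λ e → ¬e (from e))))

  nonzero?-iff : ∀ {x y} → (x ≈ 0ℤ → y ≈ 0ℤ) → (y ≈ 0ℤ → x ≈ 0ℤ) → nonzero? x ≡ nonzero? y
  nonzero?-iff {x} {y} to from =
    ≡.trans (nonzero?-def x) (≡.trans (cong (_-_ 1ℤ) (zero?-iff to from)) (≡.sym (nonzero?-def y)))

  nonzero?-cong : ∀ {x y} → x ≈ y → nonzero? x ≡ nonzero? y
  nonzero?-cong e = nonzero?-iff (≈-trans (≈-sym e)) (≈-trans e)

  nonzero?-* : ∀ x y → nonzero? (x * y) ≡ nonzero? x * nonzero? y
  nonzero?-* x y with ≈0-dec x | ≈0-dec y
  ... | yes e | _     = ≡.trans (nonzero?-yes (*-zeroˡ-≈ y e)) (≡.sym (cong (_* nonzero? y) (nonzero?-yes e)))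
  ... | no _  | yes e = ≡.trans (nonzero?-yes (*-zeroʳ-≈ x e)) (≡.sym (≡.trans (cong (nonzero? x *_) (nonzero?-yes e)) (*-zeroʳ (nonzero? x))))
  ... | no ¬e | no ¬f = ≡.trans (nonzero?-no (λ e → [ ¬e , ¬f ]′ (integral x y e))) (≡.sym (cong₂ _*_ (nonzero?-no ¬e) (nonzero?-no ¬f)))

  residues : List ℕ
  residues = upTo p

  ∑-constant-residues : ∀ c → ∑ residues (λ _ → c) ≡ + p * c
  ∑-constant-residues c = ≡.trans (∑-constant residues c) (cong (λ n → + n * c) (List.length-upTo p))

  inverse : ∀ {c} → ¬ c ≈ 0ℤ → ∃ λ c′ → c * c′ ≈ 1ℤ
  inverse {c} c≉0 with coprime-Bézout {∣ c ∣} {p} coprime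
    where
    coprime : Coprime ∣ c ∣ p
    coprime (d∣c , d∣p) with prime⇒irreducible prime d∣p
    ... | inj₁ d≡1 = d≡1
    ... | inj₂ ≡.refl = ⊥-elim (c≉0 (∣⇒≈0 (∣ᵤ⇒∣ d∣c)))
  ... | bézout = signed c bézout
    where
    fromAbs : ∀ m → Bézout.Identity 1 m p → ∃ λ c′ → + m * c′ ≈ 1ℤ
    fromAbs m (Bézout.+- x y eq) = + x , mod (divides (+ y) (≡.trans (cong (_- 1ℤ) (≡.trans (≡.trans (≡.sym (pos-* m x)) (cong +_ (ℕₚ.*-comm m x)))
      (≡.trans (cong +_ (≡.sym eq)) (cong (_+_ (1ℤ)) (pos-* y p))))) (drop (+ y * + p))))
      where drop : ∀ a → 1ℤ + a - 1ℤ ≡ a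
            drop = solve-∀
    fromAbs m (Bézout.-+ x y eq) = - + x , mod (divides (- + y) (≡.trans (flip (+ m) (+ x))
      (≡.trans (cong -_ (≡.trans (cong (_+_ (1ℤ)) (≡.sym (pos-* x m))) (≡.trans (cong +_ eq) (pos-* y p)))) (neg (+ y) (+ p)))))
      where flip : ∀ m x → m * - x - 1ℤ ≡ - (1ℤ + x * m)
            flip = solve-∀
            neg : ∀ y p → - (y * p) ≡ - y * p
            neg = solve-∀
    signed : ∀ c → Bézout.Identity 1 ∣ c ∣ p → ∃ λ c′ → c * c′ ≈ 1ℤ
    signed (+ m)    b = fromAbs m b
    signed -[1+ m ] b with fromAbs (suc m) b
    ... | c′ , e = - c′ , ≈-trans (≈-reflexive (double -[1+ m ] c′)) e
      where double : ∀ c c′ → c * - c′ ≡ - c * c′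
            double = solve-∀

  residue-unique : ∀ {x y} → x ∈ residues → y ∈ residues → + x ≈ + y → x ≡ y
  residue-unique {x} {y} x∈ y∈ e =
    [ (λ x≤y → ordered x y (∈-upTo⁻ y∈) x≤y (≈-sym e)) , (λ y≤x → ≡.sym (ordered y x (∈-upTo⁻ x∈) y≤x e)) ]′ (ℕₚ.≤-total x y)
    where
    ordered : ∀ x y → y ℕ.< p → x ℕ.≤ y → + y ≈ + x → x ≡ y
    ordered x y y<p x≤y e with ℕₚ.m≤n⇒∃[o]m+o≡n x≤y
    ... | zero , ≡.refl = ≡.sym (ℕₚ.+-identityʳ x)
    ... | suc k , ≡.refl = ⊥-elim (ℕₚ.<⇒≱ (ℕₚ.≤-<-trans (ℕₚ.m≤n+m (suc k) x) y<p) (ℕ.∣⇒≤ (∣⇒∣ᵤ (subst (+ p ∣_) (drop (+ x) (+ suc k)) (divisible e)))))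
      where drop : ∀ x k → x + k - x ≡ k
            drop = solve-∀

  -- The root comes with its sifting property, so that a sum restricted to the zero of an affine
  -- factor becomes evaluation at that zero.
  root : ∀ {c} → ¬ c ≈ 0ℤ → ∀ e → ∃ λ x → c * + x + e ≈ 0ℤ ×
         (∀ (g : ℕ → ℤ) → ∑ residues (λ a → zero? (c * + a + e) * g a) ≡ g x)
  root {c} c≉0 e = x , isRoot , λ g →
      ≡.trans (∑-single (Unique.upTo⁺ p) x∈ (λ a → zero? (c * + a + e) * g a)
                (λ {a} a∈ a≢x → ≡.trans (cong (_* g a) (zero?-no (λ r → a≢x (unique a∈ r)))) (*-zeroˡ (g a))))
              (≡.trans (cong (_* g x) (zero?-yes isRoot)) (*-identityˡ (g x)))
    where
    open ≈-Reasoning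
    c′ = proj₁ (inverse c≉0)
    cc′≈1 = proj₂ (inverse c≉0)
    y = - (c′ * e)
    x = y %ℕ p
    x∈ : x ∈ residues
    x∈ = ∈-upTo⁺ (n%ℕd<d y p)
    x≈y : + x ≈ y
    x≈y = ≈-sym (mod (divides (y /ℕ p) (≡.trans (cong (_- + x) (a≡a%ℕn+[a/ℕn]*n y p)) (drop (+ x) (y /ℕ p * + p)))))
      where drop : ∀ a b → a + b - a ≡ b
            drop = solve-∀
    isRoot : c * + x + e ≈ 0ℤ
    isRoot = begin
      c * + x + e               ≈⟨ +-cong (*-cong (≈-refl {c}) x≈y) (≈-refl {e}) ⟩
      c * - (c′ * e) + e        ≡⟨ assoc c c′ e ⟩
      - (c * c′ * e) + e        ≈⟨ +-cong (-‿cong (*-cong cc′≈1 (≈-refl {e}))) (≈-refl {e}) ⟩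
      - (1ℤ * e) + e            ≡⟨ cancel e ⟩
      0ℤ ∎
      where
      assoc : ∀ c c′ e → c * - (c′ * e) + e ≡ - (c * c′ * e) + e
      assoc = solve-∀
      cancel : ∀ e → - (1ℤ * e) + e ≡ 0ℤ
      cancel = solve-∀
    unique : ∀ {a} → a ∈ residues → c * + a + e ≈ 0ℤ → a ≡ x
    unique {a} a∈ r = residue-unique a∈ x∈ (mod (subst (+ p ∣_) (+-identityʳ (+ a - + x)) (divisible
      (cancelˡ c≉0 (≈-trans (≈-reflexive (difference c (+ a) (+ x) e)) (+-cong r (-‿cong isRoot)))))))
      where difference : ∀ c a x e → c * (a - x) ≡ (c * a + e) - (c * x + e)
            difference = solve-∀

  count-roots : ∀ {c} → ¬ c ≈ 0ℤ → ∀ e → ∑ residues (λ a → zero? (c * + a + e)) ≡ 1ℤ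
  count-roots {c} c≉0 e = let _ , _ , sift = root c≉0 e in
    ≡.trans (∑-cong residues (λ a → ≡.sym (*-identityʳ (zero? (c * + a + e))))) (sift (λ _ → 1ℤ))

  ∑-≈ : ∀ (l : List A) {g h} → (∀ a → g a ≈ h a) → ∑ l g ≈ ∑ l h
  ∑-≈ []      eq = ≈-refl
  ∑-≈ (a ∷ l) eq = +-cong (eq a) (∑-≈ l eq)

  ∑-constant-≈0 : ∀ c → ∑ residues (λ _ → c) ≈ 0ℤ
  ∑-constant-≈0 c = ≈-trans (≈-reflexive (∑-constant-residues c)) (multiple≈0 c)

  ∑-minus : ∀ g h → ∑ residues (λ a → g a - h a) ≡ ∑ residues g - ∑ residues h
  ∑-minus g h = ≡.trans (∑-cong residues (λ a → as-comb (g a) (h a)))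
    (≡.trans (∑-linear residues 1ℤ (- 1ℤ) g h) (≡.sym (as-comb (∑ residues g) (∑ residues h))))
    where as-comb : ∀ u v → u - v ≡ 1ℤ * u + (- 1ℤ) * v
          as-comb = solve-∀

  ∑-+ : ∀ g h → ∑ residues (λ a → g a + h a) ≡ ∑ residues g + ∑ residues h
  ∑-+ g h = ≡.trans (∑-cong residues (λ a → as-comb (g a) (h a)))
    (≡.trans (∑-linear residues 1ℤ 1ℤ g h) (≡.sym (as-comb (∑ residues g) (∑ residues h))))
    where as-comb : ∀ u v → u + v ≡ 1ℤ * u + 1ℤ * v
          as-comb = solve-∀

  ∑-scale : ∀ c g → ∑ residues (λ a → c * g a) ≡ c * ∑ residues g
  ∑-scale c g = ≡.trans (∑-cong residues (λ a → as-comb c (g a)))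
    (≡.trans (∑-linear residues c 0ℤ g g) (≡.sym (as-comb c (∑ residues g))))
    where as-comb : ∀ c u → c * u ≡ c * u + 0ℤ * u
          as-comb = solve-∀

  affine≈ : ∀ {c} → c ≈ 0ℤ → ∀ x e → c * x + e ≈ e
  affine≈ {c} c≈0 x e = ≈-trans (+-cong (*-zeroˡ-≈ x c≈0) (≈-refl {e})) (≈-reflexive (+-identityˡ e))

  ∑-nonzero-affine-exact : ∀ {c} → ¬ c ≈ 0ℤ → ∀ e → ∑ residues (λ x → nonzero? (c * + x + e)) ≡ + p - 1ℤ
  ∑-nonzero-affine-exact {c} c≉0 e =
    ≡.trans (∑-cong residues (λ x → nonzero?-def (c * + x + e)))
    (≡.trans (∑-minus (λ _ → 1ℤ) (λ x → zero? (c * + x + e)))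
             (cong₂ _-_ (≡.trans (∑-constant-residues 1ℤ) (*-identityʳ (+ p))) (count-roots c≉0 e)))

  -- A genuine affine function has p - 1 non-zeros, which is -1 modulo p; a constant is summed p
  -- times and contributes 0.
  ∑-nonzero-affine : ∀ c e → ∑ residues (λ x → nonzero? (c * + x + e)) ≈ - nonzero? c
  ∑-nonzero-affine c e = byCases (≈0-dec c)
    where
    byCases : Dec (c ≈ 0ℤ) → ∑ residues (λ x → nonzero? (c * + x + e)) ≈ - nonzero? c
    byCases (yes c≈0) =
      ≈-trans (≈-reflexive (∑-cong residues (λ x → nonzero?-cong (affine≈ c≈0 (+ x) e))))
      (≈-trans (∑-constant-≈0 (nonzero? e)) (≈-reflexive (≡.sym (cong -_ (nonzero?-yes c≈0)))))
    byCases (no c≉0) =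
      ≈-trans (≈-reflexive (≡.trans (∑-nonzero-affine-exact c≉0 e) (cong (_- 1ℤ) (≡.sym (*-identityʳ (+ p))))))
      (≈-trans (+-cong (multiple≈0 1ℤ) (≈-refl { - 1ℤ})) (≈-reflexive (≡.sym (cong -_ (nonzero?-no c≉0)))))

  -- The first factor is the constant b, so the sum is that of an affine function, switched on by b;
  -- the resultant is then -bc.
  ∑-nonzero-product-degenerate : ∀ {a} b c e → a ≈ 0ℤ →
    ∑ residues (λ x → nonzero? ((a * + x + b) * (c * + x + e))) ≈ - nonzero? (a * e - b * c) - nonzero? (a * c)
  ∑-nonzero-product-degenerate {a} b c e a≈0 = begin
    ∑ residues (λ x → nonzero? ((a * + x + b) * (c * + x + e)))
      ≡⟨ ∑-cong residues (λ x → ≡.trans (nonzero?-* (a * + x + b) (c * + x + e)) (cong (_* nonzero? (c * + x + e)) (nonzero?-cong (affine≈ a≈0 (+ x) b)))) ⟩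
    ∑ residues (λ x → nonzero? b * nonzero? (c * + x + e))
      ≡⟨ ∑-scale (nonzero? b) (λ x → nonzero? (c * + x + e)) ⟩
    nonzero? b * ∑ residues (λ x → nonzero? (c * + x + e))
      ≈⟨ *-cong (≈-refl {nonzero? b}) (∑-nonzero-affine c e) ⟩
    nonzero? b * - nonzero? c
      ≡⟨ rearrange (nonzero? b) (nonzero? c) ⟩
    - (nonzero? b * nonzero? c) - 0ℤ
      ≡⟨ cong₂ (λ u v → - u - v) (≡.trans (≡.sym (nonzero?-* b c)) (nonzero?-iff to from)) (≡.sym (nonzero?-yes (*-zeroˡ-≈ c a≈0))) ⟩
    - nonzero? (a * e - b * c) - nonzero? (a * c) ∎
    where
    open ≈-Reasoning
    rearrange : ∀ u v → u * - v ≡ - (u * v) - 0ℤ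
    rearrange = solve-∀
    drop : a * e - b * c ≈ - (b * c)
    drop = ≈-trans (+-cong (*-zeroˡ-≈ e a≈0) (≈-refl { - (b * c)})) (≈-reflexive (+-identityˡ (- (b * c))))
    to : b * c ≈ 0ℤ → a * e - b * c ≈ 0ℤ
    to bc = ≈-trans drop (-‿cong bc)
    from : a * e - b * c ≈ 0ℤ → b * c ≈ 0ℤ
    from d = ≈-trans (≈-reflexive (≡.sym (neg-involutive (b * c)))) (-‿cong (≈-trans (≈-sym drop) d))

  -- From the non-zeros of the second factor the root x₀ of the first has to be removed, and a(c x₀
  -- + e) is congruent to the resultant ae - bc.
  ∑-nonzero-product-generic : ∀ {a} b c e → ¬ a ≈ 0ℤ →
    ∑ residues (λ x → nonzero? ((a * + x + b) * (c * + x + e))) ≈ - nonzero? (a * e - b * c) - nonzero? (a * c)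
  ∑-nonzero-product-generic {a} b c e a≉0 = begin
    ∑ residues (λ x → nonzero? ((a * + x + b) * (c * + x + e)))
      ≡⟨ ∑-cong residues (λ x → ≡.trans (nonzero?-* (a * + x + b) (c * + x + e))
           (≡.trans (cong (_* nonzero? (c * + x + e)) (nonzero?-def (a * + x + b))) (distrib (zero? (a * + x + b)) (nonzero? (c * + x + e))))) ⟩
    ∑ residues (λ x → nonzero? (c * + x + e) - zero? (a * + x + b) * nonzero? (c * + x + e))
      ≡⟨ ∑-minus (λ x → nonzero? (c * + x + e)) (λ x → zero? (a * + x + b) * nonzero? (c * + x + e)) ⟩
    ∑ residues (λ x → nonzero? (c * + x + e)) - ∑ residues (λ x → zero? (a * + x + b) * nonzero? (c * + x + e))
      ≡⟨ cong (_-_ (∑ residues (λ x → nonzero? (c * + x + e)))) (sift (λ x → nonzero? (c * + x + e))) ⟩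
    ∑ residues (λ x → nonzero? (c * + x + e)) - nonzero? (c * + x₀ + e)
      ≈⟨ +-cong (∑-nonzero-affine c e) (≈-refl { - nonzero? (c * + x₀ + e)}) ⟩
    - nonzero? c - nonzero? (c * + x₀ + e)
      ≡⟨ cong₂ (λ u v → - u - v) (≡.trans (≡.sym (≡.trans (cong (_* nonzero? c) (nonzero?-no a≉0)) (*-identityˡ (nonzero? c)))) (≡.sym (nonzero?-* a c))) (nonzero?-iff to from) ⟩
    - nonzero? (a * c) - nonzero? (a * e - b * c)
      ≡⟨ exchange (nonzero? (a * c)) (nonzero? (a * e - b * c)) ⟩
    - nonzero? (a * e - b * c) - nonzero? (a * c) ∎
    where
    open ≈-Reasoning
    x₀     = proj₁ (root a≉0 b)
    isRoot = proj₁ (proj₂ (root a≉0 b))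
    sift = proj₂ (proj₂ (root a≉0 b))
    distrib : ∀ u v → (1ℤ - u) * v ≡ v - u * v
    distrib = solve-∀
    exchange : ∀ u v → - u - v ≡ - v - u
    exchange = solve-∀
    identity : ∀ a b c e x → a * (c * x + e) ≡ c * (a * x + b) + (a * e - b * c)
    identity = solve-∀
    key : a * (c * + x₀ + e) ≈ a * e - b * c
    key = ≈-trans (≈-reflexive (identity a b c e (+ x₀)))
                  (≈-trans (+-cong (*-zeroʳ-≈ c isRoot) (≈-refl {a * e - b * c})) (≈-reflexive (+-identityˡ (a * e - b * c))))
    to : c * + x₀ + e ≈ 0ℤ → a * e - b * c ≈ 0ℤ
    to d = ≈-trans (≈-sym key) (*-zeroʳ-≈ a d)
    from : a * e - b * c ≈ 0ℤ → c * + x₀ + e ≈ 0ℤ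
    from d = cancelˡ a≉0 (≈-trans key d)

  -- The denominator-reduction step: ∏ (aᵢ x + bᵢ) is replaced by the resultant of its factors.
  ∑-nonzero-product : ∀ a b c e → ∑ residues (λ x → nonzero? ((a * + x + b) * (c * + x + e))) ≈
                      - nonzero? (a * e - b * c) - nonzero? (a * c)
  ∑-nonzero-product a b c e = byCases (≈0-dec a)
    where
    byCases : Dec (a ≈ 0ℤ) → _
    byCases (yes a≈0) = ∑-nonzero-product-degenerate b c e a≈0
    byCases (no a≉0)  = ∑-nonzero-product-generic b c e a≉0

-- Point counts in two edge variables and in the three star variables

module Counting (p : ℕ) (prime : Prime p) where

  open Modular p prime

  ∑₂ : (ℕ → ℕ → ℤ) → ℤ
  ∑₂ g = ∑ residues (λ x → ∑ residues (g x))

  -- The sum over y depends only on the coefficient u, so the sum over x adds p equal terms.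
  ∑₂-affine : ∀ v u w → ∑₂ (λ x y → nonzero? (v * + x + (u * + y + w))) ≈ 0ℤ
  ∑₂-affine v u w = ≈-trans (∑-≈ residues inner) (∑-constant-≈0 (- nonzero? u))
    where
    rearrange : ∀ v u w x y → v * x + (u * y + w) ≡ u * y + (v * x + w)
    rearrange = solve-∀
    inner : ∀ x → ∑ residues (λ y → nonzero? (v * + x + (u * + y + w))) ≈ - nonzero? u
    inner x = ≈-trans (≈-reflexive (∑-cong residues (λ y → cong nonzero? (rearrange v u w (+ x) (+ y)))))
                      (∑-nonzero-affine u (v * + x + w))

  -- Since x and y have the same coefficient in the first factor, the resultant with respect to y
  -- loses its x² term and is affine in x with leading coefficient a(v - u). The leading-coefficient
  -- term of the first summation is free of x and dies in the second, and the two minus signs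
  -- cancel.
  ∑₂-product : ∀ a q v u w → ∑₂ (λ x y → nonzero? ((a * + x + (a * + y + q)) * (v * + x + (u * + y + w)))) ≈
               nonzero? (a * (v - u))
  ∑₂-product a q v u w = begin
    ∑₂ (λ x y → nonzero? ((a * + x + (a * + y + q)) * (v * + x + (u * + y + w))))
      ≈⟨ ∑-≈ residues inner ⟩
    ∑ residues (λ x → - nonzero? (a * (v - u) * + x + (a * w - q * u)) - nonzero? (a * u))
      ≡⟨ ∑-minus (λ x → - nonzero? (a * (v - u) * + x + (a * w - q * u))) (λ _ → nonzero? (a * u)) ⟩
    ∑ residues (λ x → - nonzero? (a * (v - u) * + x + (a * w - q * u))) - ∑ residues (λ _ → nonzero? (a * u))
      ≡⟨ cong (_- ∑ residues (λ _ → nonzero? (a * u))) (≡.trans (∑-cong residues (λ x → as-scale (nonzero? (a * (v - u) * + x + (a * w - q * u)))))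
            (∑-scale (- 1ℤ) (λ x → nonzero? (a * (v - u) * + x + (a * w - q * u))))) ⟩
    (- 1ℤ) * ∑ residues (λ x → nonzero? (a * (v - u) * + x + (a * w - q * u))) - ∑ residues (λ _ → nonzero? (a * u))
      ≈⟨ +-cong (*-cong (≈-refl { - 1ℤ}) (∑-nonzero-affine (a * (v - u)) (a * w - q * u))) (-‿cong (∑-constant-≈0 (nonzero? (a * u)))) ⟩
    (- 1ℤ) * - nonzero? (a * (v - u)) - 0ℤ
      ≡⟨ tidy (nonzero? (a * (v - u))) ⟩
    nonzero? (a * (v - u)) ∎
    where
    open ≈-Reasoning
    as-scale : ∀ x → - x ≡ (- 1ℤ) * x
    as-scale = solve-∀
    tidy : ∀ x → (- 1ℤ) * - x - 0ℤ ≡ x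
    tidy = solve-∀
    rearrange : ∀ v u w x y → v * x + (u * y + w) ≡ u * y + (v * x + w)
    rearrange = solve-∀
    resultant : ∀ a q v u w x → a * (v * x + w) - (a * x + q) * u ≡ a * (v - u) * x + (a * w - q * u)
    resultant = solve-∀
    inner : ∀ x → ∑ residues (λ y → nonzero? ((a * + x + (a * + y + q)) * (v * + x + (u * + y + w)))) ≈
            - nonzero? (a * (v - u) * + x + (a * w - q * u)) - nonzero? (a * u)
    inner x = begin
      ∑ residues (λ y → nonzero? ((a * + x + (a * + y + q)) * (v * + x + (u * + y + w))))
        ≡⟨ ∑-cong residues (λ y → cong₂ (λ s t → nonzero? (s * t)) (rearrange a a q (+ x) (+ y)) (rearrange v u w (+ x) (+ y))) ⟩
      ∑ residues (λ y → nonzero? ((a * + y + (a * + x + q)) * (u * + y + (v * + x + w))))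
        ≈⟨ ∑-nonzero-product a (a * + x + q) u (v * + x + w) ⟩
      - nonzero? (a * (v * + x + w) - (a * + x + q) * u) - nonzero? (a * u)
        ≡⟨ cong (λ s → - nonzero? s - nonzero? (a * u)) (resultant a q v u w (+ x)) ⟩
      - nonzero? (a * (v - u) * + x + (a * w - q * u)) - nonzero? (a * u) ∎

  -- An equality of integers and not a congruence, because the star count built from it is divided
  -- by p².
  count-affine : ∀ c e → ∑ residues (λ x → zero? (c * + x + e)) ≡ nonzero? c + + p * (zero? c * zero? e)
  count-affine c e = byCases (≈0-dec c)
    where
    byCases : Dec (c ≈ 0ℤ) → _
    byCases (yes c≈0) = ≡.trans (∑-cong residues (λ x → zero?-iff (≈-trans (≈-sym (affine≈ c≈0 (+ x) e))) (≈-trans (affine≈ c≈0 (+ x) e))))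
      (≡.trans (∑-constant-residues (zero? e))
      (≡.trans (identity (+ p) (zero? e)) (≡.sym (cong₂ (λ u v → u + + p * (v * zero? e)) (nonzero?-yes c≈0) (zero?-yes c≈0)))))
      where identity : ∀ p z → p * z ≡ 0ℤ + p * (1ℤ * z)
            identity = solve-∀
    byCases (no c≉0) = ≡.trans (count-roots c≉0 e)
      (≡.trans (identity (+ p) (zero? e)) (≡.sym (cong₂ (λ u v → u + + p * (v * zero? e)) (nonzero?-no c≉0) (zero?-no c≉0))))
      where identity : ∀ p z → 1ℤ ≡ 1ℤ + p * (0ℤ * z)
            identity = solve-∀

  square≈0 : ∀ x → x * x ≈ 0ℤ → x ≈ 0ℤ
  square≈0 x e = [ id , id ]′ (integral x x e)

  -- The parameters stand for the values at one point of K of the five polynomials in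
  -- `Eliminate.star`; `slope` and `constant` are the coefficients there of the third star variable.
  module Star (f r s t h : ℤ) (jacobi : f * h ≡ r * t - s * s) where

    private
      slope constant : ℕ → ℕ → ℤ
      slope x y    = f * (+ x + + y) + r
      constant x y = f * + x * + y + + x * t + + y * (r - + 2 * s + t) + h

    count : ℤ
    count = ∑ residues (λ x → ∑ residues (λ y → ∑ residues (λ z → zero? (slope x y * + z + constant x y))))

    private
      allZero = zero? f * zero? r * zero? t

      inner-sum : count ≡ ∑₂ (λ x y → nonzero? (slope x y)) + + p * ∑₂ (λ x y → zero? (slope x y) * zero? (constant x y))
      inner-sum = ≡.trans (∑-cong residues (λ x → ≡.trans (∑-cong residues (λ y → count-affine (slope x y) (constant x y)))
          (≡.trans (∑-+ (λ y → nonzero? (slope x y)) (λ y → + p * (zero? (slope x y) * zero? (constant x y))))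
                   (cong (_+_ (∑ residues (λ y → nonzero? (slope x y)))) (∑-scale (+ p) (λ y → zero? (slope x y) * zero? (constant x y)))))))
        (≡.trans (∑-+ (λ x → ∑ residues (λ y → nonzero? (slope x y))) (λ x → + p * ∑ residues (λ y → zero? (slope x y) * zero? (constant x y))))
                 (cong (_+_ (∑₂ (λ x y → nonzero? (slope x y)))) (∑-scale (+ p) (λ x → ∑ residues (λ y → zero? (slope x y) * zero? (constant x y))))))

      result : ℤ → ℤ → ℤ
      result n z = + p * + p * (n + + p * z)

      generic : ¬ f ≈ 0ℤ → count ≡ result 1ℤ 0ℤ
      generic f≉0 = begin
        count
          ≡⟨ inner-sum ⟩
        ∑₂ (λ x y → nonzero? (slope x y)) + + p * ∑₂ (λ x y → zero? (slope x y) * zero? (constant x y))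
          -- Off the line slope = 0 each of the p(p - 1) points has one z; on the line exactly one
          -- point makes the constant vanish, and it allows all p values of z.
          ≡⟨ cong₂ (λ u v → u + + p * v) first second ⟩
        + p * (+ p - 1ℤ) + + p * 1ℤ
          ≡⟨ identity (+ p) ⟩
        result 1ℤ 0ℤ ∎
        where
        open ≡-Reasoning
        identity : ∀ p → p * (p - 1ℤ) + p * 1ℤ ≡ p * p * (1ℤ + p * 0ℤ)
        identity = solve-∀
        slope-y : ∀ f r x y → f * (x + y) + r ≡ f * y + (f * x + r)
        slope-y = solve-∀
        first : ∑₂ (λ x y → nonzero? (slope x y)) ≡ + p * (+ p - 1ℤ)
        first = ≡.trans (∑-cong residues (λ x → ≡.trans (∑-cong residues (λ y → cong nonzero? (slope-y f r (+ x) (+ y))))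
                                                        (∑-nonzero-affine-exact f≉0 (f * + x + r))))
                        (∑-constant-residues (+ p - 1ℤ))
        -- On the line slope = 0 the quadric degenerates to a double point.
        complete-square : ∀ f r s t h x y →
          f * (f * x * y + x * t + y * (r - + 2 * s + t) + h) ≡
          (f * (x + y) + r) * (f * x + r - + 2 * s + t) - (f * x + (r - s)) * (f * x + (r - s)) + (f * h - (r * t - s * s))
        complete-square = solve-∀
        square : ∀ x y → slope x y ≈ 0ℤ → f * constant x y ≈ - ((f * + x + (r - s)) * (f * + x + (r - s)))
        square x y e = ≈-trans (≈-reflexive (complete-square f r s t h (+ x) (+ y)))
          (≈-trans (+-cong (+-cong (*-zeroˡ-≈ (f * + x + r - + 2 * s + t) e) (≈-refl { - ((f * + x + (r - s)) * (f * + x + (r - s)))}))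
                           (≈-reflexive (≡.trans (cong (_- (r * t - s * s)) jacobi) (cancel (r * t - s * s)))))
                   (≈-reflexive (pad ((f * + x + (r - s)) * (f * + x + (r - s))))))
          where cancel : ∀ a → a - a ≡ 0ℤ
                cancel = solve-∀
                pad : ∀ a → 0ℤ + - a + 0ℤ ≡ - a
                pad = solve-∀
        pointwise : ∀ x y → zero? (slope x y) * zero? (constant x y) ≡ zero? (f * + y + (f * + x + r)) * zero? (f * + x + (r - s))
        pointwise x y = ≡.trans (byCases (≈0-dec (slope x y))) (cong (λ c → zero? c * zero? (f * + x + (r - s))) (slope-y f r (+ x) (+ y)))
          where
          byCases : Dec (slope x y ≈ 0ℤ) → zero? (slope x y) * zero? (constant x y) ≡ zero? (slope x y) * zero? (f * + x + (r - s))
          byCases (no ¬e) = ≡.trans (cong (_* zero? (constant x y)) (zero?-no ¬e)) (≡.sym (cong (_* zero? (f * + x + (r - s))) (zero?-no ¬e)))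
          byCases (yes e) = cong (zero? (slope x y) *_) (zero?-iff
            (λ c → square≈0 _ (≈-trans (≈-reflexive (≡.sym (neg-involutive ((f * + x + (r - s)) * (f * + x + (r - s))))))
                      (-‿cong (≈-trans (≈-sym (square x y e)) (*-zeroʳ-≈ f c)))))
            (λ c → cancelˡ f≉0 (≈-trans (square x y e) (-‿cong (*-zeroˡ-≈ (f * + x + (r - s)) c)))))
        second : ∑₂ (λ x y → zero? (slope x y) * zero? (constant x y)) ≡ 1ℤ
        second = ≡.trans (∑-cong residues (λ x → begin
            ∑ residues (λ y → zero? (slope x y) * zero? (constant x y))
              ≡⟨ ∑-cong residues (λ y → ≡.trans (pointwise x y) (*-comm (zero? (f * + y + (f * + x + r))) (zero? (f * + x + (r - s))))) ⟩
            ∑ residues (λ y → zero? (f * + x + (r - s)) * zero? (f * + y + (f * + x + r)))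
              ≡⟨ ∑-scale (zero? (f * + x + (r - s))) (λ y → zero? (f * + y + (f * + x + r))) ⟩
            zero? (f * + x + (r - s)) * ∑ residues (λ y → zero? (f * + y + (f * + x + r)))
              ≡⟨ cong (zero? (f * + x + (r - s)) *_) (count-roots f≉0 (f * + x + r)) ⟩
            zero? (f * + x + (r - s)) * 1ℤ
              ≡⟨ *-identityʳ (zero? (f * + x + (r - s))) ⟩
            zero? (f * + x + (r - s)) ∎))
          (count-roots f≉0 (r - s))

      sloped : f ≈ 0ℤ → ¬ r ≈ 0ℤ → count ≡ result 1ℤ 0ℤ
      sloped f≈0 r≉0 = begin
        count
          ≡⟨ inner-sum ⟩
        ∑₂ (λ x y → nonzero? (slope x y)) + + p * ∑₂ (λ x y → zero? (slope x y) * zero? (constant x y))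
          ≡⟨ cong₂ (λ u v → u + + p * v) (∑-cong residues (λ x → ∑-cong residues (λ y → nonzero?-no (slope≉0 x y))))
                (∑-cong residues (λ x → ∑-cong residues (λ y → cong (_* zero? (constant x y)) (zero?-no (slope≉0 x y))))) ⟩
        ∑₂ (λ _ _ → 1ℤ) + + p * ∑₂ (λ _ _ → 0ℤ)
          ≡⟨ cong₂ (λ u v → u + + p * v) (constant₂ 1ℤ) (constant₂ 0ℤ) ⟩
        + p * (+ p * 1ℤ) + + p * (+ p * (+ p * 0ℤ))
          ≡⟨ identity (+ p) ⟩
        result 1ℤ 0ℤ ∎
        where
        open ≡-Reasoning
        constant₂ : ∀ c → ∑₂ (λ _ _ → c) ≡ + p * (+ p * c)
        constant₂ c = ≡.trans (∑-cong residues (λ _ → ∑-constant-residues c)) (∑-constant-residues (+ p * c))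
        identity : ∀ p → p * (p * 1ℤ) + p * (p * (p * 0ℤ)) ≡ p * p * (1ℤ + p * 0ℤ)
        identity = solve-∀
        slope≉0 : ∀ x y → ¬ slope x y ≈ 0ℤ
        slope≉0 x y e = r≉0 (≈-trans (≈-sym (affine≈ f≈0 (+ x + + y) r)) e)

      -- The slope is identically 0, so z is free and it remains to count zeros of t(x + y) + h:
      -- there are p of them if t is non-zero, and otherwise p² or none according to h.
      flat : f ≈ 0ℤ → r ≈ 0ℤ → count ≡ result (nonzero? t) (zero? t * zero? h)
      flat f≈0 r≈0 = begin
        count
          ≡⟨ inner-sum ⟩
        ∑₂ (λ x y → nonzero? (slope x y)) + + p * ∑₂ (λ x y → zero? (slope x y) * zero? (constant x y))
          ≡⟨ cong₂ (λ u v → u + + p * v) (∑-cong residues (λ x → ∑-cong residues (λ y → nonzero?-yes (slope≈0 x y))))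
                (∑-cong residues (λ x → ∑-cong residues (λ y → ≡.trans (cong (_* zero? (constant x y)) (zero?-yes (slope≈0 x y)))
                   (≡.trans (*-identityˡ (zero? (constant x y))) (zero?-iff (≈-trans (≈-sym (constant≈ x y))) (≈-trans (constant≈ x y))))))) ⟩
        ∑₂ (λ _ _ → 0ℤ) + + p * ∑₂ (λ x y → zero? (t * + y + (t * + x + h)))
          ≡⟨ cong₂ (λ u v → u + + p * v) (constant₂ 0ℤ) (≡.trans (∑-cong residues (λ x → count-affine t (t * + x + h))) sum-x) ⟩
        + p * (+ p * 0ℤ) + + p * (+ p * nonzero? t + + p * (zero? t * (+ p * zero? h)))
          ≡⟨ identity (+ p) (nonzero? t) (zero? t) (zero? h) ⟩
        result (nonzero? t) (zero? t * zero? h) ∎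
        where
        open ≡-Reasoning
        constant₂ : ∀ c → ∑₂ (λ _ _ → c) ≡ + p * (+ p * c)
        constant₂ c = ≡.trans (∑-cong residues (λ _ → ∑-constant-residues c)) (∑-constant-residues (+ p * c))
        identity : ∀ p n z w → p * (p * 0ℤ) + p * (p * n + p * (z * (p * w))) ≡ p * p * (n + p * (z * w))
        identity = solve-∀
        slope≈0 : ∀ x y → slope x y ≈ 0ℤ
        slope≈0 x y = ≈-trans (affine≈ f≈0 (+ x + + y) r) r≈0
        -- With f and r zero the Jacobi identity reduces to s² = 0, which removes the mixed term of
        -- the constant.
        s≈0 : s ≈ 0ℤ
        s≈0 = square≈0 s (≈-trans (≈-reflexive (solve-square f h r t s jacobi))
                (≈-trans (+-cong (*-zeroˡ-≈ t r≈0) (-‿cong (*-zeroˡ-≈ h f≈0))) (≈-reflexive ≡.refl)))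
          where
          solve-square : ∀ f h r t s → f * h ≡ r * t - s * s → s * s ≡ r * t - f * h
          solve-square f h r t s eq = ≡.trans (double (r * t) (s * s)) (cong (_-_ (r * t)) (≡.sym eq))
            where double : ∀ a b → b ≡ a - (a - b)
                  double = solve-∀
        regroup : ∀ f r s t h x y → f * x * y + x * t + y * (r - + 2 * s + t) + h ≡
                  (f * (x * y) + r * y - s * (+ 2 * y)) + (t * y + (t * x + h))
        regroup = solve-∀
        constant≈ : ∀ x y → constant x y ≈ t * + y + (t * + x + h)
        constant≈ x y = ≈-trans (≈-reflexive (regroup f r s t h (+ x) (+ y)))
          (≈-trans (+-cong (+-cong (+-cong (*-zeroˡ-≈ (+ x * + y) f≈0) (*-zeroˡ-≈ (+ y) r≈0)) (-‿cong (*-zeroˡ-≈ (+ 2 * + y) s≈0)))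
                           (≈-refl {t * + y + (t * + x + h)}))
                   (≈-reflexive (+-identityˡ (t * + y + (t * + x + h)))))
        absorb : ∀ x → zero? t * zero? (t * + x + h) ≡ zero? t * zero? h
        absorb x = byCases (≈0-dec t)
          where
          byCases : Dec (t ≈ 0ℤ) → zero? t * zero? (t * + x + h) ≡ zero? t * zero? h
          byCases (yes e) = cong (zero? t *_) (zero?-iff (≈-trans (≈-sym (affine≈ e (+ x) h))) (≈-trans (affine≈ e (+ x) h)))
          byCases (no ¬e) = ≡.trans (cong (_* zero? (t * + x + h)) (zero?-no ¬e)) (≡.sym (cong (_* zero? h) (zero?-no ¬e)))
        sum-x : ∑ residues (λ x → nonzero? t + + p * (zero? t * zero? (t * + x + h))) ≡ + p * nonzero? t + + p * (zero? t * (+ p * zero? h))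
        sum-x = ≡.trans (∑-cong residues (λ x → cong (λ u → nonzero? t + + p * u) (absorb x)))
          (≡.trans (∑-constant-residues (nonzero? t + + p * (zero? t * zero? h))) (distribute (+ p) (nonzero? t) (zero? t) (zero? h)))
          where distribute : ∀ p n z w → p * (n + p * (z * w)) ≡ p * n + p * (z * (p * w))
                distribute = solve-∀

    star-count : count ≡ + p * + p * ((1ℤ - allZero) + + p * (allZero * zero? h))
    star-count = byCases (≈0-dec f) (≈0-dec r)
      where
      identity₀ : ∀ p z → p * p * (1ℤ + p * 0ℤ) ≡ p * p * ((1ℤ - 0ℤ) + p * (0ℤ * z))
      identity₀ = solve-∀
      byCases : Dec (f ≈ 0ℤ) → Dec (r ≈ 0ℤ) → _
      byCases (no f≉0) _ = ≡.trans (generic f≉0) (≡.trans (identity₀ (+ p) (zero? h))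
        (cong (λ z → + p * + p * ((1ℤ - z) + + p * (z * zero? h))) (≡.sym (cong (λ z → z * zero? r * zero? t) (zero?-no f≉0)))))
      byCases (yes f≈0) (no r≉0) = ≡.trans (sloped f≈0 r≉0) (≡.trans (identity₀ (+ p) (zero? h))
        (cong (λ z → + p * + p * ((1ℤ - z) + + p * (z * zero? h))) (≡.sym (≡.trans (cong (λ z → zero? f * z * zero? t) (zero?-no r≉0))
          (cong (_* zero? t) (*-zeroʳ (zero? f)))))))
      byCases (yes f≈0) (yes r≈0) = ≡.trans (flat f≈0 r≈0)
        (≡.trans (cong (λ n → + p * + p * (n + + p * (zero? t * zero? h))) (nonzero?-def t))
          (cong (λ z → + p * + p * ((1ℤ - z) + + p * (z * zero? h)))
            (≡.sym (≡.trans (cong₂ (λ u v → u * v * zero? t) (zero?-yes f≈0) (zero?-yes r≈0)) (*-identityˡ (zero? t))))))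

    -- When f vanishes, r t = s² makes "r or t is non-zero" expressible by inclusion–exclusion in r, t and s.
    inclusion-exclusion : 1ℤ - allZero ≡
      nonzero? f + (nonzero? r - nonzero? (f * r)) + (nonzero? t - nonzero? (f * t)) - (nonzero? s - nonzero? (f * s))
    inclusion-exclusion = ≡.trans (byCases (≈0-dec f))
      (≡.sym (substitute (nonzero?-* f r) (nonzero?-* f t) (nonzero?-* f s)))
      where
      open ≡-Reasoning
      substitute : ∀ {a b c a′ b′ c′} → a ≡ a′ → b ≡ b′ → c ≡ c′ →
        nonzero? f + (nonzero? r - a) + (nonzero? t - b) - (nonzero? s - c) ≡
        nonzero? f + (nonzero? r - a′) + (nonzero? t - b′) - (nonzero? s - c′)
      substitute ≡.refl ≡.refl ≡.refl = ≡.refl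
      byCases : Dec (f ≈ 0ℤ) → 1ℤ - allZero ≡
        nonzero? f + (nonzero? r - nonzero? f * nonzero? r) + (nonzero? t - nonzero? f * nonzero? t) - (nonzero? s - nonzero? f * nonzero? s)
      byCases (no f≉0) = begin
        1ℤ - zero? f * zero? r * zero? t ≡⟨ cong (λ z → 1ℤ - z * zero? r * zero? t) (zero?-no f≉0) ⟩
        1ℤ - 0ℤ * zero? r * zero? t      ≡⟨ identity (zero? r) (zero? t) (nonzero? r) (nonzero? t) (nonzero? s) ⟩
        1ℤ + (nonzero? r - 1ℤ * nonzero? r) + (nonzero? t - 1ℤ * nonzero? t) - (nonzero? s - 1ℤ * nonzero? s)
          ≡⟨ cong (λ n → n + (nonzero? r - n * nonzero? r) + (nonzero? t - n * nonzero? t) - (nonzero? s - n * nonzero? s)) (nonzero?-no f≉0) ⟨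
        nonzero? f + (nonzero? r - nonzero? f * nonzero? r) + (nonzero? t - nonzero? f * nonzero? t) - (nonzero? s - nonzero? f * nonzero? s) ∎
        where identity : ∀ zr zt r t s → 1ℤ - 0ℤ * zr * zt ≡ 1ℤ + (r - 1ℤ * r) + (t - 1ℤ * t) - (s - 1ℤ * s)
              identity = solve-∀
      byCases (yes f≈0) = begin
        1ℤ - zero? f * zero? r * zero? t ≡⟨ cong (λ z → 1ℤ - z * zero? r * zero? t) (zero?-yes f≈0) ⟩
        1ℤ - 1ℤ * zero? r * zero? t      ≡⟨ identity (zero? r) (zero? t) ⟩
        0ℤ + ((1ℤ - zero? r) - 0ℤ * (1ℤ - zero? r)) + ((1ℤ - zero? t) - 0ℤ * (1ℤ - zero? t)) - ((1ℤ - zero? r) * (1ℤ - zero? t) - 0ℤ)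
          ≡⟨ cong₂ (λ n m → 0ℤ + (n - 0ℤ * n) + (m - 0ℤ * m) - (n * m - 0ℤ)) (nonzero?-def r) (nonzero?-def t) ⟨
        0ℤ + (nonzero? r - 0ℤ * nonzero? r) + (nonzero? t - 0ℤ * nonzero? t) - (nonzero? r * nonzero? t - 0ℤ)
          ≡⟨ cong (λ n → 0ℤ + (nonzero? r - 0ℤ * nonzero? r) + (nonzero? t - 0ℤ * nonzero? t) - (n - 0ℤ)) rt ⟩
        0ℤ + (nonzero? r - 0ℤ * nonzero? r) + (nonzero? t - 0ℤ * nonzero? t) - (nonzero? s - 0ℤ * nonzero? s)
          ≡⟨ cong (λ n → n + (nonzero? r - n * nonzero? r) + (nonzero? t - n * nonzero? t) - (nonzero? s - n * nonzero? s)) (nonzero?-yes f≈0) ⟨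
        nonzero? f + (nonzero? r - nonzero? f * nonzero? r) + (nonzero? t - nonzero? f * nonzero? t) - (nonzero? s - nonzero? f * nonzero? s) ∎
        where
        identity : ∀ a b → 1ℤ - 1ℤ * a * b ≡ 0ℤ + ((1ℤ - a) - 0ℤ * (1ℤ - a)) + ((1ℤ - b) - 0ℤ * (1ℤ - b)) - ((1ℤ - a) * (1ℤ - b) - 0ℤ)
        identity = solve-∀
        rt≈ss : r * t ≈ s * s
        rt≈ss = ≈-trans (≈-reflexive (≡.trans (double (r * t) (s * s)) (cong (_+_ (s * s)) (≡.sym jacobi))))
                        (≈-trans (+-cong (≈-refl {s * s}) (*-zeroˡ-≈ h f≈0)) (≈-reflexive (+-identityʳ (s * s))))
          where double : ∀ a b → a ≡ b + (a - b)
                double = solve-∀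
        rt : nonzero? r * nonzero? t ≡ nonzero? s
        rt = ≡.trans (≡.sym (nonzero?-* r t)) (≡.trans (nonzero?-cong rt≈ss) (nonzero?-iff (square≈0 s) (*-zeroˡ-≈ s)))

-- Sums over the points of the edge space

∑-comm : ∀ R S (g : ℕ → ℕ → ℤ) → ∑ R (λ a → ∑ S (g a)) ≡ ∑ S (λ b → ∑ R (λ a → g a b))
∑-comm []      S g = ≡.sym (≡.trans (∑-constant S 0ℤ) (*-zeroʳ (+ length S)))
∑-comm (a ∷ R) S g = ≡.trans (cong (_+_ (∑ S (g a))) (∑-comm R S g)) (≡.sym (add S (g a) (λ b → ∑ R (λ a′ → g a′ b))))
  where
  one : ∀ u v → u + v ≡ 1ℤ * u + 1ℤ * v
  one = solve-∀
  add : ∀ S (g h : ℕ → ℤ) → ∑ S (λ b → g b + h b) ≡ ∑ S g + ∑ S h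
  add S g h = ≡.trans (∑-cong S (λ b → one (g b) (h b))) (≡.trans (∑-linear S 1ℤ 1ℤ g h) (≡.sym (one (∑ S g) (∑ S h))))

-- The summand receives each edge paired with its value. This lets `D` apply directly, lets values
-- move with their edges when the list is reordered, and lets pointwise arguments use facts about
-- the edges.
∑pts : List ℕ → List A → (List (A × ℕ) → ℤ) → ℤ
∑pts R []       g = g []
∑pts R (e ∷ es) g = ∑ R (λ a → ∑pts R es (λ ws → g ((e , a) ∷ ws)))

∑pts-cong : ∀ R (es : List A) {g h : List (A × ℕ) → ℤ} → (∀ ws → map proj₁ ws ≡ es → g ws ≡ h ws) →
            ∑pts R es g ≡ ∑pts R es h
∑pts-cong R []       eq = eq [] ≡.refl
∑pts-cong R (e ∷ es) eq = ∑-cong R (λ a → ∑pts-cong R es (λ ws p → eq ((e , a) ∷ ws) (cong (e ∷_) p)))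

∑pts-linear : ∀ R (es : List A) c d (g h : List (A × ℕ) → ℤ) →
              ∑pts R es (λ ws → c * g ws + d * h ws) ≡ c * ∑pts R es g + d * ∑pts R es h
∑pts-linear R []       c d g h = ≡.refl
∑pts-linear R (e ∷ es) c d g h =
  ≡.trans (∑-cong R (λ a → ∑pts-linear R es c d (λ ws → g ((e , a) ∷ ws)) (λ ws → h ((e , a) ∷ ws)))) (∑-linear R c d _ _)

∑pts-∑-comm : ∀ R S (es : List A) (g : ℕ → List (A × ℕ) → ℤ) →
              ∑ S (λ x → ∑pts R es (g x)) ≡ ∑pts R es (λ ws → ∑ S (λ x → g x ws))
∑pts-∑-comm R S []       g = ≡.refl
∑pts-∑-comm R S (e ∷ es) g =
  ≡.trans (∑-comm S R (λ x a → ∑pts R es (λ ws → g x ((e , a) ∷ ws))))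
          (∑-cong R (λ a → ∑pts-∑-comm R S es (λ x ws → g x ((e , a) ∷ ws))))

-- Permutations of a list of edges, together with reversals φ of the orientation of single edges.
data Reorder {A : Set} (φ : A → A) : List A → List A → Set where
  refl  : ∀ {xs} → Reorder φ xs xs
  prep  : ∀ x {xs ys} → Reorder φ xs ys → Reorder φ (x ∷ xs) (x ∷ ys)
  swap  : ∀ x y {xs} → Reorder φ (x ∷ y ∷ xs) (y ∷ x ∷ xs)
  flip  : ∀ x {xs} → Reorder φ (x ∷ xs) (φ x ∷ xs)
  trans : ∀ {xs ys zs} → Reorder φ xs ys → Reorder φ ys zs → Reorder φ xs zs

↭⇒Reorder : ∀ {φ : A → A} {xs ys} → xs ↭ ys → Reorder φ xs ys
↭⇒Reorder ↭.refl         = refl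
↭⇒Reorder (↭.prep x p)   = prep x (↭⇒Reorder p)
↭⇒Reorder (↭.swap x y p) = trans (prep x (prep y (↭⇒Reorder p))) (swap x y)
↭⇒Reorder (↭.trans p q)  = trans (↭⇒Reorder p) (↭⇒Reorder q)

∑pts-reorder : ∀ R {φ : A → A} {es es′} → Reorder φ es es′ → ∀ {g} →
               (∀ {ws ws′} → Reorder (mapFst φ) ws ws′ → g ws ≡ g ws′) → ∑pts R es g ≡ ∑pts R es′ g
∑pts-reorder R refl                inv = ≡.refl
∑pts-reorder R (prep x r)          inv = ∑-cong R (λ a → ∑pts-reorder R r (λ q → inv (prep (x , a) q)))
∑pts-reorder R (swap x y {es}) {g} inv =
  ≡.trans (∑-comm R R (λ a b → ∑pts R es (λ ws → g ((x , a) ∷ (y , b) ∷ ws))))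
          (∑-cong R (λ b → ∑-cong R (λ a → ∑pts-cong R es (λ ws _ → inv (swap (x , a) (y , b))))))
∑pts-reorder R (flip x {es})       inv = ∑-cong R (λ a → ∑pts-cong R es (λ ws _ → inv (flip (x , a))))
∑pts-reorder R (trans r q)         inv = ≡.trans (∑pts-reorder R r inv) (∑pts-reorder R q inv)

D-reorder : ∀ {N} (F : Form N) {ws ws′} → Reorder (mapFst flipPair) ws ws′ → ∀ X Y → D F ws X Y ≡ D F ws′ X Y
D-reorder F refl X Y = ≡.refl
D-reorder F (prep (e , α) r) X Y = cong₂ (λ u v → + α * u + v) (D-reorder F r X Y) (D-reorder F r _ _)
D-reorder F (swap x y {ws}) X Y = D-perm F {x ∷ y ∷ ws} {y ∷ x ∷ ws} (↭.swap x y ↭.refl) X Y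
D-reorder F (flip ((s , t) , α) {ws}) X Y = D-flip F s t α ws X Y
D-reorder F (trans r q) X Y = ≡.trans (D-reorder F r X Y) (D-reorder F q X Y)

-- Reducing the point counts at a and b

Avoids : ∀ {N} → Fin N → List (Edge N) → Set
Avoids u = All (λ e → vec e u ≡ 0ℤ)

avoids-weighted : ∀ {N} {u : Fin N} {es} {ws : List (Edge N × ℕ)} → Avoids u es → map proj₁ ws ≡ es → All (λ w → vec (proj₁ w) u ≡ 0ℤ) ws
avoids-weighted av ≡.refl = All.map⁻ av

module Reduction (p : ℕ) (prime : Prime p) where

  open Modular p prime
  open Counting p prime

  ∑F : List A → (List (A × ℕ) → ℤ) → ℤ
  ∑F = ∑pts residues

  ∑F-≈ : ∀ (es : List A) {g h : List (A × ℕ) → ℤ} → (∀ ws → map proj₁ ws ≡ es → g ws ≈ h ws) → ∑F es g ≈ ∑F es h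
  ∑F-≈ []       eq = eq [] ≡.refl
  ∑F-≈ (e ∷ es) eq = ∑-≈ residues (λ a → ∑F-≈ es (λ ws q → eq ((e , a) ∷ ws) (cong (e ∷_) q)))

  ∑F-zero : ∀ (es : List A) {g} → (∀ ws → map proj₁ ws ≡ es → g ws ≈ 0ℤ) → ∑F es g ≈ 0ℤ
  ∑F-zero es {g} eq = ≈-trans (∑F-≈ es eq) (≈-reflexive (≡.trans (∑pts-linear residues es 0ℤ 0ℤ (λ _ → 0ℤ) (λ _ → 0ℤ)) ≡.refl))

  module AtVertex {N} (F : Form N) {u : Fin N} (zc : ZeroColumn F u) {es : List (Edge N)} (avoid : Avoids u es) where

    module _ {s t : Fin N} (s≢u : s ≢ u) (t≢u : t ≢ u) (ξ η : Vector N) (ηu : η u ≡ 0ℤ) where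

      private
        es₂ : List (Edge N)
        es₂ = (u , s) ∷ (u , t) ∷ es
        push : ∀ (g : List (Edge N × ℕ) → ℤ) →
               ∑F es₂ g ≡ ∑F es (λ ws → ∑₂ (λ x y → g (((u , s) , x) ∷ ((u , t) , y) ∷ ws)))
        push g = ≡.trans (∑-cong residues (λ x → ∑pts-∑-comm residues residues es (λ y ws → g (((u , s) , x) ∷ ((u , t) , y) ∷ ws))))
                         (∑pts-∑-comm residues residues es (λ x ws → ∑ residues (λ y → g (((u , s) , x) ∷ ((u , t) , y) ∷ ws))))

      -- For a single factor the two edge variables at u occur without an xy term, so summing over
      -- both of them already gives 0 modulo p. This removes the counts for t and s.
      two-edges-single : ∑F ((u , s) ∷ (u , t) ∷ es) (λ ws → nonzero? (D F ws (ξ ∷ []) (η ∷ []))) ≈ 0ℤ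
      two-edges-single = ≈-trans (≈-reflexive (push (λ ws → nonzero? (D F ws (ξ ∷ []) (η ∷ []))))) (∑F-zero es pointwise)
        where
        pointwise : ∀ ws → map proj₁ ws ≡ es →
          ∑₂ (λ x y → nonzero? (D F (((u , s) , x) ∷ ((u , t) , y) ∷ ws) (ξ ∷ []) (η ∷ []))) ≈ 0ℤ
        pointwise ws eq = ≈-trans
          (≈-reflexive (∑-cong residues (λ x → ∑-cong residues (λ y → cong nonzero? (single ξ η ηu x y)))))
          (∑₂-affine (coeff t ξ η) (coeff s ξ η) (D F ws (u ⊖ t ∷ u ⊖ s ∷ ξ ∷ []) (u ⊖ t ∷ u ⊖ s ∷ η ∷ [])))
          where open Eliminate.TwoEdges F zc (avoids-weighted avoid eq) s≢u t≢u

      -- The resultant only sees the difference of the coefficients of the second factor, that is,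
      -- `coeff-difference`. The scalar ξ(u) is kept inside, to be 0, -1 or 1 in the applications;
      -- signs do not affect non-vanishing.
      two-edges-product : ∑F ((u , s) ∷ (u , t) ∷ es) (λ ws → nonzero? (D F ws [] [] * D F ws (ξ ∷ []) (η ∷ []))) ≈
        ∑F es (λ ws → nonzero? (ξ u * (D (ground (δ u) F) ws [] [] * D (ground (δ u) F) ws (s ⊖ t ∷ []) (η ∷ []))))
      two-edges-product = ≈-trans (≈-reflexive (push (λ ws → nonzero? (D F ws [] [] * D F ws (ξ ∷ []) (η ∷ []))))) (∑F-≈ es pointwise)
        where
        pointwise : ∀ ws → map proj₁ ws ≡ es →
          ∑₂ (λ x y → nonzero? (D F (((u , s) , x) ∷ ((u , t) , y) ∷ ws) [] [] * D F (((u , s) , x) ∷ ((u , t) , y) ∷ ws) (ξ ∷ []) (η ∷ []))) ≈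
          nonzero? (ξ u * (D (ground (δ u) F) ws [] [] * D (ground (δ u) F) ws (s ⊖ t ∷ []) (η ∷ [])))
        pointwise ws eq = begin
          ∑₂ (λ x y → nonzero? (D F (((u , s) , x) ∷ ((u , t) , y) ∷ ws) [] [] * D F (((u , s) , x) ∷ ((u , t) , y) ∷ ws) (ξ ∷ []) (η ∷ [])))
            ≡⟨ ∑-cong residues (λ x → ∑-cong residues (λ y → cong₂ (λ c d → nonzero? (c * d)) (empty x y) (single ξ η ηu x y))) ⟩
          ∑₂ (λ x y → nonzero? ((a * + x + (a * + y + q)) * (v * + x + (w * + y + rest))))
            ≈⟨ ∑₂-product a q v w rest ⟩
          nonzero? (a * (v - w))
            ≡⟨ cong (λ c → nonzero? (a * (c - w))) (coeff-difference ξ η ηu) ⟩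
          nonzero? (a * (w - ξ u * m - w))
            ≡⟨ nonzero?-iff (λ e → ≈-trans (≈-reflexive (flipSign a w (ξ u) m)) (-‿cong e))
                            (λ e → ≈-trans (≈-reflexive (flipSign′ a w (ξ u) m)) (-‿cong e)) ⟩
          nonzero? (ξ u * (a * m)) ∎
          where
          open ≈-Reasoning
          open Eliminate.TwoEdges F zc (avoids-weighted avoid eq) s≢u t≢u
          a = D (ground (δ u) F) ws [] []
          m = D (ground (δ u) F) ws (s ⊖ t ∷ []) (η ∷ [])
          q = D F ws (u ⊖ t ∷ u ⊖ s ∷ []) (u ⊖ t ∷ u ⊖ s ∷ [])
          v = coeff t ξ η
          w = coeff s ξ η
          rest = D F ws (u ⊖ t ∷ u ⊖ s ∷ ξ ∷ []) (u ⊖ t ∷ u ⊖ s ∷ η ∷ [])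
          flipSign : ∀ a w k m → k * (a * m) ≡ - (a * (w - k * m - w))
          flipSign = solve-∀
          flipSign′ : ∀ a w k m → a * (w - k * m - w) ≡ - (k * (a * m))
          flipSign′ = solve-∀

    -- The empty value is free of the edge variable, and it is also the leading coefficient of the
    -- other factor. The constant term, the only place where i and j occur, is lost in the
    -- summation.
    one-edge-product : ∀ {s i j} → s ≢ u → i ≢ u → j ≢ u →
      ∑F ((u , s) ∷ es) (λ ws → nonzero? (D F ws [] [] * D F ws (u ⊖ i ∷ []) (u ⊖ j ∷ []))) ≈
      ∑F es (λ ws → nonzero? (D (ground (δ u) F) ws [] []) * - nonzero? (D (ground (δ u) F) ws [] []))
    one-edge-product {s} {i} {j} s≢u i≢u j≢u =
      ≈-trans (≈-reflexive (∑pts-∑-comm residues residues es (λ x ws → nonzero? (D F (((u , s) , x) ∷ ws) [] [] * D F (((u , s) , x) ∷ ws) (u ⊖ i ∷ []) (u ⊖ j ∷ [])))))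
              (∑F-≈ es pointwise)
      where
      pointwise : ∀ ws → map proj₁ ws ≡ es →
        ∑ residues (λ x → nonzero? (D F (((u , s) , x) ∷ ws) [] [] * D F (((u , s) , x) ∷ ws) (u ⊖ i ∷ []) (u ⊖ j ∷ []))) ≈
        nonzero? (D (ground (δ u) F) ws [] []) * - nonzero? (D (ground (δ u) F) ws [] [])
      pointwise ws eq = begin
        ∑ residues (λ x → nonzero? (D F (((u , s) , x) ∷ ws) [] [] * D F (((u , s) , x) ∷ ws) (u ⊖ i ∷ []) (u ⊖ j ∷ [])))
          ≡⟨ ∑-cong residues (λ x → ≡.trans (cong₂ (λ c d → nonzero? (c * d)) (empty₁ x) (single₁ i≢u j≢u x)) (nonzero?-* a (a * + x + rest))) ⟩
        ∑ residues (λ x → nonzero? a * nonzero? (a * + x + rest))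
          ≡⟨ ∑-scale (nonzero? a) (λ x → nonzero? (a * + x + rest)) ⟩
        nonzero? a * ∑ residues (λ x → nonzero? (a * + x + rest))
          ≈⟨ *-cong (≈-refl {nonzero? a}) (∑-nonzero-affine a rest) ⟩
        nonzero? a * - nonzero? a ∎
        where
        open ≈-Reasoning
        open Eliminate F zc (avoids-weighted avoid eq)
        open OneEdge s≢u
        a = D (ground (δ u) F) ws [] []
        rest = D F ws (u ⊖ s ∷ u ⊖ i ∷ []) (u ⊖ s ∷ u ⊖ j ∷ [])

  -- c₂ of a graph with a 3-valent vertex attached to a, b, c is the number of points of the rest of
  -- the graph at which this indicator is 1.
  indicator : ∀ {N} → Form N → (a b c : Fin N) → List (Edge N × ℕ) → ℤ
  indicator F a b c ws = 1ℤ - zero? (D F ws [] []) * zero? (D F ws (b ⊖ a ∷ []) (b ⊖ a ∷ [])) * zero? (D F ws (b ⊖ c ∷ []) (b ⊖ c ∷ []))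

  module ReduceFirst {N} (F : Form N) {a b : Fin N} (a≢b : a ≢ b) (zcᵃ : ZeroColumn F a) {a₁ a₂ : Fin N}
    (a₁≢a : a₁ ≢ a) (a₂≢a : a₂ ≢ a) {es : List (Edge N)} (avoidᵃ : Avoids a es) where

    private
      K : List (Edge N)
      K  = (a , a₁) ∷ (a , a₂) ∷ es
      b≢a : b ≢ a
      b≢a e = a≢b (≡.sym e)

      q : List (Edge N × ℕ) → Vector N → Vector N → ℤ
      q ws ξ η = D F ws (ξ ∷ []) (η ∷ [])

      off : ∀ {i j k : Fin N} → i ≢ k → j ≢ k → (i ⊖ j) k ≡ 0ℤ
      off i≢k j≢k = cong₂ _-_ (δ-distinct i≢k) (δ-distinct j≢k)

      base : List (Edge N × ℕ) → ℤ
      base ws = nonzero? (D F ws [] []) + (nonzero? (q ws (b ⊖ a) (b ⊖ a)) - nonzero? (D F ws [] [] * q ws (b ⊖ a) (b ⊖ a)))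

    -- The counts for f, r and fr, in which c does not occur. They are never evaluated, since they
    -- agree for the two vertices being compared.
    constantPart : ℤ
    constantPart = ∑F K base

    indicator-reduced : ∀ {c} → c ≢ a → ∑F ((a , a₁) ∷ (a , a₂) ∷ es) (indicator F a b c) ≈
      constantPart + ∑F es (λ ws → nonzero? (D (ground (δ a) F) ws [] [] * D (ground (δ a) F) ws (a₁ ⊖ a₂ ∷ []) (b ⊖ c ∷ [])))
    indicator-reduced {c} c≢a = begin
      ∑F K (indicator F a b c)
        ≡⟨ ∑pts-cong residues K (λ ws _ → ≡.trans (Star.inclusion-exclusion (D F ws [] []) (q ws (b ⊖ a) (b ⊖ a)) (q ws (b ⊖ a) (b ⊖ c)) (q ws (b ⊖ c) (b ⊖ c))
                (D F ws (b ⊖ a ∷ b ⊖ c ∷ []) (b ⊖ a ∷ b ⊖ c ∷ [])) (D-jacobi F ws (b ⊖ a) (b ⊖ c))) (split (base ws) (nt ws) (nft ws) (ns ws) (nfs ws))) ⟩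
      ∑F K (λ ws → 1ℤ * (1ℤ * (1ℤ * base ws + 1ℤ * nt ws) + (- 1ℤ) * nft ws) + 1ℤ * ((- 1ℤ) * ns ws + 1ℤ * nfs ws))
        ≡⟨ ≡.trans (∑pts-linear residues K 1ℤ 1ℤ (λ ws → 1ℤ * (1ℤ * base ws + 1ℤ * nt ws) + (- 1ℤ) * nft ws) (λ ws → (- 1ℤ) * ns ws + 1ℤ * nfs ws))
             (cong₂ (λ u v → 1ℤ * u + 1ℤ * v)
               (≡.trans (∑pts-linear residues K 1ℤ (- 1ℤ) (λ ws → 1ℤ * base ws + 1ℤ * nt ws) nft)
                        (cong (λ u → 1ℤ * u + (- 1ℤ) * ∑F K nft) (∑pts-linear residues K 1ℤ 1ℤ base nt)))
               (∑pts-linear residues K (- 1ℤ) 1ℤ ns nfs)) ⟩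
      1ℤ * (1ℤ * (1ℤ * ∑F K base + 1ℤ * ∑F K nt) + (- 1ℤ) * ∑F K nft) + 1ℤ * ((- 1ℤ) * ∑F K ns + 1ℤ * ∑F K nfs)
        ≡⟨ split (∑F K base) (∑F K nt) (∑F K nft) (∑F K ns) (∑F K nfs) ⟨
      ∑F K base + (∑F K nt - ∑F K nft) - (∑F K ns - ∑F K nfs)
        ≈⟨ +-cong (+-cong (≈-refl {∑F K base}) (+-cong nt≈0 (-‿cong nft≈0))) (-‿cong (+-cong ns≈0 (-‿cong nfs≈))) ⟩
      ∑F K base + (0ℤ - 0ℤ) - (0ℤ - reduced)
        ≡⟨ tidy (∑F K base) reduced ⟩
      ∑F K base + reduced ∎
      where
      open ≈-Reasoning
      nt nft ns nfs : List (Edge N × ℕ) → ℤ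
      nt ws  = nonzero? (q ws (b ⊖ c) (b ⊖ c))
      nft ws = nonzero? (D F ws [] [] * q ws (b ⊖ c) (b ⊖ c))
      ns ws  = nonzero? (q ws (b ⊖ a) (b ⊖ c))
      nfs ws = nonzero? (D F ws [] [] * q ws (b ⊖ a) (b ⊖ c))
      reduced = ∑F es (λ ws → nonzero? (D (ground (δ a) F) ws [] [] * D (ground (δ a) F) ws (a₁ ⊖ a₂ ∷ []) (b ⊖ c ∷ [])))
      split : ∀ z t ft s fs → z + (t - ft) - (s - fs) ≡ 1ℤ * (1ℤ * (1ℤ * z + 1ℤ * t) + (- 1ℤ) * ft) + 1ℤ * ((- 1ℤ) * s + 1ℤ * fs)
      split = solve-∀
      tidy : ∀ z w → z + (0ℤ - 0ℤ) - (0ℤ - w) ≡ z + w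
      tidy = solve-∀
      offbc : (b ⊖ c) a ≡ 0ℤ
      offbc = off b≢a c≢a
      open AtVertex F zcᵃ avoidᵃ
      nt≈0 : ∑F K nt ≈ 0ℤ
      nt≈0 = two-edges-single a₁≢a a₂≢a (b ⊖ c) (b ⊖ c) offbc
      ns≈0 : ∑F K ns ≈ 0ℤ
      ns≈0 = two-edges-single a₁≢a a₂≢a (b ⊖ a) (b ⊖ c) offbc
      -- The factor ξ(a) of the reduced product is 0 here, because b - c does not involve a.
      nft≈0 : ∑F K nft ≈ 0ℤ
      nft≈0 = ≈-trans (two-edges-product a₁≢a a₂≢a (b ⊖ c) (b ⊖ c) offbc)
        (∑F-zero es (λ ws _ → ≈-reflexive (nonzero?-yes (≈-reflexive
          (≡.trans (cong (_* (D (ground (δ a) F) ws [] [] * D (ground (δ a) F) ws (a₁ ⊖ a₂ ∷ []) (b ⊖ c ∷ []))) offbc) (*-zeroˡ (D (ground (δ a) F) ws [] [] * D (ground (δ a) F) ws (a₁ ⊖ a₂ ∷ []) (b ⊖ c ∷ []))))))))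
      -- This coordinate is a unit, which is why fs is the one term involving c that survives.
      unit : (b ⊖ a) a ≡ - 1ℤ
      unit = cong₂ _-_ (δ-distinct b≢a) (δ-same a)
      nfs≈ : ∑F K nfs ≈ reduced
      nfs≈ = ≈-trans (two-edges-product a₁≢a a₂≢a (b ⊖ a) (b ⊖ c) offbc)
        (≈-reflexive (∑pts-cong residues es (λ ws _ →
          ≡.trans (cong (λ k → nonzero? (k * (D (ground (δ a) F) ws [] [] * D (ground (δ a) F) ws (a₁ ⊖ a₂ ∷ []) (b ⊖ c ∷ [])))) unit)
                  (nonzero?-neg (D (ground (δ a) F) ws [] [] * D (ground (δ a) F) ws (a₁ ⊖ a₂ ∷ []) (b ⊖ c ∷ []))))))
        where
        as-neg : ∀ x → (- 1ℤ) * x ≡ - x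
        as-neg = solve-∀
        nonzero?-neg : ∀ x → nonzero? ((- 1ℤ) * x) ≡ nonzero? x
        nonzero?-neg x = nonzero?-iff (λ e → ≈-trans (≈-reflexive (≡.trans (≡.sym (neg-involutive x)) (cong -_ (≡.sym (as-neg x))))) (-‿cong e))
                                      (λ e → ≈-trans (≈-reflexive (as-neg x)) (-‿cong e))

  module ThirdNeighbour {N} (F : Form N) {a b : Fin N} (a≢b : a ≢ b) (zcᵃ : ZeroColumn F a) (zcᵇ : ZeroColumn F b) where

    private
      zcᵇ′ : ZeroColumn (ground (δ a) F) b
      zcᵇ′ = ground-zeroColumn {F = F} zcᵇ (δ-distinct a≢b)

      off : ∀ {i j k : Fin N} → i ≢ k → j ≢ k → (i ⊖ j) k ≡ 0ℤ
      off i≢k j≢k = cong₂ _-_ (δ-distinct i≢k) (δ-distinct j≢k)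

    nonadjacent : ∀ {a₁ a₂ b₁ b₂ M} → a₁ ≢ a → a₂ ≢ a → a₁ ≢ b → a₂ ≢ b → b₁ ≢ b → b₂ ≢ b →
      Avoids a ((b , b₁) ∷ (b , b₂) ∷ M) → Avoids b M →
      ∀ {c d} → c ≢ a → c ≢ b → d ≢ a → d ≢ b →
      let K = (a , a₁) ∷ (a , a₂) ∷ (b , b₁) ∷ (b , b₂) ∷ M in
      ∑F K (indicator F a b c) ≈ ∑F K (indicator F a b d)
    nonadjacent {a₁} {a₂} {b₁} {b₂} {M} a₁≢a a₂≢a a₁≢b a₂≢b b₁≢b b₂≢b avoidᵃ avoidᵇ {c} {d} c≢a c≢b d≢a d≢b =
      ≈-trans (value c≢a c≢b) (≈-sym (value d≢a d≢b))
      where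
      open ReduceFirst F a≢b zcᵃ a₁≢a a₂≢a avoidᵃ
      final : ℤ
      final = ∑F M (λ ws → nonzero? (D (ground (δ b) (ground (δ a) F)) ws [] [] * D (ground (δ b) (ground (δ a) F)) ws (b₁ ⊖ b₂ ∷ []) (a₁ ⊖ a₂ ∷ [])))
      value : ∀ {c} → c ≢ a → c ≢ b → ∑F ((a , a₁) ∷ (a , a₂) ∷ (b , b₁) ∷ (b , b₂) ∷ M) (indicator F a b c) ≈ constantPart + final
      value {c} c≢a c≢b = ≈-trans (indicator-reduced c≢a) (+-cong (≈-refl {constantPart}) (begin
        ∑F es (λ ws → nonzero? (D (ground (δ a) F) ws [] [] * D (ground (δ a) F) ws (a₁ ⊖ a₂ ∷ []) (b ⊖ c ∷ [])))
          -- The two slots are exchanged because the slot that may involve the eliminated vertex is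
          -- the left one: b - c involves b, while a₁ - a₂ is off b when a and b are not adjacent.
          ≡⟨ ∑pts-cong residues es (λ ws _ → cong (λ u → nonzero? (D (ground (δ a) F) ws [] [] * u)) (D-sym (ground (δ a) F) ws (a₁ ⊖ a₂ ∷ []) (b ⊖ c ∷ []))) ⟩
        ∑F es (λ ws → nonzero? (D (ground (δ a) F) ws [] [] * D (ground (δ a) F) ws (b ⊖ c ∷ []) (a₁ ⊖ a₂ ∷ [])))
          ≈⟨ AtVertex.two-edges-product (ground (δ a) F) zcᵇ′ avoidᵇ b₁≢b b₂≢b (b ⊖ c) (a₁ ⊖ a₂) (off a₁≢b a₂≢b) ⟩
        ∑F M (λ ws → nonzero? ((b ⊖ c) b * (D (ground (δ b) (ground (δ a) F)) ws [] [] * D (ground (δ b) (ground (δ a) F)) ws (b₁ ⊖ b₂ ∷ []) (a₁ ⊖ a₂ ∷ []))))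
          ≡⟨ ∑pts-cong residues M (λ ws _ → cong nonzero? (≡.trans
               (cong (_* (D (ground (δ b) (ground (δ a) F)) ws [] [] * D (ground (δ b) (ground (δ a) F)) ws (b₁ ⊖ b₂ ∷ []) (a₁ ⊖ a₂ ∷ []))) (cong₂ _-_ (δ-same b) (δ-distinct c≢b)))
               (*-identityˡ (D (ground (δ b) (ground (δ a) F)) ws [] [] * D (ground (δ b) (ground (δ a) F)) ws (b₁ ⊖ b₂ ∷ []) (a₁ ⊖ a₂ ∷ []))))) ⟩
        final ∎))
        where
        open ≈-Reasoning
        es : List (Edge N)
        es = (b , b₁) ∷ (b , b₂) ∷ M

    -- With a₁ = b the surviving test vector is b - a₂, so both test vectors involve b. Since the
    -- edge ab has already been used up at a, only one edge variable is left at b, and the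
    -- single-edge reduction forgets both a₂ and c.
    adjacent : ∀ {a₂ b₁ M} → a₂ ≢ a → a₂ ≢ b → b₁ ≢ b →
      Avoids a ((b , b₁) ∷ M) → Avoids b M →
      ∀ {c d} → c ≢ a → c ≢ b → d ≢ a → d ≢ b →
      let K = (a , b) ∷ (a , a₂) ∷ (b , b₁) ∷ M in
      ∑F K (indicator F a b c) ≈ ∑F K (indicator F a b d)
    adjacent {a₂} {b₁} {M} a₂≢a a₂≢b b₁≢b avoidᵃ avoidᵇ c≢a c≢b d≢a d≢b =
      ≈-trans (value c≢a c≢b) (≈-sym (value d≢a d≢b))
      where
      b≢a : b ≢ a
      b≢a e = a≢b (≡.sym e)
      open ReduceFirst F a≢b zcᵃ b≢a a₂≢a avoidᵃ
      value : ∀ {c} → c ≢ a → c ≢ b → ∑F ((a , b) ∷ (a , a₂) ∷ (b , b₁) ∷ M) (indicator F a b c) ≈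
        constantPart + ∑F M (λ ws → nonzero? (D (ground (δ b) (ground (δ a) F)) ws [] []) * - nonzero? (D (ground (δ b) (ground (δ a) F)) ws [] []))
      value {c} c≢a c≢b = ≈-trans (indicator-reduced c≢a)
        (+-cong (≈-refl {constantPart}) (AtVertex.one-edge-product (ground (δ a) F) zcᵇ′ avoidᵇ b₁≢b a₂≢b c≢b))

-- From zero counts to sums of indicators

∑pts-map : ∀ R {A B : Set} (φ : A → B) es g → ∑pts R (map φ es) g ≡ ∑pts R es (λ ws → g (map (mapFst φ) ws))
∑pts-map R φ []       g = ≡.refl
∑pts-map R φ (e ∷ es) g = ∑-cong R (λ a → ∑pts-map R φ es (λ ws → g ((φ e , a) ∷ ws)))

D-neg : ∀ {N} {F F′ : Form N} → (∀ X → ⟦ F′ ⟧ X ≡ - ⟦ F ⟧ X) → ∀ ws X Y → D F′ ws X Y ≡ D F ws X Y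
D-neg {F = F} eq []             X Y = ≡.trans (cong₂ _*_ (eq X) (eq Y)) (negs (⟦ F ⟧ X) (⟦ F ⟧ Y))
  where negs : ∀ x y → - x * - y ≡ x * y
        negs = solve-∀
D-neg {F = F} {F′} eq ((e , α) ∷ ws) X Y =
  cong₂ (λ u v → + α * u + v) (D-neg {F = F} {F′} eq ws X Y) (D-neg {F = F} {F′} eq ws _ _)

length-bfilter-++ : ∀ {A : Set} (P : A → Bool) xs ys →
                    length (bfilter P (xs ++ ys)) ≡ length (bfilter P xs) ℕ.+ length (bfilter P ys)
length-bfilter-++ P []       ys = ≡.refl
length-bfilter-++ P (x ∷ xs) ys with P x
... | true  = cong suc (length-bfilter-++ P xs ys)
... | false = length-bfilter-++ P xs ys

length-bfilter-map : ∀ {A B : Set} (P : B → Bool) (f : A → B) xs →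
                     length (bfilter P (map f xs)) ≡ length (bfilter (λ x → P (f x)) xs)
length-bfilter-map P f []       = ≡.refl
length-bfilter-map P f (x ∷ xs) with P (f x)
... | true  = cong suc (length-bfilter-map P f xs)
... | false = length-bfilter-map P f xs

bit : Bool → ℤ
bit b = if b then 1ℤ else 0ℤ

length-bfilter-points : ∀ p {A : Set} (es : List A) (P : List ℕ → Bool) →
  + length (bfilter P (points p (length es))) ≡ ∑pts (upTo p) es (λ ws → bit (P (map proj₂ ws)))
length-bfilter-points p [] P with P []
... | true  = ≡.refl
... | false = ≡.refl
length-bfilter-points p (e ∷ es) P = go (upTo p)
  where
  go : ∀ R → + length (bfilter P (concatMap (λ a → map (a ∷_) (points p (length es))) R)) ≡
       ∑ R (λ a → ∑pts (upTo p) es (λ ws → bit (P (a ∷ map proj₂ ws))))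
  go []      = ≡.refl
  go (a ∷ R) = ≡.trans
    (cong +_ (length-bfilter-++ P (map (a ∷_) (points p (length es))) _))
    (≡.trans (ℤₚ.pos-+ (length (bfilter P (map (a ∷_) (points p (length es))))) _)
    (cong₂ _+_ (≡.trans (cong +_ (length-bfilter-map P (a ∷_) (points p (length es)))) (length-bfilter-points p es (λ α → P (a ∷ α)))) (go R)))

natural-quotient : ∀ p .{{_ : NonZero p}} n m → + n ≡ + p * + p * m → + ((n / p) / p) ≡ m
natural-quotient p@(suc _) n (+ m) eq = cong +_ (≡.trans (cong (λ k → (k / p) / p) n≡)
    (≡.trans (cong (_/ p) (m*n/n≡m (m ℕ.* p) p)) (m*n/n≡m m p)))
  where
  n≡ : n ≡ m ℕ.* p ℕ.* p
  n≡ = ℤₚ.+-injective (≡.trans eq (≡.trans (rearrange (+ p) (+ m))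
         (≡.trans (cong (_* + p) (≡.sym (ℤₚ.pos-* m p))) (≡.sym (ℤₚ.pos-* (m ℕ.* p) p)))))
    where rearrange : ∀ p m → p * p * m ≡ m * p * p
          rearrange = solve-∀
-- A negative m would make the count p² m negative.
natural-quotient (suc _) n -[1+ m ] ()

zeroCount-unfold : ∀ p .{{_ : NonZero p}} {n} (H : Graph n) →
  zeroCount p H ≡ length (bfilter (λ α → (kirchhoff H α % p) ≡ᵇ 0) (points p (length (edges H))))
zeroCount-unfold (suc _) H = ≡.refl

c2-unfold : ∀ p .{{_ : NonZero p}} {n} (H : Graph n) → c2 p H ≡ ((zeroCount p H / p) / p) % p
c2-unfold (suc _) H = ≡.refl

module Invariant (p : ℕ) (prime : Prime p) where

  open Modular p prime
  open Counting p prime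
  open Reduction p prime

  bit-zero? : ∀ k {x} → + k ≡ x → bit (k % p ≡ᵇ 0) ≡ zero? x
  bit-zero? k ≡.refl = byCases (k % p) ≡.refl
    where
    byCases : ∀ m → k % p ≡ m → bit (m ≡ᵇ 0) ≡ zero? (+ k)
    byCases zero    eq = ≡.sym (zero?-yes (∣⇒≈0 (∣ᵤ⇒∣ (ℕ.m%n≡0⇒n∣m k p eq))))
    byCases (suc m) eq = ≡.sym (zero?-no (λ e → ℕₚ.1+n≢0 (≡.trans (≡.sym eq) (ℕ.n∣m⇒m%n≡0 k p (∣⇒∣ᵤ (≈0⇒∣ e))))))

  zeroCount-as-sum : ∀ {n} (H : Graph n) {B : Set} (φ : Fin n × Fin n → B) (Ψ : List (B × ℕ) → ℤ) →
    (∀ ws → map proj₁ ws ≡ edges H → + kirchhoff H (map proj₂ ws) ≡ Ψ (map (mapFst φ) ws)) →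
    + zeroCount p H ≡ ∑F (map φ (edges H)) (λ ws → zero? (Ψ ws))
  zeroCount-as-sum H φ Ψ eq = ≡.trans (cong +_ (zeroCount-unfold p H)) (≡.trans (length-bfilter-points p (edges H) (λ α → kirchhoff H α % p ≡ᵇ 0))
    (≡.trans (∑pts-cong residues (edges H) (λ ws q → bit-zero? (kirchhoff H (map proj₂ ws)) (eq ws q)))
             (≡.sym (∑pts-map residues φ (edges H) (λ ws → zero? (Ψ ws))))))

  private
    ≈⇒%≡ : ∀ m n → + m ≈ + n → m % p ≡ n % p
    ≈⇒%≡ m n e = [ (λ m≤n → ≡.sym (ordered m n m≤n (≈-sym e))) , (λ n≤m → ordered n m n≤m e) ]′ (ℕₚ.≤-total m n)
      where
      ordered : ∀ m n → m ℕ.≤ n → + n ≈ + m → n % p ≡ m % p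
      ordered m n m≤n e with ℕₚ.m≤n⇒∃[o]m+o≡n m≤n
      ... | o , ≡.refl with ∣⇒∣ᵤ (subst (+ p ∣_) (drop (+ m) (+ o)) (divisible e))
        where drop : ∀ x k → x + k - x ≡ k
              drop = solve-∀
      ... | ℕ.divides k ≡.refl = [m+kn]%n≡m%n m k p

  -- An exact expansion from which x / p² modulo p is read off as M. The remainder collects the
  -- points at which the star contributes p³ zeros.
  record Reduced (x M : ℤ) : Set where
    constructor reduced
    field
      remainder : ℤ
      expansion : x ≡ + p * + p * (M + + p * remainder)

  c2-from-sums : ∀ {n n′} (H : Graph n) (H′ : Graph n′) {M M′} →
    Reduced (+ zeroCount p H) M → Reduced (+ zeroCount p H′) M′ → M ≈ M′ → c2 p H ≡ c2 p H′
  c2-from-sums H H′ {M} {M′} (reduced Z eq) (reduced Z′ eq′) e =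
    ≡.trans (c2-unfold p H) (≡.trans (≈⇒%≡ ((zeroCount p H / p) / p) ((zeroCount p H′ / p) / p)
    (≈-trans (≈-reflexive (natural-quotient p (zeroCount p H) (M + + p * Z) eq))
    (≈-trans (≈-trans (drop M Z) (≈-trans e (≈-sym (drop M′ Z′))))
             (≈-sym (≈-reflexive (natural-quotient p (zeroCount p H′) (M′ + + p * Z′) eq′))))))
    (≡.sym (c2-unfold p H′)))
    where
    drop : ∀ M Z → M + + p * Z ≈ M
    drop M Z = ≈-trans (+-cong (≈-refl {M}) (multiple≈0 Z)) (≈-reflexive (ℤₚ.+-identityʳ M))

  module _ {N} (F : Form N) {w : Fin N} (zc : ZeroColumn F w) {a b c : Fin N} (a≢w : a ≢ w) (b≢w : b ≢ w) (c≢w : c ≢ w)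
           {K : List (Edge N)} (avoid : Avoids w K) where

    private
      F′ = ground (δ w) F
      allZero : List (Edge N × ℕ) → ℤ
      allZero ws = zero? (D F′ ws [] []) * zero? (D F′ ws (b ⊖ a ∷ []) (b ⊖ a ∷ [])) * zero? (D F′ ws (b ⊖ c ∷ []) (b ⊖ c ∷ []))
      remainder : List (Edge N × ℕ) → ℤ
      remainder ws = allZero ws * zero? (D F′ ws (b ⊖ a ∷ b ⊖ c ∷ []) (b ⊖ a ∷ b ⊖ c ∷ []))

    -- The three star variables are moved to the innermost sums, so that `star-count` applies at
    -- each fixed point of K with its values of f, r, s, t and h.
    star-sum : Reduced (∑F ((w , a) ∷ (w , b) ∷ (w , c) ∷ K) (λ ws → zero? (D F ws [] []))) (∑F K (indicator (ground (δ w) F) a b c))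
    star-sum = reduced (∑F K remainder) (begin
      ∑F ((w , a) ∷ (w , b) ∷ (w , c) ∷ K) (λ ws → zero? (D F ws [] []))
        ≡⟨ ∑-cong residues (λ x → ∑-cong residues (λ y → ∑pts-∑-comm residues residues K (λ z ws → g x y z ws))) ⟩
      ∑ residues (λ x → ∑ residues (λ y → ∑F K (λ ws → ∑ residues (λ z → g x y z ws))))
        ≡⟨ ∑-cong residues (λ x → ∑pts-∑-comm residues residues K (λ y ws → ∑ residues (λ z → g x y z ws))) ⟩
      ∑ residues (λ x → ∑F K (λ ws → ∑ residues (λ y → ∑ residues (λ z → g x y z ws))))
        ≡⟨ ∑pts-∑-comm residues residues K (λ x ws → ∑ residues (λ y → ∑ residues (λ z → g x y z ws))) ⟩
      ∑F K (λ ws → ∑ residues (λ x → ∑ residues (λ y → ∑ residues (λ z → g x y z ws))))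
        ≡⟨ ∑pts-cong residues K (λ ws eq → ≡.trans (pointwise ws eq) (distribute (+ p) (indicator F′ a b c ws) (remainder ws))) ⟩
      ∑F K (λ ws → + p * + p * indicator F′ a b c ws + + p * + p * + p * remainder ws)
        ≡⟨ ∑pts-linear residues K (+ p * + p) (+ p * + p * + p) (indicator F′ a b c) remainder ⟩
      + p * + p * ∑F K (indicator F′ a b c) + + p * + p * + p * ∑F K remainder
        ≡⟨ distribute (+ p) (∑F K (indicator F′ a b c)) (∑F K remainder) ⟨
      + p * + p * (∑F K (indicator F′ a b c) + + p * ∑F K remainder) ∎)
      where
      open ≡-Reasoning
      g : ℕ → ℕ → ℕ → List (Edge N × ℕ) → ℤ
      g x y z ws = zero? (D F (((w , a) , x) ∷ ((w , b) , y) ∷ ((w , c) , z) ∷ ws) [] [])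
      distribute : ∀ p u v → p * p * (u + p * v) ≡ p * p * u + p * p * p * v
      distribute = solve-∀
      pointwise : ∀ ws → map proj₁ ws ≡ K → ∑ residues (λ x → ∑ residues (λ y → ∑ residues (λ z → g x y z ws))) ≡
                  + p * + p * (indicator F′ a b c ws + + p * remainder ws)
      pointwise ws eq = ≡.trans
        (∑-cong residues (λ x → ∑-cong residues (λ y → ∑-cong residues (λ z → cong zero? (star a≢w b≢w c≢w x y z)))))
        (Star.star-count (D F′ ws [] []) (D F′ ws (b ⊖ a ∷ []) (b ⊖ a ∷ [])) (D F′ ws (b ⊖ a ∷ []) (b ⊖ c ∷ []))
           (D F′ ws (b ⊖ c ∷ []) (b ⊖ c ∷ [])) (D F′ ws (b ⊖ a ∷ b ⊖ c ∷ []) (b ⊖ a ∷ b ⊖ c ∷ [])) (D-jacobi F′ ws (b ⊖ a) (b ⊖ c)))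
        where open Eliminate F zc (avoids-weighted avoid eq)

-- Spanning trees as determinants

same-members⇒↭ : ∀ {A : Set} {xs ys : List A} → Unique xs → Unique ys →
                 (∀ {x} → x ∈ xs → x ∈ ys) → (∀ {x} → x ∈ ys → x ∈ xs) → xs ↭ ys
same-members⇒↭ u u′ to from = ∼bag⇒↭ (unique∧set⇒bag u u′ (mk⇔ to from))

Unique-resp-↭ : ∀ {A : Set} {xs ys : List A} → xs ↭ ys → Unique xs → Unique ys
Unique-resp-↭ ↭.refl         u = u
Unique-resp-↭ (↭.prep x p)   (x∉ ∷ u) = ↭.All-resp-↭ p x∉ ∷ Unique-resp-↭ p u
Unique-resp-↭ (↭.swap x y p) ((x≢y ∷ x∉) ∷ y∉ ∷ u) =
  ((λ y≡x → x≢y (≡.sym y≡x)) ∷ ↭.All-resp-↭ p y∉) ∷ ↭.All-resp-↭ p x∉ ∷ Unique-resp-↭ p u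
Unique-resp-↭ (↭.trans p q)  u = Unique-resp-↭ q (Unique-resp-↭ p u)

extract : ∀ {A : Set} {x : A} {xs} → x ∈ xs → ∃ λ ys → xs ↭ x ∷ ys
extract {x = x} x∈xs with ∈-∃++ x∈xs
... | ys , zs , ≡.refl = ys ++ zs , ↭.shift x ys zs

square : ∀ {N} → Form N → List (Vector N) → ℤ
square F X = ⟦ F ⟧ X * ⟦ F ⟧ X

square-neg : ∀ {N} (F : Form N) {X Y} → ⟦ F ⟧ X ≡ - ⟦ F ⟧ Y → square F X ≡ square F Y
square-neg F {X} {Y} eq = ≡.trans (cong₂ _*_ eq eq) (negs (⟦ F ⟧ Y))
  where negs : ∀ y → - y * - y ≡ y * y
        negs = solve-∀

square-perm : ∀ {N} (F : Form N) {X Y} → X ↭ Y → square F X ≡ square F Y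
square-perm F ↭.refl = ≡.refl
square-perm F (↭.prep x p) = square-perm (ground x F) p
square-perm F {_ ∷ _ ∷ X} {_ ∷ _ ∷ Y} (↭.swap x y p) =
  ≡.trans (square-neg F {x ∷ y ∷ X} {y ∷ x ∷ X} (swap-at (alternating F) [] x y X)) (square-perm (ground x (ground y F)) p)
square-perm F (↭.trans p q) = ≡.trans (square-perm F p) (square-perm F q)

-- Beside the column `δ s` the vector s - t may be replaced by -δ t, and squaring removes the sign.
square-edge : ∀ {N} (F : Form N) s t Q → square F (s ⊖ t ∷ δ s ∷ Q) ≡ square F (δ t ∷ δ s ∷ Q)
square-edge F s t Q = square-neg F {s ⊖ t ∷ δ s ∷ Q} {δ t ∷ δ s ∷ Q}
  (≡.trans (linear (alternating F) [] {δ s} {δ t} (δ s ∷ Q) 1ℤ (- 1ℤ) (λ i → minus (δ s i) (δ t i)))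
  (≡.trans (cong (λ u → 1ℤ * u + (- 1ℤ) * ⟦ F ⟧ (δ t ∷ δ s ∷ Q)) (repeat-zero (alternating F) [] (δ s) Q))
           (tidy (⟦ F ⟧ (δ t ∷ δ s ∷ Q)))))
  where
  minus : ∀ a b → a - b ≡ 1ℤ * a + (- 1ℤ) * b
  minus = solve-∀
  tidy : ∀ a → 1ℤ * 0ℤ + (- 1ℤ) * a ≡ - a
  tidy = solve-∀

square-edge′ : ∀ {N} (F : Form N) s t Q → square F (t ⊖ s ∷ δ s ∷ Q) ≡ square F (δ t ∷ δ s ∷ Q)
square-edge′ F s t Q = cong (λ u → u * u)
  (≡.trans (linear (alternating F) [] {δ t} {δ s} (δ s ∷ Q) 1ℤ (- 1ℤ) (λ i → minus (δ t i) (δ s i)))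
  (≡.trans (cong (λ u → 1ℤ * ⟦ F ⟧ (δ t ∷ δ s ∷ Q) + (- 1ℤ) * u) (repeat-zero (alternating F) [] (δ s) Q))
           (tidy (⟦ F ⟧ (δ t ∷ δ s ∷ Q)))))
  where
  minus : ∀ a b → a - b ≡ 1ℤ * a + (- 1ℤ) * b
  minus = solve-∀
  tidy : ∀ a → 1ℤ * a + (- 1ℤ) * 0ℤ ≡ a
  tidy = solve-∀

weigh : ∀ {N} → (Fin N → ℤ) → Vector N → ℤ
weigh {N} c x = ∑ (allFin N) (λ i → c i * x i)

weigh-Linear : ∀ {N} (c : Fin N → ℤ) → Linear (weigh c)
weigh-Linear {N} c = go (allFin N)
  where
  one : ∀ a b → a + b ≡ a + 1ℤ * b
  one = solve-∀
  go : ∀ is → Linear (λ x → ∑ is (λ i → c i * x i))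
  go []       = null (λ _ → ≡.refl)
  go (i ∷ is) = comb (c i) 1ℤ (coord i) (go is) (λ x → one (c i * x i) (∑ is (λ i → c i * x i)))

weigh-δ : ∀ {N} (c : Fin N → ℤ) j → weigh c (δ j) ≡ c j
weigh-δ {N} c j = ≡.trans
  (∑-single (Unique.allFin⁺ N) (∈-allFin j) (λ i → c i * δ j i)
     (λ {i} _ i≢j → ≡.trans (cong (c i *_) (δ-distinct (λ j≡i → i≢j (≡.sym j≡i)))) (ℤₚ.*-zeroʳ (c i))))
  (≡.trans (cong (c j *_) (δ-same j)) (ℤₚ.*-identityʳ (c j)))

weigh-⊖ : ∀ {N} (c : Fin N → ℤ) s t → weigh c (s ⊖ t) ≡ c s - c t
weigh-⊖ {N} c s t = ≡.trans (go (allFin N)) (cong₂ _-_ (weigh-δ c s) (weigh-δ c t))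
  where
  identity : ∀ c a b x y → c * (a - b) + (x - y) ≡ (c * a + x) - (c * b + y)
  identity = solve-∀
  go : ∀ is → ∑ is (λ i → c i * (s ⊖ t) i) ≡ ∑ is (λ i → c i * δ s i) - ∑ is (λ i → c i * δ t i)
  go []       = ≡.refl
  go (i ∷ is) = ≡.trans (cong (_+_ (c i * (s ⊖ t) i)) (go is)) (identity (c i) (δ s i) (δ t i) _ _)

anyB-intro : ∀ {A : Set} (f : A → Bool) {x xs} → x ∈ xs → f x ≡ true → anyB f xs ≡ true
anyB-intro f (here ≡.refl) eq rewrite eq = ≡.refl
anyB-intro f {xs = y ∷ ys} (there x∈) eq with f y
... | true  = ≡.refl
... | false = anyB-intro f x∈ eq

anyB-elim : ∀ {A : Set} (f : A → Bool) xs → anyB f xs ≡ true → ∃ λ x → x ∈ xs × f x ≡ true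
anyB-elim f (x ∷ xs) eq with f x in fx
... | true  = x , here ≡.refl , fx
... | false with anyB-elim f xs eq
...   | y , y∈ , fy = y , there y∈ , fy

allB-intro : ∀ {A : Set} (f : A → Bool) xs → (∀ x → f x ≡ true) → allB f xs ≡ true
allB-intro f []       all = ≡.refl
allB-intro f (x ∷ xs) all rewrite all x = allB-intro f xs all

allB-elim : ∀ {A : Set} (f : A → Bool) {x xs} → allB f xs ≡ true → x ∈ xs → f x ≡ true
allB-elim f {xs = y ∷ ys} eq x∈ with f y in fy
allB-elim f eq (here ≡.refl) | true = fy
allB-elim f eq (there x∈)    | true = allB-elim f eq x∈

∨-elim : ∀ a b → a ∨ b ≡ true → a ≡ true ⊎ b ≡ true
∨-elim true  b _  = inj₁ ≡.refl
∨-elim false b eq = inj₂ eq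

∧-elim : ∀ a b → a ∧ b ≡ true → a ≡ true × b ≡ true
∧-elim true true _ = ≡.refl , ≡.refl

∨-introʳ : ∀ a {b} → b ≡ true → a ∨ b ≡ true
∨-introʳ true  _  = ≡.refl
∨-introʳ false eq = eq

==-elim : ∀ {n} {i j : Fin n} → (i == j) ≡ true → i ≡ j
==-elim {i = i} {j} eq with i ≟ j
... | yes i≡j = i≡j

==-refl : ∀ {n} (i : Fin n) → (i == i) ≡ true
==-refl i with i ≟ i
... | yes _ = ≡.refl
... | no ne = ⊥-elim (ne ≡.refl)

module _ {n} (T : List (Edge n)) {S : Fin n → Bool} where

  iter-suc : ∀ k {x} → iter k T S x ≡ true → iter (suc k) T S x ≡ true
  iter-suc k eq rewrite eq = ≡.refl

  iter-≤ : ∀ {k l} → k ℕ.≤ l → ∀ {x} → iter k T S x ≡ true → iter l T S x ≡ true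
  iter-≤ k≤l eq with ℕₚ.m≤n⇒∃[o]m+o≡n k≤l
  iter-≤ {k} k≤l {x} eq | o , ≡.refl = go o
    where
    go : ∀ o → iter (k ℕ.+ o) T S x ≡ true
    go zero    = subst (λ l → iter l T S x ≡ true) (≡.sym (ℕₚ.+-identityʳ k)) eq
    go (suc o) = subst (λ l → iter l T S x ≡ true) (≡.sym (ℕₚ.+-suc k o)) (iter-suc (k ℕ.+ o) (go o))

  iter-edge : ∀ k {s t} → (s , t) ∈ T → iter k T S s ≡ true → iter (suc k) T S t ≡ true
  iter-edge k {s} {t} e∈ eq = ∨-introʳ (iter k T S t) (anyB-intro _ e∈ holds)
    where
    holds : (iter k T S s ∧ (t == t)) ∨ (iter k T S t ∧ (s == t)) ≡ true
    holds rewrite eq | ==-refl t = ≡.refl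

  iter-edge′ : ∀ k {s t} → (s , t) ∈ T → iter k T S t ≡ true → iter (suc k) T S s ≡ true
  iter-edge′ k {s} {t} e∈ eq = ∨-introʳ (iter k T S s) (anyB-intro _ e∈ holds)
    where
    holds : (iter k T S s ∧ (t == s)) ∨ (iter k T S t ∧ (s == s)) ≡ true
    holds rewrite eq | ==-refl s = ∨-introʳ _ ≡.refl

  iter-closed : ∀ {P : Fin n → Set} → (∀ {x} → S x ≡ true → P x) →
                (∀ {s t} → (s , t) ∈ T → (P s → P t) × (P t → P s)) → ∀ k {x} → iter k T S x ≡ true → P x
  iter-closed start closed zero    eq = start eq
  iter-closed start closed (suc k) {x} eq with ∨-elim (iter k T S x) _ eq
  ... | inj₁ old = iter-closed start closed k old
  ... | inj₂ new with anyB-elim _ T new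
  ... | (s , t) , e∈ , h with ∨-elim (iter k T S s ∧ (t == x)) _ h
  ... | inj₁ h′ with ∧-elim (iter k T S s) _ h′
  ...   | is , t≡x with ==-elim t≡x
  ...   | ≡.refl = proj₁ (closed e∈) (iter-closed start closed k is)
  iter-closed start closed (suc k) {x} eq | inj₂ new | (s , t) , e∈ , h | inj₂ h′ with ∧-elim (iter k T S t) _ h′
  ...   | it , s≡x with ==-elim s≡x
  ...   | ≡.refl = proj₂ (closed e∈) (iter-closed start closed k it)

bit-false : ∀ {b} → b ≢ true → bit b ≡ 0ℤ
bit-false {true}  ne = ⊥-elim (ne ≡.refl)
bit-false {false} ne = ≡.refl

bit-yes : ∀ {P : Set} (d : Dec P) → P → bit (does d) ≡ 1ℤ
bit-yes (yes _) _ = ≡.refl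
bit-yes (no ¬p) p = ⊥-elim (¬p p)

bit-no : ∀ {P : Set} (d : Dec P) → ¬ P → bit (does d) ≡ 0ℤ
bit-no (yes p) ¬p = ⊥-elim (¬p p)
bit-no (no _)  _  = ≡.refl

kirchhoff-masks : ∀ {n} (H : Graph n) (ws : List (Edge n × ℕ)) → map proj₁ ws ≡ edges H →
  kirchhoff H (map proj₂ ws) ≡
  sumL (map (λ k → if isSpanningTree (select k (map proj₁ ws)) then productL (select (complement k) (map proj₂ ws)) else 0)
            (masks (length (map proj₁ ws))))
kirchhoff-masks H ws eq = cong (λ es →
  sumL (map (λ k → if isSpanningTree (select k es) then productL (select (complement k) (map proj₂ ws)) else 0)
            (masks (length es)))) (≡.sym eq)

embedEdge : ∀ {n} → Fin (suc n) → Edge n → Edge (suc n)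
embedEdge v (s , t) = punchIn v s , punchIn v t

module TreeDeterminant {m : ℕ} (v : Fin (suc (suc m))) where

  open DecMembership (_≟_ {n = suc m}) using (_∈?_)

  emb : Fin (suc m) → Fin (suc (suc m))
  emb = punchIn v

  private
    start : Fin (suc m) → Bool
    start x = x == Fin.zero

    F : Form (suc (suc m))
    F = ground (δ v) detForm

    vertices : List (Fin (suc m)) → List (Vector (suc (suc m)))
    vertices = map (λ i → δ (emb i))

    arcs : List (Edge (suc m)) → List (Vector (suc (suc m)))
    arcs = map (λ e → vec (embedEdge v e))

    all-vertices : v ∷ map emb (allFin (suc m)) ↭ allFin (suc (suc m))
    all-vertices = same-members⇒↭
      (All.map⁺ (All.universal (λ i e → punchInᵢ≢i v i (≡.sym e)) (allFin (suc m))) ∷ Unique.map⁺ (punchIn-injective v _ _) (Unique.allFin⁺ (suc m)))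
      (Unique.allFin⁺ (suc (suc m))) (λ _ → ∈-allFin _) (λ {x} _ → from x)
      where
      from : ∀ x → x ∈ v ∷ map emb (allFin (suc m))
      from x with v ≟ x
      ... | yes ≡.refl = here ≡.refl
      ... | no  v≢x    = there (subst (_∈ map emb (allFin (suc m))) (punchIn-punchOut v≢x) (∈-map⁺ emb (∈-allFin (punchOut v≢x))))

    square-all : ∀ {V} → V ↭ allFin (suc m) → square F (vertices V) ≡ 1ℤ
    square-all {V} V↭ = ≡.trans (square-perm detForm perm) (cong₂ _*_ basis basis)
      where
      basis : det (map δ (allFin (suc (suc m)))) ≡ 1ℤ
      basis = det-basis
      perm : δ v ∷ vertices V ↭ map δ (allFin (suc (suc m)))
      perm = ↭-trans (↭-reflexive (cong (δ v ∷_) (List.map-∘ V)))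
             (↭.map⁺ δ (↭-trans (↭.prep v (↭.map⁺ emb V↭)) all-vertices))

    -- V is the part of the graph explored from the root, U its complement and R the edges not used yet.
    -- Trading an edge of R between V and U for its endpoint in U preserves the squared determinant.
    record State (T : List (Edge (suc m))) (V U : List (Fin (suc m))) (R : List (Edge (suc m))) : Set where
      field
        partition : V ++ U ↭ allFin (suc m)
        unused⊆T  : ∀ {e} → e ∈ R → e ∈ T
        used      : ∀ {s t} → (s , t) ∈ T → (s , t) ∈ R ⊎ (s ∈ V × t ∈ V)
        root∈V    : Fin.zero ∈ V
        steps     : ℕ
        reached   : ∀ {x} → x ∈ V → iter steps T start x ≡ true
        -- Each explored vertex costs one iteration and shrinks U by one, so the suc m iterations
        -- performed by `connectedE` suffice.
        budget    : steps ℕ.+ length U ℕ.≤ (suc m)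
        sizes     : length R ≡ length U
    open State

    -- Both sides are 0. No edge of T leaves V, so u is never reached from the root. On the other
    -- side the indicator functional of the unexplored vertices kills `δ v`, the explored vertices
    -- and every remaining edge vector, and takes the value 1 at u.
    disconnected : ∀ {T V u U R} → State T V (u ∷ U) R →
      (∀ {s t} → (s , t) ∈ T → (s ∈ V × t ∈ V) ⊎ (s ∈ u ∷ U × t ∈ u ∷ U)) →
      square F (vertices V ++ arcs R) ≡ bit (connectedE T)
    disconnected {T} {V} {u} {U} {R} σ separated = ≡.trans (cong (λ d → d * d) vanish) (≡.sym (bit-false notConnected))
      where
      disjoint : ∀ {x} → x ∈ V → x ∈ u ∷ U → ⊥
      disjoint = go V (Unique-resp-↭ (↭-sym (partition σ)) (Unique.allFin⁺ (suc m)))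
        where
        go : ∀ V → Unique (V ++ u ∷ U) → ∀ {x} → x ∈ V → x ∈ u ∷ U → ⊥
        go (y ∷ V) (y∉ ∷ _) (here ≡.refl) x∈U = All.lookup y∉ (∈-++⁺ʳ V x∈U) ≡.refl
        go (y ∷ V) (_ ∷ uq) (there x∈V)   x∈U = go V uq x∈V x∈U
      notConnected : connectedE T ≢ true
      notConnected c = disjoint (iter-closed T {P = _∈ V} (λ eq → subst (_∈ V) (≡.sym (==-elim eq)) (root∈V σ)) closed (suc m)
                                   (allB-elim _ c (∈-allFin u))) (here ≡.refl)
        where
        closed : ∀ {s t} → (s , t) ∈ T → (s ∈ V → t ∈ V) × (t ∈ V → s ∈ V)
        closed e∈ with separated e∈
        ... | inj₁ (s∈ , t∈) = (λ _ → t∈) , (λ _ → s∈)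
        ... | inj₂ (s∈ , t∈) = (λ s∈V → ⊥-elim (disjoint s∈V s∈)) , (λ t∈V → ⊥-elim (disjoint t∈V t∈))
      open DecMembership (_≟_ {n = suc (suc m)}) using () renaming (_∈?_ to _∈?′_)
      c : Fin (suc (suc m)) → ℤ
      c i = bit (does (i ∈?′ map emb (u ∷ U)))
      c-in : ∀ {x} → x ∈ u ∷ U → c (emb x) ≡ 1ℤ
      c-in {x} x∈ = bit-yes (emb x ∈?′ map emb (u ∷ U)) (∈-map⁺ emb x∈)
      c-out : ∀ {i} → i ∉ map emb (u ∷ U) → c i ≡ 0ℤ
      c-out {i} i∉ = bit-no (i ∈?′ map emb (u ∷ U)) i∉
      v∉ : v ∉ map emb (u ∷ U)
      v∉ v∈ with ∈-map⁻ emb v∈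
      ... | j , _ , eq = punchInᵢ≢i v j (≡.sym eq)
      V∉ : ∀ {x} → x ∈ V → emb x ∉ map emb (u ∷ U)
      V∉ x∈V x∈ with ∈-map⁻ emb x∈
      ... | j , j∈ , eq with punchIn-injective v _ _ eq
      ... | ≡.refl = disjoint x∈V j∈
      arc : ∀ {e} → e ∈ R → weigh c (vec (embedEdge v e)) ≡ 0ℤ
      arc {s , t} e∈ = ≡.trans (weigh-⊖ c (emb s) (emb t)) (balance (separated (unused⊆T σ e∈)))
        where
        balance : (s ∈ V × t ∈ V) ⊎ (s ∈ u ∷ U × t ∈ u ∷ U) → c (emb s) - c (emb t) ≡ 0ℤ
        balance (inj₁ (s∈ , t∈)) = cong₂ _-_ (c-out (V∉ s∈)) (c-out (V∉ t∈))
        balance (inj₂ (s∈ , t∈)) = cong₂ _-_ (c-in s∈) (c-in t∈)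
      vanish : det (δ v ∷ vertices V ++ arcs R) ≡ 0ℤ
      vanish = det-functional-zero (weigh-Linear c) (δ (emb u)) (≡.trans (weigh-δ c (emb u)) (c-in (here ≡.refl)))
        (≡.trans (weigh-δ c v) (c-out v∉) ∷
         All.++⁺ (All.map⁺ (All.tabulate (λ {x} x∈ → ≡.trans (weigh-δ c (emb x)) (c-out (V∉ x∈)))))
                 (All.map⁺ (All.tabulate arc)))

    -- As `δ s` is already among the columns, the vector of e can be exchanged for `δ t`, in either
    -- orientation of e.
    grow : ∀ {T V U R e s t} → State T V U R → e ∈ R → s ∈ V → t ∈ U → (e ≡ (s , t) ⊎ e ≡ (t , s)) →
      ∃ λ U′ → ∃ λ R′ → length U ≡ suc (length U′) × State T (t ∷ V) U′ R′ ×
        square F (vertices V ++ arcs R) ≡ square F (vertices (t ∷ V) ++ arcs R′)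
    grow {T} {V} {U} {R} {e} {s} {t} σ e∈R s∈V t∈U orient with extract e∈R | extract s∈V | extract t∈U
    ... | R′ , R↭ | V′ , V↭ | U′ , U↭ = U′ , R′ , ↭.↭-length U↭ , state , squares
      where
      e∈T : e ∈ T
      e∈T = unused⊆T σ e∈R
      ends : (e ≡ (s , t) ⊎ e ≡ (t , s)) → proj₁ e ∈ t ∷ V × proj₂ e ∈ t ∷ V
      ends (inj₁ ≡.refl) = there s∈V , here ≡.refl
      ends (inj₂ ≡.refl) = here ≡.refl , there s∈V
      t-reached : (e ≡ (s , t) ⊎ e ≡ (t , s)) → iter (suc (steps σ)) T start t ≡ true
      t-reached (inj₁ ≡.refl) = iter-edge T (steps σ) e∈T (reached σ s∈V)
      t-reached (inj₂ ≡.refl) = iter-edge′ T (steps σ) e∈T (reached σ s∈V)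
      still : ∀ {x y} → (x , y) ∈ R ⊎ (x ∈ V × y ∈ V) → (x , y) ∈ R′ ⊎ (x ∈ t ∷ V × y ∈ t ∷ V)
      still (inj₂ (x∈ , y∈)) = inj₂ (there x∈ , there y∈)
      still (inj₁ r∈) with ↭.∈-resp-↭ R↭ r∈
      ... | here ≡.refl = inj₂ (ends orient)
      ... | there r∈    = inj₁ r∈
      state : State T (t ∷ V) U′ R′
      state = record
        { partition = ↭-trans (↭-sym (↭.shift t V U′)) (↭-trans (↭.++⁺ˡ V (↭-sym U↭)) (partition σ))
        ; unused⊆T  = λ r∈ → unused⊆T σ (↭.∈-resp-↭ (↭-sym R↭) (there r∈))
        ; used      = λ r∈ → still (used σ r∈)
        ; root∈V    = there (root∈V σ)
        ; steps     = suc (steps σ)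
        ; reached   = λ { (here ≡.refl) → t-reached orient ; (there x∈) → iter-suc T (steps σ) (reached σ x∈) }
        ; budget    = subst (ℕ._≤ (suc m)) (≡.trans (cong (steps σ ℕ.+_) (↭.↭-length U↭)) (ℕₚ.+-suc (steps σ) (length U′))) (budget σ)
        ; sizes     = ℕₚ.suc-injective (≡.trans (≡.sym (↭.↭-length R↭)) (≡.trans (sizes σ) (↭.↭-length U↭))) }
      Q = vertices V′ ++ arcs R′
      perm₁ : vertices V ++ arcs R ↭ vec (embedEdge v e) ∷ δ (emb s) ∷ Q
      perm₁ = ↭-trans (↭.++⁺ (↭.map⁺ _ V↭) (↭.map⁺ _ R↭)) (↭.shift (vec (embedEdge v e)) (vertices (s ∷ V′)) (arcs R′))
      perm₂ : δ (emb t) ∷ δ (emb s) ∷ Q ↭ vertices (t ∷ V) ++ arcs R′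
      perm₂ = ↭.prep (δ (emb t)) (↭.++⁺ʳ (arcs R′) (↭.map⁺ _ (↭-sym V↭)))
      exchange : (e ≡ (s , t) ⊎ e ≡ (t , s)) → square F (vec (embedEdge v e) ∷ δ (emb s) ∷ Q) ≡ square F (δ (emb t) ∷ δ (emb s) ∷ Q)
      exchange (inj₁ ≡.refl) = square-edge F (emb s) (emb t) Q
      exchange (inj₂ ≡.refl) = square-edge′ F (emb s) (emb t) Q
      squares : square F (vertices V ++ arcs R) ≡ square F (vertices (t ∷ V) ++ arcs R′)
      squares = ≡.trans (square-perm F perm₁) (≡.trans (exchange orient) (square-perm F perm₂))

    -- Induction on the number of unexplored vertices. An edge of R between V and U lets V grow; if
    -- there is none, no edge of T crosses either, since the edges already used lie inside V. When U
    -- is exhausted so is R, because their sizes agree, and the columns form a permuted basis.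
    explore : ∀ k {T V U R} → length U ≡ k → State T V U R → square F (vertices V ++ arcs R) ≡ bit (connectedE T)
    explore zero {T} {V} {[]} {[]} _ σ = ≡.trans
      (cong (square F) (List.++-identityʳ (vertices V)))
      (≡.trans (square-all V↭) (cong bit (≡.sym (allB-intro _ (allFin (suc m)) (λ x →
        iter-≤ T {S = start} (subst (ℕ._≤ (suc m)) (ℕₚ.+-identityʳ (steps σ)) (budget σ)) {x} (reached σ (↭.∈-resp-↭ (↭-sym V↭) (∈-allFin x))))))))
      where
      V↭ : V ↭ allFin (suc m)
      V↭ = subst (_↭ allFin (suc m)) (List.++-identityʳ V) (partition σ)
    explore zero {T} {V} {[]} {_ ∷ _} _ σ with () ← sizes σ
    explore (suc k) {T} {V} {u ∷ U} {R} len σ with any? crossing? R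
      where
      Crossing : Edge (suc m) → Set
      Crossing (s , t) = (s ∈ V × t ∈ u ∷ U) ⊎ (s ∈ u ∷ U × t ∈ V)
      crossing? : ∀ e → Dec (Crossing e)
      crossing? (s , t) = ((s ∈? V) ×-dec (t ∈? (u ∷ U))) ⊎-dec ((s ∈? (u ∷ U)) ×-dec (t ∈? V))
    ... | yes found = let e , e∈ , crosses = find found in continue e crosses e∈
      where
      continue : ∀ e → (proj₁ e ∈ V × proj₂ e ∈ u ∷ U) ⊎ (proj₁ e ∈ u ∷ U × proj₂ e ∈ V) → e ∈ R →
                 square F (vertices V ++ arcs R) ≡ bit (connectedE T)
      continue (s , t) (inj₁ (s∈ , t∈)) e∈ =
        let _ , _ , len′ , σ′ , eq = grow σ e∈ s∈ t∈ (inj₁ ≡.refl)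
        in ≡.trans eq (explore k (ℕₚ.suc-injective (≡.trans (≡.sym len′) len)) σ′)
      continue (s , t) (inj₂ (s∈ , t∈)) e∈ =
        let _ , _ , len′ , σ′ , eq = grow σ e∈ t∈ s∈ (inj₂ ≡.refl)
        in ≡.trans eq (explore k (ℕₚ.suc-injective (≡.trans (≡.sym len′) len)) σ′)
    ... | no stuck = disconnected σ separated
      where
      side : ∀ x → x ∈ V ⊎ x ∈ u ∷ U
      side x = ∈-++⁻ V (↭.∈-resp-↭ (↭-sym (partition σ)) (∈-allFin x))
      separated : ∀ {s t} → (s , t) ∈ T → (s ∈ V × t ∈ V) ⊎ (s ∈ u ∷ U × t ∈ u ∷ U)
      separated {s} {t} e∈ with used σ e∈
      ... | inj₂ both = inj₁ both
      ... | inj₁ e∈R with side s | side t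
      ... | inj₁ s∈ | inj₁ t∈ = inj₁ (s∈ , t∈)
      ... | inj₂ s∈ | inj₂ t∈ = inj₂ (s∈ , t∈)
      ... | inj₁ s∈ | inj₂ t∈ = ⊥-elim (stuck (lose e∈R (inj₁ (s∈ , t∈))))
      ... | inj₂ s∈ | inj₁ t∈ = ⊥-elim (stuck (lose e∈R (inj₂ (s∈ , t∈))))

    initial : ∀ T → length T ≡ m → State T (Fin.zero ∷ []) (tabulate Fin.suc) T
    initial T len = record
      { partition = ↭-refl
      ; unused⊆T  = λ e∈ → e∈
      ; used      = inj₁
      ; root∈V    = here ≡.refl
      ; steps     = 0
      ; reached   = λ { (here ≡.refl) → ≡.refl }
      ; budget    = ℕₚ.≤-trans (ℕₚ.≤-reflexive (List.length-tabulate Fin.suc)) (ℕₚ.n≤1+n m)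
      ; sizes     = ≡.trans len (≡.sym (List.length-tabulate Fin.suc)) }

  tree-determinant₀ : ∀ T → square F (δ (emb Fin.zero) ∷ arcs T) ≡ bit (isSpanningTree T)
  tree-determinant₀ T with length T ℕ.≟ m
  ... | yes len = ≡.trans (explore m (List.length-tabulate Fin.suc) (initial T len)) (cong bit (≡.sym (tree len)))
    where
    tree : length T ≡ m → isSpanningTree T ≡ connectedE T
    tree len = ≡.trans (cong (connectedE T ∧_) (subst (λ k → (length T ≡ᵇ k) ≡ true) len (≡ᵇ-refl (length T))))
                       (Bool.∧-identityʳ (connectedE T))
      where ≡ᵇ-refl : ∀ k → (k ≡ᵇ k) ≡ true
            ≡ᵇ-refl zero    = ≡.refl
            ≡ᵇ-refl (suc k) = ≡ᵇ-refl k
  -- A set with the wrong number of edges is not a tree, and its array is not square.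
  ... | no ne = ≡.trans (cong (λ d → d * d) (det-length _ wrong)) (≡.sym (bit-false notTree))
    where
    wrong : suc (suc (length (arcs T))) ≢ suc (suc m)
    wrong e = ne (≡.trans (≡.sym (List.length-map _ T)) (ℕₚ.suc-injective (ℕₚ.suc-injective e)))
    notTree : isSpanningTree T ≢ true
    notTree e = ne (ℕₚ.≡ᵇ⇒≡ (length T) m (subst Bool.T (≡.sym (proj₂ (∧-elim (connectedE T) _ e))) _))

  -- The sum of the coordinates other than v kills every edge vector, so the root may be moved.
  change-root : ∀ r r′ T → det (δ v ∷ δ (emb r) ∷ arcs T) ≡ det (δ v ∷ δ (emb r′) ∷ arcs T)
  change-root r r′ T = begin
    det (δ v ∷ δ (emb r) ∷ arcs T)                ≡⟨ swap-at (alternating detForm) [] (δ v) (δ (emb r)) (arcs T) ⟩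
    - det (δ (emb r) ∷ δ v ∷ arcs T)              ≡⟨ cong -_ rotate ⟩
    - det (δ (emb r′) ∷ δ v ∷ arcs T)             ≡⟨ swap-at (alternating detForm) [] (δ v) (δ (emb r′)) (arcs T) ⟨
    det (δ v ∷ δ (emb r′) ∷ arcs T)               ∎
    where
    open ≡-Reasoning
    c : Fin (suc (suc m)) → ℤ
    c i = bit (not (v == i))
    c-v : c v ≡ 0ℤ
    c-v = cong (λ b → bit (not b)) (==-refl v)
    c-emb : ∀ i → c (emb i) ≡ 1ℤ
    c-emb i with v ≟ emb i
    ... | yes e = ⊥-elim (punchInᵢ≢i v i (≡.sym e))
    ... | no _  = ≡.refl
    rest : All (λ x → weigh c x ≡ 0ℤ) (δ v ∷ arcs T)
    rest = ≡.trans (weigh-δ c v) c-v ∷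
      All.map⁺ (All.universal (λ (s , t) → ≡.trans (weigh-⊖ c (emb s) (emb t)) (cong₂ _-_ (c-emb s) (c-emb t))) T)
    identity : ∀ x y → 1ℤ * x - (1ℤ * y - 0ℤ) ≡ 0ℤ → y ≡ x
    identity x y eq = ≡.trans (≡.sym (ℤₚ.+-identityʳ y)) (≡.trans (cong (_+_ y) (≡.sym eq)) (cancel x y))
      where cancel : ∀ x y → y + (1ℤ * x - (1ℤ * y - 0ℤ)) ≡ x
            cancel = solve-∀
    rotate : det (δ (emb r) ∷ δ v ∷ arcs T) ≡ det (δ (emb r′) ∷ δ v ∷ arcs T)
    rotate = identity _ _ (begin
      1ℤ * det (δ (emb r′) ∷ δ v ∷ arcs T) - (1ℤ * det (δ (emb r) ∷ δ v ∷ arcs T) - 0ℤ)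
        ≡⟨ substitute (≡.trans (weigh-δ c (emb r)) (c-emb r)) (≡.trans (weigh-δ c (emb r′)) (c-emb r′))
             (ext-zero-on {f = λ Y → det (δ (emb r) ∷ δ (emb r′) ∷ Y)} rest) ⟨
      ext (weigh c) det (δ (emb r) ∷ δ (emb r′) ∷ δ v ∷ arcs T)
        ≡⟨ ext-det (weigh-Linear c) _ ⟩
      0ℤ ∎)
      where
      substitute : ∀ {p q z p′ q′ z′ x y} → p ≡ p′ → q ≡ q′ → z ≡ z′ → p * x - (q * y - z) ≡ p′ * x - (q′ * y - z′)
      substitute ≡.refl ≡.refl ≡.refl = ≡.refl

  -- `D` pushes each chosen edge vector in front of the earlier ones, so a tree arrives in reversed
  -- order.
  stack : List (Edge (suc m)) → List (Vector (suc (suc m))) → List (Vector (suc (suc m)))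
  stack []      X = X
  stack (e ∷ T) X = stack T (vec (embedEdge v e) ∷ X)

  rooted : Fin (suc m) → Form (suc (suc m))
  rooted r = ground (δ v) (ground (δ (emb r)) detForm)

  tree-determinant : ∀ r T → square (rooted r) (stack T []) ≡ bit (isSpanningTree T)
  tree-determinant r T = begin
    square (rooted r) (stack T [])        ≡⟨ square-perm (rooted r) (↭-trans (stack-↭ T []) (↭-reflexive (List.++-identityʳ (arcs T)))) ⟩
    square (rooted r) (arcs T)            ≡⟨ square-neg detForm {δ (emb r) ∷ δ v ∷ arcs T} {δ v ∷ δ (emb r) ∷ arcs T} (swap-at (alternating detForm) [] (δ (emb r)) (δ v) (arcs T)) ⟩
    square F (δ (emb r) ∷ arcs T)         ≡⟨ cong (λ d → d * d) (change-root r Fin.zero T) ⟩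
    square F (δ (emb Fin.zero) ∷ arcs T)  ≡⟨ tree-determinant₀ T ⟩
    bit (isSpanningTree T) ∎
    where
    open ≡-Reasoning
    stack-↭ : ∀ T X → stack T X ↭ arcs T ++ X
    stack-↭ []      X = ↭-refl
    stack-↭ (e ∷ T) X = ↭-trans (stack-↭ T (vec (embedEdge v e) ∷ X)) (↭.shift (vec (embedEdge v e)) (arcs T) X)

  -- The matrix-tree theorem, by induction on the edges. The predicate and X are general because
  -- choosing e replaces them by `λ T → tree (e ∷ T)` and by X with the vector of e in front;
  -- rejecting e contributes the factor α, as in the recursion of `D`.
  masked-sum : ∀ (F : Form (suc (suc m))) (tree : List (Edge (suc m)) → Bool) X → (∀ T → square F (stack T X) ≡ bit (tree T)) → ∀ ws →
    + sumL (map (λ k → if tree (select k (map proj₁ ws)) then productL (select (complement k) (map proj₂ ws)) else 0)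
                (masks (length (map proj₁ ws)))) ≡ D F (map (mapFst (embedEdge v)) ws) X X
  masked-sum F tree X hyp [] = ≡.trans (base (tree [])) (≡.sym (hyp []))
    where base : ∀ b → + sumL ((if b then 1 else 0) ∷ []) ≡ bit b
          base true  = ≡.refl
          base false = ≡.refl
  masked-sum F tree X hyp ((e , α) ∷ ws) = begin
    + sumL (map g (map (true ∷_) M ++ (map (false ∷_) M ++ [])))
      ≡⟨ cong (λ l → + sumL (map g (map (true ∷_) M ++ l))) (List.++-identityʳ (map (false ∷_) M)) ⟩
    + sumL (map g (map (true ∷_) M ++ map (false ∷_) M))
      ≡⟨ cong (λ l → + sumL l) (List.map-++ g (map (true ∷_) M) (map (false ∷_) M)) ⟩
    + sumL (map g (map (true ∷_) M) ++ map g (map (false ∷_) M))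
      ≡⟨ cong +_ (sumL-++ (map g (map (true ∷_) M)) (map g (map (false ∷_) M))) ⟩
    + (sumL (map g (map (true ∷_) M)) ℕ.+ sumL (map g (map (false ∷_) M)))
      ≡⟨ cong₂ (λ a b → + (sumL a ℕ.+ sumL b)) (≡.sym (List.map-∘ M)) (≡.sym (List.map-∘ M)) ⟩
    + (sumL (map (λ k → g (true ∷ k)) M) ℕ.+ sumL (map (λ k → g (false ∷ k)) M))
      ≡⟨ cong (λ s → + (sumL (map (λ k → g (true ∷ k)) M) ℕ.+ s)) (scale M) ⟩
    + (sumL (map (λ k → g (true ∷ k)) M) ℕ.+ α ℕ.* sumL (map h M))
      ≡⟨ ℤₚ.pos-+ (sumL (map (λ k → g (true ∷ k)) M)) (α ℕ.* sumL (map h M)) ⟩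
    + sumL (map (λ k → g (true ∷ k)) M) + + (α ℕ.* sumL (map h M))
      ≡⟨ cong₂ _+_ (masked-sum F (λ T → tree (e ∷ T)) (vec (embedEdge v e) ∷ X) (λ T → hyp (e ∷ T)) ws)
                   (≡.trans (ℤₚ.pos-* α (sumL (map h M))) (cong (+ α *_) (masked-sum F tree X hyp ws))) ⟩
    D F ws′ (vec (embedEdge v e) ∷ X) (vec (embedEdge v e) ∷ X) + + α * D F ws′ X X
      ≡⟨ ℤₚ.+-comm (D F ws′ (vec (embedEdge v e) ∷ X) (vec (embedEdge v e) ∷ X)) (+ α * D F ws′ X X) ⟩
    + α * D F ws′ X X + D F ws′ (vec (embedEdge v e) ∷ X) (vec (embedEdge v e) ∷ X) ∎
    where
    open ≡-Reasoning
    ws′ = map (mapFst (embedEdge v)) ws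
    M = masks (length (map proj₁ ws))
    g h : List Bool → ℕ
    g k = if tree (select k (e ∷ map proj₁ ws)) then productL (select (complement k) (α ∷ map proj₂ ws)) else 0
    h k = if tree (select k (map proj₁ ws)) then productL (select (complement k) (map proj₂ ws)) else 0
    sumL-++ : ∀ xs ys → sumL (xs ++ ys) ≡ sumL xs ℕ.+ sumL ys
    sumL-++ []       ys = ≡.refl
    sumL-++ (x ∷ xs) ys = ≡.trans (cong (x ℕ.+_) (sumL-++ xs ys)) (≡.sym (ℕₚ.+-assoc x (sumL xs) (sumL ys)))
    pull : ∀ b x → (if b then α ℕ.* x else 0) ≡ α ℕ.* (if b then x else 0)
    pull true  x = ≡.refl
    pull false x = ≡.sym (ℕₚ.*-zeroʳ α)
    scale : ∀ M → sumL (map (λ k → g (false ∷ k)) M) ≡ α ℕ.* sumL (map h M)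
    scale []      = ≡.sym (ℕₚ.*-zeroʳ α)
    scale (k ∷ M) = ≡.trans (cong₂ ℕ._+_ (pull (tree (select k (map proj₁ ws))) _) (scale M)) (≡.sym (ℕₚ.*-distribˡ-+ α (h k) (sumL (map h M))))

  kirchhoff-as-D : ∀ (H : Graph (suc m)) {r} → v ≢ r → ∀ ws → map proj₁ ws ≡ edges H →
    + kirchhoff H (map proj₂ ws) ≡ D (ground (δ v) (ground (δ r) detForm)) (map (mapFst (embedEdge v)) ws) [] []
  kirchhoff-as-D H {r} v≢r ws eq = ≡.trans (cong +_ (kirchhoff-masks H ws eq))
    (masked-sum (ground (δ v) (ground (δ r) detForm)) isSpanningTree [] (at (punchIn-punchOut v≢r)) ws)
    where
    at : ∀ {i r} → emb i ≡ r → ∀ T → square (ground (δ v) (ground (δ r) detForm)) (stack T []) ≡ bit (isSpanningTree T)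
    at {i} ≡.refl = tree-determinant i

-- Edges and neighbours in a graph

∈-bfilter⁺ : ∀ {A : Set} (P : A → Bool) {x xs} → x ∈ xs → P x ≡ true → x ∈ bfilter P xs
∈-bfilter⁺ P {xs = y ∷ ys} (here ≡.refl) eq rewrite eq = here ≡.refl
∈-bfilter⁺ P {xs = y ∷ ys} (there x∈) eq with P y
... | true  = there (∈-bfilter⁺ P x∈ eq)
... | false = ∈-bfilter⁺ P x∈ eq

∈-bfilter⁻ : ∀ {A : Set} (P : A → Bool) {x} xs → x ∈ bfilter P xs → x ∈ xs × P x ≡ true
∈-bfilter⁻ P (y ∷ ys) x∈ with P y in eq
∈-bfilter⁻ P (y ∷ ys) (here ≡.refl) | true = here ≡.refl , eq
∈-bfilter⁻ P (y ∷ ys) (there x∈)    | true = let x∈′ , px = ∈-bfilter⁻ P ys x∈ in there x∈′ , px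
∈-bfilter⁻ P (y ∷ ys) x∈            | false = let x∈′ , px = ∈-bfilter⁻ P ys x∈ in there x∈′ , px

bfilter-unique : ∀ {A : Set} (P : A → Bool) {xs} → Unique xs → Unique (bfilter P xs)
bfilter-unique P [] = []
bfilter-unique P {x ∷ xs} (x∉ ∷ u) with P x
... | true  = All.tabulate (λ {y} y∈ → All.lookup x∉ (proj₁ (∈-bfilter⁻ P xs y∈))) ∷ bfilter-unique P u
... | false = bfilter-unique P u

T⇒true : ∀ {b} → Bool.T b → b ≡ true
T⇒true {true} _ = ≡.refl

true⇒T : ∀ {b} → b ≡ true → Bool.T b
true⇒T ≡.refl = tt

∧-intro : ∀ {a b} → a ≡ true → b ≡ true → a ∧ b ≡ true
∧-intro ≡.refl ≡.refl = ≡.refl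

true≢false : true ≢ false
true≢false ()

allPairs : ∀ n → List (Edge n)
allPairs n = concatMap (λ i → map (λ j → i , j) (allFin n)) (allFin n)

allPairs-product : ∀ n → allPairs n ≡ cartesianProduct (allFin n) (allFin n)
allPairs-product n = go (allFin n)
  where
  go : ∀ xs → concatMap (λ i → map (λ j → i , j) (allFin n)) xs ≡ cartesianProduct xs (allFin n)
  go []       = ≡.refl
  go (x ∷ xs) = cong (map (x ,_) (allFin n) ++_) (go xs)

∈-allPairs : ∀ {n} (e : Edge n) → e ∈ allPairs n
∈-allPairs {n} (i , j) = subst ((i , j) ∈_) (≡.sym (allPairs-product n)) (∈-cartesianProduct⁺ (∈-allFin i) (∈-allFin j))

allPairs-unique : ∀ n → Unique (allPairs n)
allPairs-unique n = subst Unique (≡.sym (allPairs-product n)) (Unique.cartesianProduct⁺ (Unique.allFin⁺ n) (Unique.allFin⁺ n))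

adjacent⇒≢ : ∀ {n} (G : Graph n) {i j} → adj G i j ≡ true → i ≢ j
adjacent⇒≢ G {i} eq ≡.refl = true≢false (≡.trans (≡.sym eq) (irrefl G i))

-- The edges of the subgraph induced on S, each once and increasing, as in `edges`, but in any
-- order: two such lists are permutations of each other.
record EdgeList {n} (G : Graph n) (S : Fin n → Set) (es : List (Edge n)) : Set where
  field
    unique   : Unique es
    sound    : ∀ {i j} → (i , j) ∈ es → adj G i j ≡ true × toℕ i ℕ.< toℕ j × S i × S j
    complete : ∀ {i j} → adj G i j ≡ true → toℕ i ℕ.< toℕ j → S i → S j → (i , j) ∈ es

record Neighbours {n} (G : Graph n) (S : Fin n → Set) (u : Fin n) (ts : List (Fin n)) : Set where
  field
    unique   : Unique ts
    sound    : ∀ {t} → t ∈ ts → adj G u t ≡ true × S t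
    complete : ∀ {t} → adj G u t ≡ true → S t → t ∈ ts

module _ {n} (G : Graph n) where

  edgeList : {S : Fin n → Set} → (∀ i → Dec (S i)) → ∃ (EdgeList G S)
  edgeList {S} S? = bfilter P (allPairs n) , record
    { unique   = bfilter-unique P (allPairs-unique n)
    ; sound    = λ {i} {j} e∈ →
        let ij , rest = ∧-elim (adj G i j) _ (proj₂ (∈-bfilter⁻ P (allPairs n) e∈))
            lt , inS  = ∧-elim (toℕ i <ᵇ toℕ j) _ rest
            si , sj   = ∧-elim (does (S? i)) _ inS
        in ij , ℕₚ.<ᵇ⇒< (toℕ i) (toℕ j) (true⇒T lt) , fromDec (S? i) si , fromDec (S? j) sj
    ; complete = λ {i} {j} ij lt si sj → ∈-bfilter⁺ P (∈-allPairs (i , j))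
        (∧-intro ij (∧-intro (T⇒true (ℕₚ.<⇒<ᵇ lt)) (∧-intro (toDec (S? i) si) (toDec (S? j) sj)))) }
    where
    P : Edge n → Bool
    P (i , j) = adj G i j ∧ ((toℕ i <ᵇ toℕ j) ∧ (does (S? i) ∧ does (S? j)))
    fromDec : ∀ {A : Set} (d : Dec A) → does d ≡ true → A
    fromDec (yes a) _ = a
    toDec : ∀ {A : Set} (d : Dec A) → A → does d ≡ true
    toDec (yes _) _ = ≡.refl
    toDec (no ¬a) a = ⊥-elim (¬a a)

  EdgeList-map : ∀ {S S′ : Fin n → Set} {es} → (∀ {i} → S i → S′ i) → (∀ {i} → S′ i → S i) →
                 EdgeList G S es → EdgeList G S′ es
  EdgeList-map to from E = record
    { unique   = EdgeList.unique E
    ; sound    = λ e∈ → let ij , lt , si , sj = EdgeList.sound E e∈ in ij , lt , to si , to sj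
    ; complete = λ ij lt si sj → EdgeList.complete E ij lt (from si) (from sj) }

  norm : Fin n → Fin n → Edge n
  norm u t with toℕ u ℕ.<? toℕ t
  ... | yes _ = u , t
  ... | no _  = t , u

  norm-< : ∀ {u t} → toℕ u ℕ.< toℕ t → norm u t ≡ (u , t)
  norm-< {u} {t} lt with toℕ u ℕ.<? toℕ t
  ... | yes _ = ≡.refl
  ... | no ¬lt = ⊥-elim (¬lt lt)

  norm-> : ∀ {u t} → toℕ t ℕ.< toℕ u → norm u t ≡ (t , u)
  norm-> {u} {t} gt with toℕ u ℕ.<? toℕ t
  ... | yes lt = ⊥-elim (ℕₚ.<-asym gt lt)
  ... | no _ = ≡.refl

  norm-injective : ∀ u {t t′} → norm u t ≡ norm u t′ → t ≡ t′
  norm-injective u {t} {t′} eq with toℕ u ℕ.<? toℕ t | toℕ u ℕ.<? toℕ t′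
  norm-injective u ≡.refl | yes _ | yes _ = ≡.refl
  norm-injective u ≡.refl | yes _ | no _  = ≡.refl
  norm-injective u ≡.refl | no _  | yes _ = ≡.refl
  norm-injective u ≡.refl | no _  | no _  = ≡.refl

  norm-flip : ∀ u ts es → Reorder flipPair (map (norm u) ts ++ es) (map (u ,_) ts ++ es)
  norm-flip u []       es = refl
  norm-flip u (t ∷ ts) es with toℕ u ℕ.<? toℕ t
  ... | yes _ = prep (u , t) (norm-flip u ts es)
  ... | no _  = trans (flip (t , u)) (prep (u , t) (norm-flip u ts es))

  module _ {S : Fin n → Set} {u : Fin n} where

    -- Elimination expects the edges at u in front and directed away from u, whereas edge lists are
    -- increasing; this is where the reversals in `Reorder` come from.
    peel : ∀ {es ts es′} → S u → EdgeList G S es → Neighbours G S u ts → EdgeList G (λ i → S i × i ≢ u) es′ →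
           Reorder flipPair es (map (u ,_) ts ++ es′)
    peel {es} {ts} {es′} Su E Nb E′ = trans (↭⇒Reorder (same-members⇒↭ (EdgeList.unique E) unique′ to from)) (norm-flip u ts es′)
      where
      normal : ∀ {e} → e ∈ map (norm u) ts → (∃ λ t → t ∈ ts × toℕ u ℕ.< toℕ t × e ≡ (u , t)) ⊎ (∃ λ t → t ∈ ts × toℕ t ℕ.< toℕ u × e ≡ (t , u))
      normal e∈ with ∈-map⁻ (norm u) e∈
      ... | t , t∈ , eq with ℕₚ.<-cmp (toℕ u) (toℕ t)
      ... | tri< lt _ _ = inj₁ (t , t∈ , lt , ≡.trans eq (norm-< lt))
      ... | tri> _ _ gt = inj₂ (t , t∈ , gt , ≡.trans eq (norm-> gt))
      ... | tri≈ _ e _  = ⊥-elim (adjacent⇒≢ G (proj₁ (Neighbours.sound Nb t∈)) (toℕ-injective e))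
      disjoint : ∀ {e} → e ∈ map (norm u) ts × e ∈ es′ → ⊥
      disjoint (e∈ , e∈′) with normal e∈
      ... | inj₁ (t , _ , _ , ≡.refl) = let _ , _ , su , _ = EdgeList.sound E′ e∈′ in proj₂ su ≡.refl
      ... | inj₂ (t , _ , _ , ≡.refl) = let _ , _ , _ , su = EdgeList.sound E′ e∈′ in proj₂ su ≡.refl
      unique′ : Unique (map (norm u) ts ++ es′)
      unique′ = Unique.++⁺ (Unique.map⁺ (norm-injective u) (Neighbours.unique Nb)) (EdgeList.unique E′) disjoint
      to : ∀ {e} → e ∈ es → e ∈ map (norm u) ts ++ es′
      to {i , j} e∈ with EdgeList.sound E e∈ | i ≟ u | j ≟ u
      ... | ij , lt , si , sj | yes ≡.refl | _ =
        ∈-++⁺ˡ (subst (_∈ map (norm u) ts) (norm-< lt) (∈-map⁺ (norm u) (Neighbours.complete Nb ij sj)))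
      ... | ij , lt , si , sj | no _ | yes ≡.refl =
        ∈-++⁺ˡ (subst (_∈ map (norm u) ts) (norm-> lt) (∈-map⁺ (norm u) (Neighbours.complete Nb (≡.trans (Graph.sym G u i) ij) si)))
      ... | ij , lt , si , sj | no i≢u | no j≢u =
        ∈-++⁺ʳ (map (norm u) ts) (EdgeList.complete E′ ij lt (si , i≢u) (sj , j≢u))
      from : ∀ {e} → e ∈ map (norm u) ts ++ es′ → e ∈ es
      from {i , j} e∈ with ∈-++⁻ (map (norm u) ts) e∈
      ... | inj₂ e∈′ = let ij , lt , si , sj = EdgeList.sound E′ e∈′ in EdgeList.complete E ij lt (proj₁ si) (proj₁ sj)
      ... | inj₁ e∈′ with normal e∈′
      ... | inj₁ (t , t∈ , lt , ≡.refl) = let ut , st = Neighbours.sound Nb t∈ in EdgeList.complete E ut lt Su st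
      ... | inj₂ (t , t∈ , gt , ≡.refl) = let ut , st = Neighbours.sound Nb t∈ in EdgeList.complete E (≡.trans (Graph.sym G t u) ut) gt st Su

    avoids : ∀ {es} → EdgeList G (λ i → S i × i ≢ u) es → Avoids u es
    avoids E = All.tabulate (λ {(i , j)} e∈ → let _ , _ , si , sj = EdgeList.sound E e∈ in
                 cong₂ _-_ (δ-distinct (proj₂ si)) (δ-distinct (proj₂ sj)))

    Neighbours-↭ : ∀ {ts ts′} → ts ↭ ts′ → Neighbours G S u ts → Neighbours G S u ts′
    Neighbours-↭ p Nb = record
      { unique = Unique-resp-↭ p (Neighbours.unique Nb)
      ; sound = λ t∈ → Neighbours.sound Nb (↭.∈-resp-↭ (↭-sym p) t∈)
      ; complete = λ ut st → ↭.∈-resp-↭ p (Neighbours.complete Nb ut st) }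

    remove : ∀ {ts t} → Neighbours G S u ts → t ∈ ts →
             ∃ λ ts′ → ts ↭ t ∷ ts′ × Neighbours G (λ i → S i × i ≢ t) u ts′
    remove {ts} {t} Nb t∈ with extract t∈
    ... | ts′ , p = ts′ , p , from (Neighbours-↭ p Nb)
      where
      from : Neighbours G S u (t ∷ ts′) → Neighbours G (λ i → S i × i ≢ t) u ts′
      from Nb with Neighbours.unique Nb
      ... | t∉ ∷ uq = record
        { unique = uq
        ; sound = λ x∈ → let ux , sx = Neighbours.sound Nb (there x∈) in ux , sx , λ x≡t → All.lookup t∉ x∈ (≡.sym x≡t)
        ; complete = λ ux (sx , x≢t) → drop x≢t (Neighbours.complete Nb ux sx) }
        where
        drop : ∀ {x} → x ≢ t → x ∈ t ∷ ts′ → x ∈ ts′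
        drop x≢t (here x≡t) = ⊥-elim (x≢t x≡t)
        drop x≢t (there x∈) = x∈

    nonremove : ∀ {ts t} → Neighbours G S u ts → adj G u t ≢ true → Neighbours G (λ i → S i × i ≢ t) u ts
    nonremove {ts} {t} Nb ¬ut = record
      { unique = Neighbours.unique Nb
      ; sound = λ x∈ → let ux , sx = Neighbours.sound Nb x∈ in ux , sx , λ { ≡.refl → ¬ut ux }
      ; complete = λ ux (sx , _) → Neighbours.complete Nb ux sx }

  neighbours : ∀ u → Neighbours G (λ _ → ⊤) u (bfilter (adj G u) (allFin n))
  neighbours u = record
    { unique = bfilter-unique (adj G u) (Unique.allFin⁺ n)
    ; sound = λ t∈ → proj₂ (∈-bfilter⁻ (adj G u) (allFin n) t∈) , tt
    ; complete = λ ut _ → ∈-bfilter⁺ (adj G u) (∈-allFin _) ut }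

  Neighbours-map : ∀ {S S′ : Fin n → Set} {u ts} → (∀ {i} → S i → S′ i) → (∀ {i} → S′ i → S i) →
                   Neighbours G S u ts → Neighbours G S′ u ts
  Neighbours-map to from Nb = record
    { unique   = Neighbours.unique Nb
    ; sound    = λ t∈ → let ut , st = Neighbours.sound Nb t∈ in ut , to st
    ; complete = λ ut st → Neighbours.complete Nb ut (from st) }

module _ {n} (G : Graph (suc n)) (v : Fin (suc n)) where

  private
    emb : Fin n → Fin (suc n)
    emb = punchIn v

    P : Edge n → Bool
    P e = adj G (emb (proj₁ e)) (emb (proj₂ e)) ∧ (toℕ (proj₁ e) <ᵇ toℕ (proj₂ e))

  -- `punchIn v` is strictly increasing, so edges of the deleted graph keep their orientation inside
  -- G and both deletions can be treated on the same vertex set.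
  edges-deleteVertex : EdgeList G (λ i → i ≢ v) (map (embedEdge v) (edges (deleteVertex G v)))
  edges-deleteVertex = record { unique = Unique.map⁺ inj (bfilter-unique P (allPairs-unique n)) ; sound = snd ; complete = cmp }
    where
    inj : ∀ {e e′ : Edge n} → embedEdge v e ≡ embedEdge v e′ → e ≡ e′
    inj eq = cong₂ _,_ (punchIn-injective v _ _ (cong proj₁ eq)) (punchIn-injective v _ _ (cong proj₂ eq))
    <⇒emb< : ∀ {s t} → toℕ s ℕ.< toℕ t → toℕ (emb s) ℕ.< toℕ (emb t)
    <⇒emb< {s} {t} lt = ℕₚ.≤∧≢⇒< (punchIn-mono-≤ v s t (ℕₚ.<⇒≤ lt))
      (λ e → ℕₚ.<⇒≢ lt (cong toℕ (punchIn-injective v s t (toℕ-injective e))))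
    emb<⇒< : ∀ {s t} → toℕ (emb s) ℕ.< toℕ (emb t) → toℕ s ℕ.< toℕ t
    emb<⇒< {s} {t} lt = ℕₚ.≤∧≢⇒< (punchIn-cancel-≤ v s t (ℕₚ.<⇒≤ lt))
      (λ e → ℕₚ.<⇒≢ lt (cong (λ x → toℕ (emb x)) (toℕ-injective e)))
    snd : ∀ {i j} → (i , j) ∈ map (embedEdge v) (edges (deleteVertex G v)) →
          adj G i j ≡ true × toℕ i ℕ.< toℕ j × i ≢ v × j ≢ v
    snd e∈ with ∈-map⁻ _ e∈
    ... | (s , t) , st∈ , ≡.refl =
      let st , lt = ∧-elim (adj G (emb s) (emb t)) _ (proj₂ (∈-bfilter⁻ P (allPairs n) st∈))
      in st , <⇒emb< (ℕₚ.<ᵇ⇒< (toℕ s) (toℕ t) (true⇒T lt)) , punchInᵢ≢i v s , punchInᵢ≢i v t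
    cmp : ∀ {i j} → adj G i j ≡ true → toℕ i ℕ.< toℕ j → i ≢ v → j ≢ v →
          (i , j) ∈ map (embedEdge v) (edges (deleteVertex G v))
    cmp {i} {j} ij lt i≢v j≢v = go (punchIn-punchOut (λ e → i≢v (≡.sym e))) (punchIn-punchOut (λ e → j≢v (≡.sym e))) ij lt
      where
      go : ∀ {i j s t} → emb s ≡ i → emb t ≡ j → adj G i j ≡ true → toℕ i ℕ.< toℕ j →
           (i , j) ∈ map (embedEdge v) (edges (deleteVertex G v))
      go {s = s} {t} ≡.refl ≡.refl st lt =
        ∈-map⁺ _ (∈-bfilter⁺ P (∈-allPairs (s , t)) (∧-intro st (T⇒true (ℕₚ.<⇒<ᵇ (emb<⇒< lt)))))

-- Neighbourhoods in a 4-regular graph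

singleton : ∀ {A : Set} (xs : List A) → length xs ≡ 1 → ∃ λ x → xs ≡ x ∷ []
singleton (x ∷ []) _ = x , ≡.refl

pair : ∀ {A : Set} (xs : List A) → length xs ≡ 2 → ∃ λ x → ∃ λ y → xs ≡ x ∷ y ∷ []
pair (x ∷ y ∷ []) _ = x , y , ≡.refl

module _ {n} (G : Graph n) where

  third-neighbour : ∀ {v w a b} → degree G w ≡ 4 → adj G w v ≡ true → adj G w a ≡ true → adj G w b ≡ true →
    a ≢ v → b ≢ v → a ≢ b →
    ∃ λ x → x ≢ v × x ≢ w × x ≢ a × x ≢ b × Neighbours G (λ i → i ≢ v) w (a ∷ b ∷ x ∷ [])
  third-neighbour {v} {w} {a} {b} deg wv wa wb a≢v b≢v a≢b =
    let N₄           = neighbours G w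
        ts₃ , p₃ , N₃ = remove G N₄ (Neighbours.complete N₄ wv tt)
        ts₂ , p₂ , N₂ = remove G N₃ (Neighbours.complete N₃ wa (tt , a≢v))
        ts₁ , p₁ , N₁ = remove G N₂ (Neighbours.complete N₂ wb ((tt , b≢v) , ≢-sym a≢b))
        len₁          = ℕₚ.suc-injective (≡.trans (≡.sym (↭.↭-length p₁)) (ℕₚ.suc-injective (≡.trans (≡.sym (↭.↭-length p₂))
                          (ℕₚ.suc-injective (≡.trans (≡.sym (↭.↭-length p₃)) deg)))))
        x , eq        = singleton ts₁ len₁
        wx , ((_ , x≢v) , x≢a) , x≢b = Neighbours.sound N₁ (subst (x ∈_) (≡.sym eq) (here ≡.refl))
    in x , x≢v , (λ x≡w → adjacent⇒≢ G wx (≡.sym x≡w)) , x≢a , x≢b ,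
       Neighbours-map G proj₂ (tt ,_) (Neighbours-↭ G (↭-trans p₂ (↭.prep a (subst (λ l → ts₂ ↭ b ∷ l) eq p₁))) N₃)

  other-neighbours : ∀ {v w a} → degree G a ≡ 4 → adj G a v ≡ true → adj G a w ≡ true → w ≢ v →
    ∃ λ x → ∃ λ y → Neighbours G (λ i → i ≢ v × i ≢ w) a (x ∷ y ∷ [])
  other-neighbours {v} {w} {a} deg av aw w≢v =
    let N₄            = neighbours G a
        ts₃ , p₃ , N₃ = remove G N₄ (Neighbours.complete N₄ av tt)
        ts₂ , p₂ , N₂ = remove G N₃ (Neighbours.complete N₃ aw (tt , w≢v))
        x , y , eq    = pair ts₂ (ℕₚ.suc-injective (≡.trans (≡.sym (↭.↭-length p₂)) (ℕₚ.suc-injective (≡.trans (≡.sym (↭.↭-length p₃)) deg))))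
    in x , y , subst (Neighbours G _ a) eq (Neighbours-map G (λ ((_ , i≢v) , i≢w) → i≢v , i≢w) (λ (i≢v , i≢w) → (tt , i≢v) , i≢w) N₂)

ground₂-zeroColumn : ∀ {N} {r v u : Fin N} → r ≢ u → v ≢ u → ZeroColumn (ground (δ v) (ground (δ r) detForm)) u
ground₂-zeroColumn {r = r} {v} {u} r≢u v≢u =
  ground-zeroColumn {F = ground (δ r) detForm} (ground-zeroColumn {F = detForm} (det-zeroColumn u) (δ-distinct r≢u)) (δ-distinct v≢u)

ground₃-zeroColumn : ∀ {N} {r v w u : Fin N} → r ≢ u → v ≢ u → w ≢ u →
                     ZeroColumn (ground (δ w) (ground (δ v) (ground (δ r) detForm))) u
ground₃-zeroColumn {r = r} {v} r≢u v≢u w≢u =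
  ground-zeroColumn {F = ground (δ v) (ground (δ r) detForm)} (ground₂-zeroColumn r≢u v≢u) (δ-distinct w≢u)

-- Comparing the two vertex deletions

module _ (p : ℕ) (prime : Prime p) where

  open Modular p prime
  open Reduction p prime
  open Invariant p prime

  indicator-reorder : ∀ {N} (F : Form N) a b c {ws ws′} → Reorder (mapFst flipPair) ws ws′ →
                      indicator F a b c ws ≡ indicator F a b c ws′
  indicator-reorder F a b c r rewrite D-reorder F r [] [] | D-reorder F r (b ⊖ a ∷ []) (b ⊖ a ∷ [])
    | D-reorder F r (b ⊖ c ∷ []) (b ⊖ c ∷ []) = ≡.refl

  indicator-neg : ∀ {N} {F F′ : Form N} → (∀ X → ⟦ F′ ⟧ X ≡ - ⟦ F ⟧ X) → ∀ a b c ws →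
                  indicator F′ a b c ws ≡ indicator F a b c ws
  indicator-neg {F = F} {F′} neg a b c ws rewrite D-neg {F = F} {F′} neg ws [] [] | D-neg {F = F} {F′} neg ws (b ⊖ a ∷ []) (b ⊖ a ∷ [])
    | D-neg {F = F} {F′} neg ws (b ⊖ c ∷ []) (b ⊖ c ∷ []) = ≡.refl

  zeroCount-via-star : ∀ {n N} (H : Graph n) (φ : Edge n → Edge N) (F : Form N) {w a b x K} → ZeroColumn F w →
    a ≢ w → b ≢ w → x ≢ w → Avoids w K →
    (∀ ws → map proj₁ ws ≡ edges H → + kirchhoff H (map proj₂ ws) ≡ D F (map (mapFst φ) ws) [] []) →
    Reorder flipPair (map φ (edges H)) ((w , a) ∷ (w , b) ∷ (w , x) ∷ K) →
    Reduced (+ zeroCount p H) (∑F K (indicator (ground (δ w) F) a b x))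
  zeroCount-via-star H φ F {w} {a} {b} {x} {K} zc a≢w b≢w x≢w avoid asD order =
    subst (λ z → Reduced z (∑F K (indicator (ground (δ w) F) a b x)))
      (≡.sym (≡.trans (zeroCount-as-sum H φ (λ ws → D F ws [] []) asD)
                      (∑pts-reorder residues order (λ ρ → cong zero? (D-reorder F ρ [] [])))))
      (star-sum F zc a≢w b≢w x≢w avoid)

  zeroCount-star : ∀ {m} (G : Graph (suc (suc m))) {v w a b x r : Fin (suc (suc m))} {K} →
    v ≢ w → v ≢ r → r ≢ w → a ≢ w → b ≢ w → x ≢ w →
    Neighbours G (λ i → i ≢ v) w (a ∷ b ∷ x ∷ []) → EdgeList G (λ i → i ≢ v × i ≢ w) K →
    Reduced (+ zeroCount p (deleteVertex G v)) (∑F K (indicator (ground (δ w) (ground (δ v) (ground (δ r) detForm))) a b x))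
  zeroCount-star G {v} {w} {r = r} v≢w v≢r r≢w a≢w b≢w x≢w Nb EK =
    zeroCount-via-star (deleteVertex G v) (embedEdge v) (ground (δ v) (ground (δ r) detForm))
      (ground₂-zeroColumn r≢w v≢w)
      a≢w b≢w x≢w (avoids G EK) (TreeDeterminant.kirchhoff-as-D v (deleteVertex G v) v≢r)
      (peel G (≢-sym v≢w) (edges-deleteVertex G v) Nb EK)

  -- Both a and b lose exactly the neighbours v and w, so two edges remain at each. The edges at a
  -- are peeled off first; an edge ab is then counted at a, and b keeps two edges or one, which is
  -- the distinction between the cases.
  indicator-sum-≈ : ∀ {n} (G : Graph n) → FourRegular G → ∀ {v w a b c d} (F : Form n) {K} →
    v ≢ w → adj G a v ≡ true → adj G a w ≡ true → adj G b v ≡ true → adj G b w ≡ true → a ≢ b →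
    c ≢ a → c ≢ b → d ≢ a → d ≢ b → ZeroColumn F a → ZeroColumn F b → EdgeList G (λ i → i ≢ v × i ≢ w) K →
    ∑F K (indicator F a b c) ≈ ∑F K (indicator F a b d)
  indicator-sum-≈ {n} G regular {v} {w} {a} {b} {c} {d} F {K} v≢w av aw bv bw a≢b c≢a c≢b d≢a d≢b zcᵃ zcᵇ EK =
    byCases (adj G b a Bool.≟ true)
    where
    S : Fin n → Set
    S i = i ≢ v × i ≢ w
    a∈S : S a
    a∈S = adjacent⇒≢ G av , adjacent⇒≢ G aw
    b∈S : S b
    b∈S = adjacent⇒≢ G bv , adjacent⇒≢ G bw
    S∖a? : ∀ i → Dec (S i × i ≢ a)
    S∖a? i = (¬? (i ≟ v) ×-dec ¬? (i ≟ w)) ×-dec ¬? (i ≟ a)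
    EL = proj₂ (edgeList G S∖a?)
    EM = proj₂ (edgeList G (λ i → S∖a? i ×-dec ¬? (i ≟ b)))
    M = proj₁ (edgeList G (λ i → S∖a? i ×-dec ¬? (i ≟ b)))
    open ThirdNeighbour F a≢b zcᵃ zcᵇ
    off : ∀ {u} {S : Fin n → Set} {ts t} → Neighbours G S u ts → t ∈ ts → t ≢ u
    off Nb t∈ t≡u = adjacent⇒≢ G (proj₁ (Neighbours.sound Nb t∈)) (≡.sym t≡u)

    arrange : ∀ {ts us} → Neighbours G S a ts → Neighbours G (λ i → S i × i ≢ a) b us →
              Reorder flipPair K (map (a ,_) ts ++ (map (b ,_) us ++ M))
    arrange {ts} Na Nb = trans (peel G a∈S EK Na EL) (append (map (a ,_) ts) (peel G (b∈S , ≢-sym a≢b) EL Nb EM))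
      where
      append : ∀ {A : Set} {φ : A → A} xs {ys zs} → Reorder φ ys zs → Reorder φ (xs ++ ys) (xs ++ zs)
      append []       r = r
      append (x ∷ xs) r = prep x (append xs r)

    avoidᵃ : ∀ {us} → Neighbours G (λ i → S i × i ≢ a) b us → Avoids a (map (b ,_) us ++ M)
    avoidᵃ {us} Nb = All.++⁺ (All.map⁺ (All.tabulate (λ t∈ →
        cong₂ _-_ (δ-distinct (≢-sym a≢b)) (δ-distinct (proj₂ (proj₂ (Neighbours.sound Nb t∈)))))))
      (All.tabulate (λ {(i , j)} e∈ → let _ , _ , si , sj = EdgeList.sound EM e∈ in
        cong₂ _-_ (δ-distinct (proj₂ (proj₁ si))) (δ-distinct (proj₂ (proj₁ sj)))))

    transport : ∀ {K′} → Reorder flipPair K K′ → ∑F K′ (indicator F a b c) ≈ ∑F K′ (indicator F a b d) →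
                ∑F K (indicator F a b c) ≈ ∑F K (indicator F a b d)
    transport ρ e = ≈-trans (≈-reflexive (∑pts-reorder residues ρ (indicator-reorder F a b c)))
      (≈-trans e (≈-reflexive (≡.sym (∑pts-reorder residues ρ (indicator-reorder F a b d)))))

    Goal : Set
    Goal = ∑F K (indicator F a b c) ≈ ∑F K (indicator F a b d)

    apart : ∀ {a₁ a₂ b₁ b₂} → adj G b a ≢ true → Neighbours G S a (a₁ ∷ a₂ ∷ []) → Neighbours G (λ i → S i × i ≢ a) b (b₁ ∷ b₂ ∷ []) → Goal
    apart {a₁} {a₂} {b₁} {b₂} ¬ba Na Nb =
      transport {(a , a₁) ∷ (a , a₂) ∷ (b , b₁) ∷ (b , b₂) ∷ M} (arrange Na Nb)
        (nonadjacent (off Na (here ≡.refl)) (off Na (there (here ≡.refl))) (¬b (here ≡.refl)) (¬b (there (here ≡.refl)))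
          (off Nb (here ≡.refl)) (off Nb (there (here ≡.refl))) (avoidᵃ Nb) (avoids G EM) c≢a c≢b d≢a d≢b)
      where
      ¬b : ∀ {t} → t ∈ a₁ ∷ a₂ ∷ [] → t ≢ b
      ¬b t∈ ≡.refl = ¬ba (≡.trans (Graph.sym G b a) (proj₁ (Neighbours.sound Na t∈)))

    joined : ∀ {a₂ b₁} → Neighbours G S a (b ∷ a₂ ∷ []) → Neighbours G (λ i → S i × i ≢ a) b (b₁ ∷ []) → Goal
    joined {a₂} {b₁} Na Nb =
      transport {(a , b) ∷ (a , a₂) ∷ (b , b₁) ∷ M} (arrange Na Nb)
        (adjacent (off Na (there (here ≡.refl))) (distinct (Neighbours.unique Na)) (off Nb (here ≡.refl))
          (avoidᵃ Nb) (avoids G EM) c≢a c≢b d≢a d≢b)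
      where
      distinct : ∀ {x y : Fin n} → Unique (x ∷ y ∷ []) → y ≢ x
      distinct ((x≢y ∷ _) ∷ _) y≡x = x≢y (≡.sym y≡x)

    byCases : Dec (adj G b a ≡ true) → Goal
    byCases (no ¬ba) =
      let _ , _ , Na = other-neighbours G (regular a) av aw (≢-sym v≢w)
          _ , _ , Nb = other-neighbours G (regular b) bv bw (≢-sym v≢w)
      in apart ¬ba Na (nonremove G Nb ¬ba)
    byCases (yes ba) =
      let _ , _ , Na = other-neighbours G (regular a) av aw (≢-sym v≢w)
          _ , _ , Nb = other-neighbours G (regular b) bv bw (≢-sym v≢w)
          _ , pa , _ = remove G Na (Neighbours.complete Na (≡.trans (Graph.sym G a b) ba) b∈S)
          _ , pb , Nb′ = remove G Nb (Neighbours.complete Nb ba a∈S)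
          _ , eqa = singleton _ (ℕₚ.suc-injective (≡.sym (↭.↭-length pa)))
          _ , eqb = singleton _ (ℕₚ.suc-injective (≡.sym (↭.↭-length pb)))
      in joined (Neighbours-↭ G (subst (λ l → _ ↭ b ∷ l) eqa pa) Na) (subst (Neighbours G _ b) eqb Nb′)

  c2-invariance : ∀ {m} (G : Graph (suc (suc m))) → FourRegular G → ∀ {v w a b} → adj G v w ≡ true →
    adj G v a ≡ true → adj G w a ≡ true → adj G v b ≡ true → adj G w b ≡ true → a ≢ b →
    c2 p (deleteVertex G v) ≡ c2 p (deleteVertex G w)
  c2-invariance G regular {v} {w} {a} {b} vw va wa vb wb a≢b =
    let wv  = ≡.trans (Graph.sym G w v) vw
        v≢w = adjacent⇒≢ G vw
        a≢v = ≢-sym (adjacent⇒≢ G va)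
        a≢w = ≢-sym (adjacent⇒≢ G wa)
        b≢v = ≢-sym (adjacent⇒≢ G vb)
        b≢w = ≢-sym (adjacent⇒≢ G wb)
        c , c≢v , c≢w , c≢a , c≢b , Nw = third-neighbour G (regular w) wv wa wb a≢v b≢v a≢b
        d , d≢w , d≢v , d≢a , d≢b , Nv = third-neighbour G (regular v) vw va vb a≢w b≢w a≢b
        K , EK = edgeList G (λ i → ¬? (i ≟ v) ×-dec ¬? (i ≟ w))
        -- The root c is a vertex of both deletions and differs from a and b, so the coordinates a
        -- and b stay live for the eliminations.
        F  = ground (δ w) (ground (δ v) (ground (δ c) detForm))
        R  = zeroCount-star G v≢w (≢-sym c≢v) c≢w a≢w b≢w c≢w Nw EK
        R′ = zeroCount-star G (≢-sym v≢w) (≢-sym c≢w) c≢v a≢v b≢v d≢v Nv (EdgeList-map G flipPair flipPair EK)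
    in c2-from-sums (deleteVertex G v) (deleteVertex G w) R R′
      (≈-trans (indicator-sum-≈ G regular F v≢w (≡.trans (Graph.sym G a v) va) (≡.trans (Graph.sym G a w) wa)
                  (≡.trans (Graph.sym G b v) vb) (≡.trans (Graph.sym G b w) wb) a≢b c≢a c≢b d≢a d≢b
                  (ground₃-zeroColumn c≢a (≢-sym a≢v) (≢-sym a≢w)) (ground₃-zeroColumn c≢b (≢-sym b≢v) (≢-sym b≢w)) EK)
        -- In one deletion v is removed and w is the centre of the star, in the other the roles are
        -- exchanged; the two groundings in opposite order differ by a sign.
        (≈-reflexive (≡.sym (∑pts-cong residues K (λ ws _ →
          indicator-neg {F = F} {ground (δ v) (ground (δ w) (ground (δ c) detForm))}
            (λ X → swap-at (alternating detForm) (δ c ∷ []) (δ w) (δ v) X) a b d ws)))))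

theorem7p10 : ∀ {n} (G : Graph (suc n)) → Connected G → FourRegular G →
    (p : ℕ) → Prime p → (v w : Fin (suc n)) → adj G v w ≡ true →
    commonNeighbours G v w ≡ 2 →
    c2 p (deleteVertex G v) ≡ c2 p (deleteVertex G w)
-- With a single vertex the two deletions are the same graph; the determinant description needs at
-- least two.
theorem7p10 {zero} G _ regular p p-prime Fin.zero Fin.zero vw common = ≡.refl
theorem7p10 {suc m} G _ regular p p-prime v w vw common =
  let P              = λ u → adj G v u ∧ adj G w u
      a , b , eq     = pair (bfilter P (allFin _)) common
      unique         = subst Unique eq (bfilter-unique P (Unique.allFin⁺ _))
      adjacencies    = λ {u} (u∈ : u ∈ a ∷ b ∷ []) → ∧-elim (adj G v u) (adj G w u) (proj₂ (∈-bfilter⁻ P (allFin _) (subst (u ∈_) (≡.sym eq) u∈)))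
      va , wa        = adjacencies (here ≡.refl)
      vb , wb        = adjacencies (there (here ≡.refl))
      a≢b            = Unique-head unique
  in c2-invariance p p-prime G regular vw va wa vb wb a≢b
  where
  Unique-head : ∀ {A : Set} {x y : A} {xs} → Unique (x ∷ y ∷ xs) → x ≢ y
  Unique-head ((x≢y ∷ _) ∷ _) = x≢y
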